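{- Let $(\mathcal N,\mathcal O,\mathfrak l)$ be a plabic network representing a point $[A]$ in a positroid cell $\mathcal S_{\mathcal M}^{\mathrm{TNN}}\subset Gr^{\mathrm{TNN}}(k,n)$, with perfect orientation $\mathcal O$ associated to the base $I=\{1\le i_1<\dots<i_k\le n\}$ in the matroid $\mathcal M$ and gauge ray direction $\mathfrak l$. Assign vectors $B_j$ to the boundary sinks $b_j$, $j\in\bar I$. Then for every edge $e$ the edge vector $$E_e=\sum_{j\in\bar I}\Big(\sum_{\mathcal P:e\to b_j}(-1)^{\mathrm{wind}(\mathcal P)+\mathrm{int}(\mathcal P)}w(\mathcal P)\Big)B_j$$ is a rational expression in the weights of the network with subtraction-free denominator: $$E_e=\sum_{j\in\bar I}\left[\frac{\displaystyle\sum_{F\in\mathcal F_{e,b_j}(\mathcal G)}(-1)^{\mathrm{wind}(F)+\mathrm{int}(F)}\,w(F)}{\displaystyle\sum_{C\in\mathcal C(\mathcal G)}w(C)}\right]B_j .$$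
   Context: **Plabic networks.** Let $D$ be a closed convex disk whose boundary contains a straight segment. A plabic graph $\mathcal G$ is a finite directed planar graph embedded in $D$ with straight edges. It has boundary vertices $b_1,\dots,b_n$ on the segment, labelled clockwise, each of degree 1 (a source if its edge is outgoing, a sink otherwise). The remaining (internal) vertices lie inside $D$ and have degree 2 or 3. No component is isolated from the boundary. The graph is perfect: each internal vertex has exactly one incoming edge (then it is white) or exactly one outgoing edge (then it is black); a bivalent vertex has one incoming and one outgoing edge and is given either color. The orientation $\mathcal O$ is called a perfect orientation. $I$ is the set of indices of the boundary sources, $|I|=k$, and $\bar I=[n]\setminus I$. A network $\mathcal N$ is $\mathcal G$ with a positive weight $w_e$ on each edge. $\mathcal M=\mathcal M_{\mathcal G}$ is the set of source sets of all perfect orientations of $\mathcal G$ compatible with the coloring, and $\mathcal S^{\mathrm{TNN}}_{\mathcal M}\subset Gr^{\mathrm{TNN}}(k,n)$ is the set of points whose maximal minors satisfy $\Delta_J>0$ for $J\in\mathcal M$ and $\Delta_J=0$ otherwise. **Gauge rays.** A gauge ray direction $\mathfrak l$ is an oriented direction, not parallel to any edge, such that the rays with direction $\mathfrak l$ starting at boundary vertices point inside $D$ and contain no internal vertices. The gauge rays are the rays $\mathfrak l_{i_r}$ starting at the boundary sources. $\mathrm{int}(e)$ is the number of intersections of the edge $e$ with the gauge rays (the base point of a ray is not counted). **Winding.** For nonzero planar vectors, $s(a,b)=+1,0,-1$ if the ordered pair $(a,b)$ is positively oriented, parallel, negatively oriented respectively. For consecutive directed edges $e,f$: $\mathrm{wind}(e,f)=1$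 if $s(e,f)=s(e,\mathfrak l)=s(\mathfrak l,f)=1$; $\mathrm{wind}(e,f)=-1$ if $s(e,f)=s(e,\mathfrak l)=s(\mathfrak l,f)=-1$; otherwise $0$. **Paths.** For a directed path $\mathcal P=(e_1,\dots,e_m)$ (edges may repeat): $w(\mathcal P)=\prod_l w_{e_l}$, $\mathrm{wind}(\mathcal P)=\sum_{l<m}\mathrm{wind}(e_l,e_{l+1})$, $\mathrm{int}(\mathcal P)=\sum_l\mathrm{int}(e_l)$. Sums over $\mathcal P:e\to b_j$ run over all directed paths with first edge $e$ ending at $b_j$. They are formal power series in the weights (convergent for small weights), and the identity in the claim is an identity of such series. For arbitrary positive weights the rational expression is the meaning of $E_e$. **Flows.** A conservative flow is a collection of distinct edges, none incident to the boundary, with as many edges arriving as leaving at every internal vertex. $\mathcal C(\mathcal G)$ is the set of all of them, including the empty one (weight 1). An edge flow starting at $e$ is a collection $F$ of distinct edges such that: - it contains $e$; - at each internal vertex other than the starting vertex $V$ of $e$ the numbers of arriving and leaving edges of $F$ are equal; - at $V$ the number of arriving edges of $F$ equals the number of leaving edges minus 1; - $F$ contains no edges at boundary sources except possibly $e$. $\mathcal F_{e,b_j}(\mathcal G)$ is the set of edge flows starting at $e$ that contain the boundary sink $b_j$. Each $F\in\mathcal F_{e,b_j}(\mathcal G)$ is the union of an edge loop-erased walk $P$ (a directed path from $e$ to $b_j$ not passing any edge twice) and a (possibly trivial) conservative flow having no common edges with $P$. The weight $w(\cdot)$ of a flow is the product of the weights of its edges; $\mathrm{wind}(F):=\mathrm{wind}(P)$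 and $\mathrm{int}(F):=\mathrm{int}(P)$. -}

module Defs where

open import Algebra.Bundles using (CommutativeRing)
open import Data.Bool using (Bool; true; false; if_then_else_)
open import Data.Fin as Fin using (Fin; zero; suc; toℕ; punchIn)
import Data.Fin.Properties as Fin
open import Data.Fin.Subset as Subset using (Subset; inside; outside; ⁅_⁆; _∪_; _∩_; _∈_)
open import Data.Fin.Subset.Properties using (_∈?_; anySubset?)
open import Data.Integer as ℤ using (ℤ; +_; -[1+_])
open import Data.List as List using (List; []; _∷_; allFin; upTo; filter; foldr; cartesianProductWith; concatMap; head; last; length)
open import Data.List.Relation.Unary.All using (All)
open import Data.List.Relation.Unary.Linked using (Linked; linked?)
open import Data.List.Relation.Unary.Unique.Propositional using (Unique)
import Data.List.Relation.Unary.Unique.DecPropositional as UniqueDec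
open import Data.Maybe as Maybe using (Maybe; just; fromMaybe)
import Data.Maybe.Properties as Maybe
open import Data.Nat as ℕ using (ℕ; zero; suc; _∸_)
import Data.Nat.Properties as ℕ
open import Data.Product using (Σ; ∃; _×_; _,_; proj₁; proj₂)
open import Data.Sum using (_⊎_; inj₁; inj₂)
import Data.Sum.Properties as Sum
open import Data.Vec as Vec using (Vec; []; _∷_; lookup; tabulate)
import Data.Vec.Properties as Vec
import Data.Bool.Properties as Bool
open import Function using (_∘_; _⇔_)
open import Level using (Level; _⊔_) renaming (suc to lsuc)
open import Relation.Binary.Construct.Closure.Equivalence using (EqClosure)
open import Relation.Binary.Core using (Rel)
open import Relation.Binary.Definitions using (DecidableEquality; tri<; tri≈; tri>)
open import Relation.Binary.PropositionalEquality as ≡ using (_≡_; _≢_)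
open import Relation.Binary.Structures using (IsStrictTotalOrder)
open import Relation.Nullary using (¬_; Dec; yes; no)
open import Relation.Nullary.Decidable using (¬?; _×-dec_; _⊎-dec_; _→-dec_; map′)

private
  variable
    n m q : ℕ

-- An ordered field takes the place of ℝ, which is an instance (classically).

record OrderedField (c ℓ₁ ℓ₂ : Level) : Set (lsuc (c ⊔ ℓ₁ ⊔ ℓ₂)) where
  infix 4 _<_
  field
    commutativeRing : CommutativeRing c ℓ₁
  open CommutativeRing commutativeRing public
  field
    _<_                : Rel Carrier ℓ₂
    isStrictTotalOrder : IsStrictTotalOrder _≈_ _<_
    0<1                : 0# < 1#
    +-monoˡ-<          : ∀ {x y} z → x < y → x + z < y + z
    *-pos              : ∀ {x y} → 0# < x → 0# < y → 0# < x * y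
    inverse            : ∀ x → ¬ (x ≈ 0#) → ∃ λ y → x * y ≈ 1#

data Color : Set where
  white black : Color

-- inj₁ i is the boundary vertex b_i, inj₂ v an internal vertex.

Vertex : ℕ → ℕ → Set
Vertex n m = Fin n ⊎ Fin m

_≟ᵥ_ : DecidableEquality (Vertex n m)
_≟ᵥ_ = Sum.≡-dec Fin._≟_ Fin._≟_

record Digraph (n m q : ℕ) : Set where
  field
    src tgt : Fin q → Vertex n m

module _ (G : Digraph n m q) where
  open Digraph G

  inDegree outDegree : Vertex n m → ℕ
  inDegree  v = length (filter (λ e → tgt e ≟ᵥ v) (allFin _))
  outDegree v = length (filter (λ e → src e ≟ᵥ v) (allFin _))

  Source : Fin n → Set
  Source i = ∃ λ e → src e ≡ inj₁ i

  source? : ∀ i → Dec (Source i)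
  source? i = Fin.any? (λ e → src e ≟ᵥ inj₁ i)

  sources sinks : List (Fin n)
  sources = filter source? (allFin n)
  sinks   = filter (¬? ∘ source?) (allFin n)

  Adjacent : Rel (Vertex n m) _
  Adjacent u v = ∃ λ e → src e ≡ u × tgt e ≡ v

  PerfectAt : Color → Vertex n m → Set
  PerfectAt white v = inDegree v ≡ 1
  PerfectAt black v = outDegree v ≡ 1

  Perfect : (Fin m → Color) → Set
  Perfect color = ∀ v → PerfectAt (color v) (inj₂ v)

record IsPlabic (G : Digraph n m q) (color : Fin m → Color) : Set where
  open Digraph G
  field
    boundary-degree : ∀ i → inDegree G (inj₁ i) ℕ.+ outDegree G (inj₁ i) ≡ 1
    internal-degree : ∀ v → let d = inDegree G (inj₂ v) ℕ.+ outDegree G (inj₂ v)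
                            in d ≡ 2 ⊎ d ≡ 3
    perfect         : Perfect G color
    no-isolated     : ∀ v → ∃ λ i → EqClosure (Adjacent G) (inj₂ v) (inj₁ i)

reorient : (Fin q → Bool) → Digraph n m q → Digraph n m q
reorient o G = record
  { src = λ e → if o e then tgt e else src e
  ; tgt = λ e → if o e then src e else tgt e
  } where open Digraph G

Matroid : Digraph n m q → (Fin m → Color) → Subset n → Set
Matroid G color J = ∃ λ o → Perfect (reorient o G) color ×
                            (∀ i → i ∈ J ⇔ Source (reorient o G) i)

sequences : ∀ q → ℕ → List (List (Fin q))
sequences q zero    = [] ∷ []
sequences q (suc l) = cartesianProductWith _∷_ (allFin q) (sequences q l)

subsets : ∀ q → List (Subset q)
subsets zero    = [] ∷ []
subsets (suc q) = cartesianProductWith _∷_ (inside ∷ outside ∷ []) (subsets q)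

edgeSet : List (Fin q) → Subset q
edgeSet = foldr (λ e F → ⁅ e ⁆ ∪ F) Subset.⊥

_≟ₛ_ : DecidableEquality (Subset q)
_≟ₛ_ = Vec.≡-dec Bool._≟_

module _ {n m q : ℕ} (G : Digraph n m q) where
  open Digraph G

  IsPath : Fin q → Fin n → List (Fin q) → Set
  IsPath e j P = Linked (λ f g → tgt f ≡ src g) P
               × head P ≡ just e
               × Maybe.map tgt (last P) ≡ just (inj₁ j)

  isPath? : ∀ e j P → Dec (IsPath e j P)
  isPath? e j P = linked? (λ f g → tgt f ≟ᵥ src g) P
    ×-dec Maybe.≡-dec Fin._≟_ (head P) (just e)
    ×-dec Maybe.≡-dec _≟ᵥ_ (Maybe.map tgt (last P)) (just (inj₁ j))

  arriving leaving : Subset q → Vertex n m → ℕ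
  arriving F v = length (filter (λ f → (f ∈? F) ×-dec (tgt f ≟ᵥ v)) (allFin q))
  leaving  F v = length (filter (λ f → (f ∈? F) ×-dec (src f ≟ᵥ v)) (allFin q))

  Conservative : Subset q → Set
  Conservative C = (∀ f → f ∈ C → ∀ i → src f ≢ inj₁ i × tgt f ≢ inj₁ i)
                 × (∀ v → arriving C (inj₂ v) ≡ leaving C (inj₂ v))

  conservative? : ∀ C → Dec (Conservative C)
  conservative? C =
    Fin.all? (λ f → (f ∈? C) →-dec
      Fin.all? (λ i → ¬? (src f ≟ᵥ inj₁ i) ×-dec ¬? (tgt f ≟ᵥ inj₁ i)))
    ×-dec Fin.all? (λ v → arriving C (inj₂ v) ℕ.≟ leaving C (inj₂ v))

  EdgeFlow : Fin q → Subset q → Set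
  EdgeFlow e F = e ∈ F
    × (∀ v → inj₂ v ≢ src e → arriving F (inj₂ v) ≡ leaving F (inj₂ v))
    × suc (arriving F (src e)) ≡ leaving F (src e)
    × (∀ f → f ∈ F → f ≢ e → ∀ i → src f ≢ inj₁ i)

  EdgeFlowTo : Fin q → Fin n → Subset q → Set
  EdgeFlowTo e j F = EdgeFlow e F × ∃ λ f → f ∈ F × tgt f ≡ inj₁ j

  edgeFlowTo? : ∀ e j F → Dec (EdgeFlowTo e j F)
  edgeFlowTo? e j F =
    ((e ∈? F)
      ×-dec Fin.all? (λ v → ¬? (inj₂ v ≟ᵥ src e) →-dec
                            (arriving F (inj₂ v) ℕ.≟ leaving F (inj₂ v)))
      ×-dec (suc (arriving F (src e)) ℕ.≟ leaving F (src e))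
      ×-dec Fin.all? (λ f → (f ∈? F) →-dec (¬? (f Fin.≟ e) →-dec
                            Fin.all? (λ i → ¬? (src f ≟ᵥ inj₁ i)))))
    ×-dec Fin.any? (λ f → (f ∈? F) ×-dec (tgt f ≟ᵥ inj₁ j))

  conservativeFlows : List (Subset q)
  conservativeFlows = filter conservative? (subsets q)

  edgeFlows : Fin q → Fin n → List (Subset q)
  edgeFlows e j = filter (edgeFlowTo? e j) (subsets q)

  -- P is an edge loop-erased walk from e to b_j, and F is the union of P and
  -- a conservative flow having no common edges with P.

  Decomposes : Fin q → Fin n → Subset q → List (Fin q) → Set
  Decomposes e j F P = IsPath e j P × Unique P ×
    ∃ λ C → Conservative C × edgeSet P ∩ C ≡ Subset.⊥ × F ≡ edgeSet P ∪ C

  decomposes? : ∀ e j F P → Dec (Decomposes e j F P)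
  decomposes? e j F P = isPath? e j P ×-dec UniqueDec.unique? Fin._≟_ P ×-dec
    anySubset? (λ C → conservative? C
      ×-dec ((edgeSet P ∩ C) ≟ₛ Subset.⊥)
      ×-dec (F ≟ₛ (edgeSet P ∪ C)))

  -- The edge loop-erased walk P of an edge flow F. On a plabic graph it
  -- exists and is unique for every edge flow in ℱ_{e,b_j}, so neither the
  -- default value nor the order of the search matters. A path without
  -- repeated edges has at most q edges.

  walkOf : Fin q → Fin n → Subset q → List (Fin q)
  walkOf e j F = fromMaybe [] (head (filter (decomposes? e j F)
                   (concatMap (sequences q) (upTo (suc q)))))

flowExponents : Subset q → Vec ℕ q
flowExponents = Vec.map (λ b → if b then 1 else 0)

pathExponents : List (Fin q) → Vec ℕ q
pathExponents P = tabulate (λ f → length (filter (f Fin.≟_) P))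

module OverField {c ℓ₁ ℓ₂ : Level} (K : OrderedField c ℓ₁ ℓ₂) where
  open OrderedField K hiding (zero)
  open IsStrictTotalOrder isStrictTotalOrder using (compare; <-resp-≈)
  open import Algebra.Properties.Semiring.Exp semiring using (_^_)

  infix 4 _≤_
  _≤_ : Rel Carrier (ℓ₁ ⊔ ℓ₂)
  x ≤ y = x < y ⊎ x ≈ y

  ∑ : ∀ {a} {A : Set a} → List A → (A → Carrier) → Carrier
  ∑ xs f = foldr (λ x s → f x + s) 0# xs

  Point : Set c
  Point = Carrier × Carrier

  infix 4 _≈ₚ_
  _≈ₚ_ : Rel Point ℓ₁
  (x₁ , x₂) ≈ₚ (y₁ , y₂) = x₁ ≈ y₁ × x₂ ≈ y₂

  infixl 6 _+ₚ_ _-ₚ_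
  _+ₚ_ _-ₚ_ : Point → Point → Point
  (x₁ , x₂) +ₚ (y₁ , y₂) = x₁ + y₁ , x₂ + y₂
  (x₁ , x₂) -ₚ (y₁ , y₂) = x₁ - y₁ , x₂ - y₂

  infixr 7 _·ₚ_
  _·ₚ_ : Carrier → Point → Point
  t ·ₚ (x₁ , x₂) = t * x₁ , t * x₂

  cross : Point → Point → Carrier
  cross (x₁ , x₂) (y₁ , y₂) = x₁ * y₂ - x₂ * y₁

  between : Point → Point → Carrier → Point
  between x y t = x +ₚ t ·ₚ (y -ₚ x)

  Unit : Carrier → Set (ℓ₁ ⊔ ℓ₂)
  Unit t = 0# ≤ t × t ≤ 1#

  Near : Point → Carrier → Point → Set (ℓ₁ ⊔ ℓ₂)
  Near (x₁ , x₂) ε (y₁ , y₂) = (x₁ - ε ≤ y₁ × y₁ ≤ x₁ + ε)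
                             × (x₂ - ε ≤ y₂ × y₂ ≤ x₂ + ε)

  Interior : ∀ {ℓ} → (Point → Set ℓ) → Point → Set (c ⊔ ℓ₁ ⊔ ℓ₂ ⊔ ℓ)
  Interior R x = ∃ λ ε → 0# < ε × (∀ y → Near x ε y → R y)

  -- A closed convex disk (a closed bounded convex region with non-empty
  -- interior) with a chosen straight segment [p , p′] on its boundary.

  record Disk (ℓ : Level) : Set (c ⊔ ℓ₁ ⊔ ℓ₂ ⊔ lsuc ℓ) where
    field
      Region   : Point → Set ℓ
      resp     : ∀ {x y} → x ≈ₚ y → Region x → Region y
      convex   : ∀ {x y t} → Region x → Region y → Unit t → Region (between x y t)
      closed   : ∀ {x} → ¬ Region x → Interior (¬_ ∘ Region) x
      bounded  : ∃ λ r → ∀ x → Region x → Near (0# , 0#) r x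
      nonempty : ∃ λ x → Interior Region x
      p p′     : Point
      p≉p′     : ¬ (p ≈ₚ p′)
      flat     : ∀ {t} → Unit t → Region (between p p′ t) × ¬ Interior Region (between p p′ t)

  record Network (ℓ : Level) (n m q : ℕ) : Set (c ⊔ ℓ₁ ⊔ ℓ₂ ⊔ lsuc ℓ) where
    field
      graph    : Digraph n m q
      color    : Fin m → Color
      isPlabic : IsPlabic graph color
    open Digraph graph public
    field
      weight     : Fin q → Carrier
      weight-pos : ∀ e → 0# < weight e
      disk       : Disk ℓ
    open Disk disk public
    field
      pos : Vertex n m → Point

    b : Fin n → Point
    b i = pos (inj₁ i)

    vec : Fin q → Point
    vec e = pos (tgt e) -ₚ pos (src e)

    edgePoint : Fin q → Carrier → Point
    edgePoint e = between (pos (src e)) (pos (tgt e))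

    Endpoint : Vertex n m → Fin q → Set
    Endpoint v e = v ≡ src e ⊎ v ≡ tgt e

    field
      pos-injective : ∀ {u v} → pos u ≈ₚ pos v → u ≡ v
      on-segment    : ∀ i → ∃ λ t → Unit t × b i ≈ₚ between p p′ t
      -- The disk lies to the right of the boundary traversed clockwise.
      clockwise     : ∀ {i j} → i Fin.< j → ∀ {x} → Interior Region x →
                      cross (b j -ₚ b i) (x -ₚ b i) < 0#
      inside-disk   : ∀ v → Interior Region (pos (inj₂ v))
      nondegenerate : ∀ e → src e ≢ tgt e
      planar        : ∀ {e f s t} → e ≢ f → Unit s → Unit t →
                      edgePoint e s ≈ₚ edgePoint f t →
                      ∃ λ v → pos v ≈ₚ edgePoint e s × Endpoint v e × Endpoint v f
      𝔩             : Point
      𝔩-nonzero     : ¬ (𝔩 ≈ₚ (0# , 0#))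
      𝔩-nonparallel : ∀ e → ¬ (cross (vec e) 𝔩 ≈ 0#)
      𝔩-inward      : ∀ i → ∃ λ t → 0# < t × Interior Region (b i +ₚ t ·ₚ 𝔩)
      𝔩-generic     : ∀ i v {t} → 0# ≤ t → ¬ (pos (inj₂ v) ≈ₚ b i +ₚ t ·ₚ 𝔩)

    rank : ℕ
    rank = length (sources graph)

  -- The segment [x , y] meets the ray from z in direction d at a point other
  -- than z.

  Crosses : Point → Point → Point → Point → Set (c ⊔ ℓ₁ ⊔ ℓ₂)
  Crosses x y z d = ∃ λ s → ∃ λ t → Unit s × 0# < t × between x y s ≈ₚ z +ₚ t ·ₚ d

  _≟_ : ∀ x y → Dec (x ≈ y)
  x ≟ y with compare x y
  ... | tri< _ x≉y _ = no x≉y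
  ... | tri≈ _ x≈y _ = yes x≈y
  ... | tri> _ x≉y _ = no x≉y

  _<?_ : ∀ x y → Dec (x < y)
  x <? y with compare x y
  ... | tri< x<y _ _ = yes x<y
  ... | tri≈ x≮y _ _ = no x≮y
  ... | tri> x≮y _ _ = no x≮y

  _≤?_ : ∀ x y → Dec (x ≤ y)
  x ≤? y = (x <? y) ⊎-dec (x ≟ y)

  private
    open import Algebra.Solver.Ring.NaturalCoefficients.Default commutativeSemiring
      using (solve; _:=_; _:+_; _:*_)
    open import Algebra.Properties.Ring ring using (-‿distribˡ-*; -‿distribʳ-*; -‿+-comm; -‿involutive)
    open import Relation.Binary.Reasoning.Setoid setoid

    ≤-resp : ∀ {x x′ y y′} → x ≈ x′ → y ≈ y′ → x ≤ y → x′ ≤ y′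
    ≤-resp p r (inj₁ x<y) = inj₁ (proj₁ <-resp-≈ r (proj₂ <-resp-≈ p x<y))
    ≤-resp p r (inj₂ x≈y) = inj₂ (trans (sym p) (trans x≈y r))

    drop-zero : ∀ x y {z} → z ≈ 0# → x + z * y ≈ x
    drop-zero x y h = trans (+-congˡ (trans (*-congʳ h) (zeroˡ y))) (+-identityʳ x)

    slide : ∀ x y → - x * y ≈ x * - y
    slide x y = trans (sym (-‿distribˡ-* x y)) (-‿distribʳ-* x y)

    difference : ∀ {x z u v} → x + u ≈ z + v → z - x ≈ u - v
    difference {x} {z} {u} {v} h = begin
      z - x                   ≈⟨ drop-zero (z - x) 1# (-‿inverseʳ v) ⟨
      z - x + (v - v) * 1#    ≈⟨ +-congˡ (*-identityʳ _) ⟩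
      z - x + (v - v)         ≈⟨ solve 4 (λ z x⁻ v v⁻ → (z :+ x⁻) :+ (v :+ v⁻) := (z :+ v) :+ (x⁻ :+ v⁻)) refl z (- x) v (- v) ⟩
      z + v + (- x - v)       ≈⟨ +-congʳ h ⟨
      x + u + (- x - v)       ≈⟨ solve 4 (λ x x⁻ u v⁻ → (x :+ u) :+ (x⁻ :+ v⁻) := (u :+ v⁻) :+ (x :+ x⁻)) refl x (- x) u (- v) ⟩
      u - v + (x - x)         ≈⟨ +-congˡ (-‿inverseʳ x) ⟩
      u - v + 0#              ≈⟨ +-identityʳ _ ⟩
      u - v                   ∎

  crosses? : ∀ x y z d → ¬ (cross (y -ₚ x) d ≈ 0#) → Dec (Crosses x y z d)
  crosses? (x₁ , x₂) (y₁ , y₂) (z₁ , z₂) (d₁ , d₂) cr≉0 =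
    map′ to from ((0# ≤? s₀ ×-dec s₀ ≤? 1#) ×-dec 0# <? t₀)
    where
    a₁ a₂ u₁ u₂ cr i s₀ t₀ : Carrier
    a₁ = y₁ - x₁
    a₂ = y₂ - x₂
    u₁ = z₁ - x₁
    u₂ = z₂ - x₂
    cr = cross (a₁ , a₂) (d₁ , d₂)
    i  = proj₁ (inverse cr cr≉0)
    s₀ = cross (u₁ , u₂) (d₁ , d₂) * i
    t₀ = cross (u₁ , u₂) (a₁ , a₂) * i

    cr*i≈1 : cr * i ≈ 1#
    cr*i≈1 = proj₂ (inverse cr cr≉0)

    scale : ∀ x → x * (cr * i) ≈ x
    scale x = trans (*-congˡ cr*i≈1) (*-identityʳ x)

    meet₁ : s₀ * a₁ ≈ u₁ + t₀ * d₁
    meet₁ = begin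
      (u₁ * d₂ - u₂ * d₁) * i * a₁
        ≈⟨ *-congʳ (*-congʳ (+-congˡ (-‿distribˡ-* u₂ d₁))) ⟩
      (u₁ * d₂ + - u₂ * d₁) * i * a₁
        ≈⟨ drop-zero _ (u₁ * d₁ * i) (-‿inverseʳ a₂) ⟨
      (u₁ * d₂ + - u₂ * d₁) * i * a₁ + (a₂ - a₂) * (u₁ * d₁ * i)
        ≈⟨ solve 8 (λ u₁ v₂ d₁ d₂ i a₁ a₂ c₂ →
             ((u₁ :* d₂ :+ v₂ :* d₁) :* i :* a₁) :+ (a₂ :+ c₂) :* (u₁ :* d₁ :* i)
             := u₁ :* ((a₁ :* d₂ :+ c₂ :* d₁) :* i) :+ (u₁ :* a₂ :+ v₂ :* a₁) :* i :* d₁)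
             refl u₁ (- u₂) d₁ d₂ i a₁ a₂ (- a₂) ⟩
      u₁ * ((a₁ * d₂ + - a₂ * d₁) * i) + (u₁ * a₂ + - u₂ * a₁) * i * d₁
        ≈⟨ +-cong (*-congˡ (*-congʳ (+-congˡ (-‿distribˡ-* a₂ d₁))))
                  (*-congʳ (*-congʳ (+-congˡ (-‿distribˡ-* u₂ a₁)))) ⟨
      u₁ * (cr * i) + t₀ * d₁
        ≈⟨ +-congʳ (scale u₁) ⟩
      u₁ + t₀ * d₁ ∎

    meet₂ : s₀ * a₂ ≈ u₂ + t₀ * d₂
    meet₂ = begin
      (u₁ * d₂ - u₂ * d₁) * i * a₂
        ≈⟨ drop-zero _ (a₁ * d₂ * i) (-‿inverseʳ u₂) ⟨
      (u₁ * d₂ - u₂ * d₁) * i * a₂ + (u₂ - u₂) * (a₁ * d₂ * i)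
        ≈⟨ +-congʳ (*-congʳ (*-congʳ (+-congˡ (-‿distribʳ-* u₂ d₁)))) ⟩
      (u₁ * d₂ + u₂ * - d₁) * i * a₂ + (u₂ - u₂) * (a₁ * d₂ * i)
        ≈⟨ solve 8 (λ u₁ u₂ v₂ d₂ e₁ i a₁ a₂ →
             ((u₁ :* d₂ :+ u₂ :* e₁) :* i :* a₂) :+ (u₂ :+ v₂) :* (a₁ :* d₂ :* i)
             := u₂ :* ((a₁ :* d₂ :+ a₂ :* e₁) :* i) :+ (u₁ :* a₂ :+ v₂ :* a₁) :* i :* d₂)
             refl u₁ u₂ (- u₂) d₂ (- d₁) i a₁ a₂ ⟩
      u₂ * ((a₁ * d₂ + a₂ * - d₁) * i) + (u₁ * a₂ + - u₂ * a₁) * i * d₂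
        ≈⟨ +-cong (*-congˡ (*-congʳ (+-congˡ (-‿distribʳ-* a₂ d₁))))
                  (*-congʳ (*-congʳ (+-congˡ (-‿distribˡ-* u₂ a₁)))) ⟨
      u₂ * (cr * i) + t₀ * d₂
        ≈⟨ +-congʳ (scale u₂) ⟩
      u₂ + t₀ * d₂ ∎

    lift : ∀ {x z s t} → s ≈ z - x + t → x + s ≈ z + t
    lift {x} {z} {s} {t} h = begin
      x + s               ≈⟨ +-congˡ h ⟩
      x + (z - x + t)     ≈⟨ solve 4 (λ x x⁻ z t → x :+ ((z :+ x⁻) :+ t) := (z :+ t) :+ (x :+ x⁻)) refl x (- x) z t ⟩
      z + t + (x - x)     ≈⟨ +-congˡ (-‿inverseʳ x) ⟩
      z + t + 0#          ≈⟨ +-identityʳ _ ⟩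
      z + t               ∎

    to : Unit s₀ × 0# < t₀ → Crosses (x₁ , x₂) (y₁ , y₂) (z₁ , z₂) (d₁ , d₂)
    to (s∈ , 0<t) = s₀ , t₀ , s∈ , 0<t , lift meet₁ , lift meet₂

    module _ (s t : Carrier) (h₁ : u₁ ≈ s * a₁ - t * d₁) (h₂ : u₂ ≈ s * a₂ - t * d₂) where

      expand : ∀ b₁ b₂ → cross (u₁ , u₂) (b₁ , b₂) ≈
               (s * a₁ + - t * d₁) * b₂ + (- s * a₂ + t * d₂) * b₁
      expand b₁ b₂ = +-cong
        (*-congʳ (trans h₁ (+-congˡ (-‿distribˡ-* t d₁))))
        (trans (-‿distribˡ-* u₂ b₁) (*-congʳ (begin
          - u₂                         ≈⟨ -‿cong h₂ ⟩
          - (s * a₂ - t * d₂)          ≈⟨ -‿+-comm _ _ ⟨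
          - (s * a₂) + - - (t * d₂)    ≈⟨ +-cong (-‿distribˡ-* s a₂) (-‿involutive _) ⟩
          - s * a₂ + t * d₂            ∎)))

      unique-s : s₀ ≈ s
      unique-s = begin
        s₀
          ≈⟨ *-congʳ (expand d₁ d₂) ⟩
        ((s * a₁ + - t * d₁) * d₂ + (- s * a₂ + t * d₂) * d₁) * i
          ≈⟨ solve 9 (λ s s⁻ t t⁻ a₁ a₂ d₁ d₂ i →
               ((s :* a₁ :+ t⁻ :* d₁) :* d₂ :+ (s⁻ :* a₂ :+ t :* d₂) :* d₁) :* i
               := (s :* (a₁ :* d₂) :+ s⁻ :* (a₂ :* d₁)) :* i :+ (t :+ t⁻) :* (d₁ :* d₂ :* i))
               refl s (- s) t (- t) a₁ a₂ d₁ d₂ i ⟩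
        (s * (a₁ * d₂) + - s * (a₂ * d₁)) * i + (t - t) * (d₁ * d₂ * i)
          ≈⟨ drop-zero _ _ (-‿inverseʳ t) ⟩
        (s * (a₁ * d₂) + - s * (a₂ * d₁)) * i
          ≈⟨ *-congʳ (+-congˡ (slide s (a₂ * d₁))) ⟩
        (s * (a₁ * d₂) + s * - (a₂ * d₁)) * i
          ≈⟨ *-congʳ (distribˡ s _ _) ⟨
        s * cr * i
          ≈⟨ *-assoc s cr i ⟩
        s * (cr * i)
          ≈⟨ scale s ⟩
        s ∎

      unique-t : t₀ ≈ t
      unique-t = begin
        t₀
          ≈⟨ *-congʳ (expand a₁ a₂) ⟩
        ((s * a₁ + - t * d₁) * a₂ + (- s * a₂ + t * d₂) * a₁) * i
          ≈⟨ solve 9 (λ s s⁻ t t⁻ a₁ a₂ d₁ d₂ i →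
               ((s :* a₁ :+ t⁻ :* d₁) :* a₂ :+ (s⁻ :* a₂ :+ t :* d₂) :* a₁) :* i
               := (t :* (a₁ :* d₂) :+ t⁻ :* (a₂ :* d₁)) :* i :+ (s :+ s⁻) :* (a₁ :* a₂ :* i))
               refl s (- s) t (- t) a₁ a₂ d₁ d₂ i ⟩
        (t * (a₁ * d₂) + - t * (a₂ * d₁)) * i + (s - s) * (a₁ * a₂ * i)
          ≈⟨ drop-zero _ _ (-‿inverseʳ s) ⟩
        (t * (a₁ * d₂) + - t * (a₂ * d₁)) * i
          ≈⟨ *-congʳ (+-congˡ (slide t (a₂ * d₁))) ⟩
        (t * (a₁ * d₂) + t * - (a₂ * d₁)) * i
          ≈⟨ *-congʳ (distribˡ t _ _) ⟨
        t * cr * i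
          ≈⟨ *-assoc t cr i ⟩
        t * (cr * i)
          ≈⟨ scale t ⟩
        t ∎

    from : Crosses (x₁ , x₂) (y₁ , y₂) (z₁ , z₂) (d₁ , d₂) → Unit s₀ × 0# < t₀
    from (s , t , (0≤s , s≤1) , 0<t , e₁ , e₂) =
      let h₁ = difference e₁ ; h₂ = difference e₂
          s≈ = sym (unique-s s t h₁ h₂) ; t≈ = sym (unique-t s t h₁ h₂)
      in (≤-resp refl s≈ 0≤s , ≤-resp s≈ refl s≤1) , proj₁ <-resp-≈ t≈ 0<t

  orientation : Point → Point → ℤ
  orientation x y with compare (cross x y) 0#
  ... | tri< _ _ _ = -[1+ 0 ]
  ... | tri≈ _ _ _ = + 0
  ... | tri> _ _ _ = + 1

  -- The arguments are s(e,f), s(e,𝔩), s(𝔩,f).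

  windFrom : ℤ → ℤ → ℤ → ℤ
  windFrom (+ 1)    (+ 1)    (+ 1)    = + 1
  windFrom -[1+ 0 ] -[1+ 0 ] -[1+ 0 ] = -[1+ 0 ]
  windFrom _        _        _        = + 0

  module _ {ℓ : Level} (N : Network ℓ n m q) where
    open Network N

    windEdges : Fin q → Fin q → ℤ
    windEdges e f = windFrom (orientation (vec e) (vec f))
                             (orientation (vec e) 𝔩) (orientation 𝔩 (vec f))

    -- A gauge ray is not parallel to e, so it meets e in at most one point;
    -- int e is the number of gauge rays meeting e away from their base point.

    int : Fin q → ℕ
    int e = length (filter
      (λ i → crosses? (pos (src e)) (pos (tgt e)) (b i) 𝔩 (𝔩-nonparallel e))
      (sources graph))

    windPath : List (Fin q) → ℤ
    windPath []          = + 0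
    windPath (e ∷ [])    = + 0
    windPath (e ∷ f ∷ P) = windEdges e f ℤ.+ windPath (f ∷ P)

    intPath : List (Fin q) → ℕ
    intPath P = List.sum (List.map int P)

    sign : List (Fin q) → Carrier
    sign P = (- 1#) ^ ℤ.∣ windPath P ℤ.+ (+ intPath P) ∣

  Series : ℕ → Set c
  Series q = Vec ℕ q → Carrier

  infix 4 _≈ˢ_
  _≈ˢ_ : Rel (Series q) ℓ₁
  S ≈ˢ T = ∀ α → S α ≈ T α

  splits : Vec ℕ q → List (Vec ℕ q × Vec ℕ q)
  splits []      = ([] , []) ∷ []
  splits (a ∷ α) = cartesianProductWith
    (λ k (β , γ) → (k ∷ β) , ((a ∸ k) ∷ γ)) (upTo (suc a)) (splits α)

  infixl 7 _*ˢ_ _/ˢ_ _·ˢ_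
  infixl 6 _-ˢ_
  _*ˢ_ _-ˢ_ _/ˢ_ : Series q → Series q → Series q
  (S *ˢ T) α = ∑ (splits α) (λ (β , γ) → S β * T γ)
  (S -ˢ T) α = S α - T α

  _·ˢ_ : Series q → Carrier → Series q
  (S ·ˢ x) α = S α * x

  ∑ˢ : ∀ {a} {A : Set a} → List A → (A → Series q) → Series q
  ∑ˢ xs S α = ∑ xs (λ x → S x α)

  Polynomial : ℕ → Set c
  Polynomial q = List (Carrier × Vec ℕ q)

  toSeries : Polynomial q → Series q
  toSeries p α = ∑ (filter (λ (_ , β) → Vec.≡-dec ℕ._≟_ β α) p) proj₁

  1ˢ : Series q
  1ˢ = toSeries ((1# , Vec.replicate _ 0) ∷ [])

  powˢ : Series q → ℕ → Series q
  powˢ S zero    = 1ˢ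
  powˢ S (suc k) = S *ˢ powˢ S k

  -- The inverse ∑ₖ (1 - S)ᵏ of a series S with constant term 1; in degree α
  -- only the terms with k ≤ |α| contribute.

  inverseˢ : Series q → Series q
  inverseˢ S α = ∑ (upTo (suc (Vec.sum α))) (λ k → powˢ (1ˢ -ˢ S) k α)

  S /ˢ T = S *ˢ inverseˢ T

  evaluate : (Fin q → Carrier) → Polynomial q → Carrier
  evaluate w p = ∑ p (λ (a , α) →
    a * foldr (λ f x → w f ^ lookup α f * x) 1# (allFin _))

  SubtractionFree : Polynomial q → Set (c ⊔ ℓ₂)
  SubtractionFree = All (λ (a , _) → 0# < a)

  -- S is a rational function, defined at w and with value x there.

  HasValue : (Fin q → Carrier) → Series q → Carrier → Set (c ⊔ ℓ₁)
  HasValue w S x = ∃ λ num → ∃ λ den →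
      toSeries den *ˢ S ≈ˢ toSeries num
    × ¬ (evaluate w den ≈ 0#)
    × x * evaluate w den ≈ evaluate w num

  module _ {ℓ : Level} (N : Network ℓ n m q) where
    open Network N

    -- The paths with weight monomial α have |α| edges.

    pathSeries : Fin q → Fin n → Series q
    pathSeries e j α = ∑ (filter
      (λ P → isPath? graph e j P ×-dec Vec.≡-dec ℕ._≟_ (pathExponents P) α)
      (sequences q (Vec.sum α))) (sign N)

    numerator : Fin q → Fin n → Polynomial q
    numerator e j = List.map
      (λ F → sign N (walkOf graph e j F) , flowExponents F)
      (edgeFlows graph e j)

    denominator : Polynomial q
    denominator = List.map (λ C → 1# , flowExponents C) (conservativeFlows graph)

    edgeVector : ∀ {d} → (Fin n → Fin d → Carrier) → Fin q → Fin d → Series q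
    edgeVector B e r = ∑ˢ (sinks graph) (λ j → pathSeries e j ·ˢ B j r)

  Matrix : ℕ → ℕ → Set c
  Matrix k n = Fin k → Fin n → Carrier

  det : ∀ k → Matrix k k → Carrier
  det zero    A = 1#
  det (suc k) A = ∑ (allFin (suc k)) (λ j →
    (- 1#) ^ toℕ j * A zero j * det k (λ r s → A (suc r) (punchIn j s)))

  module _ {ℓ : Level} (N : Network ℓ n m q) where
    open Network N

    -- The minor Δ_J is taken along the increasing enumeration γ of J.

    InCell : Matrix rank n → Set (ℓ₁ ⊔ ℓ₂)
    InCell A = ∀ J (γ : Fin rank → Fin n) →
      (∀ {r s} → r Fin.< s → γ r Fin.< γ s) →
      (∀ i → i ∈ J ⇔ ∃ λ r → γ r ≡ i) →
      let Δ = det rank (λ r s → A r (γ s)) in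
        (Matroid graph color J → 0# < Δ) × (¬ Matroid graph color J → Δ ≈ 0#)

    -- The reduced row echelon form of A with respect to the base I has in row
    -- i ∈ I and column j ∉ I the value at the weights of the signed sum over
    -- all paths from b_i to b_j (Postnikov's boundary measurement map, its
    -- sign being (-1)^(wind + int)).

    Represents : Matrix rank n → Set (c ⊔ ℓ₁)
    Represents A = ∃ λ (M : Fin n → Fin n → Carrier) →
        (∀ e i j → src e ≡ inj₁ i → ¬ Source graph j →
          HasValue weight (pathSeries N e j) (M i j))
      × (∀ r j → ¬ Source graph j → A r j ≈ ∑ (sources graph) (λ i → A r i * M i j))

-- Let S(e) be the signed path series from e to b_j, N(e) the numerator and D
-- the denominator. Splitting off the first edge gives the linear system
--   S(e) = ± w_e (∑ ± S(f) + [e ends at b_j]),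
-- f running over the edges that leave the end of e; as w_e has degree one it
-- has only one solution. The N(e) solve the same system with D in place of 1,
-- hence S(e) = N(e) / D. Indeed, removing e from an edge flow starting at e
-- leaves an edge flow starting at the next edge f of its walk. Conversely, e
-- can be added to an edge flow F starting at f unless F already contains e. In
-- that case e ends at a white vertex with outgoing edges f and g, and F is also
-- an edge flow starting at g; the two walks differ by a simple cycle through e,
-- so the two terms cancel once wind + int of a simple cycle is known to be odd.
--
-- Every gauge ray starts on the boundary of the convex disk, so an internal edge
-- meets it exactly if it changes sides of the ray's line, and int is even.
-- For wind (a discrete Umlaufsatz modulo 2), think of 𝔩 as vertical and attach
-- to a pair of edges the number of their endpoints lying vertically below or
-- above the other edge. It is even for disjoint edges, and for consecutive edges
-- it tells whether the path turns through 𝔩 there. The sum over all pairs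
-- telescopes, and the pair of the last and the first edge, which enters in the
-- wrong order, makes the total odd.
module Submission where

open import Defs
open import Algebra.Bundles using (CommutativeMonoid)
open import Data.Bool as Bool using (Bool; true; false; if_then_else_; not; _xor_)
import Data.Bool.Properties as Bool
open import Data.Bool.Solver using (module xor-∧-Solver)
open import Data.Empty using (⊥; ⊥-elim)
open import Data.Fin as Fin using (Fin; zero; suc)
import Data.Fin.Properties as Fin
open import Data.Fin.Subset as Subset using (Subset; inside; outside; ⁅_⁆; _∈_; _∉_)
import Data.Fin.Subset.Properties as Subset
open import Data.Integer as ℤ using (ℤ; +_; -[1+_])
import Data.Integer.Properties as ℤ
open import Data.List as List using (List; []; _∷_; _++_; allFin; upTo; filter; foldr; cartesianProductWith; head; last; length)
import Data.List.Properties as List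
open import Data.List.Membership.Propositional as List using () renaming (_∈_ to _∈ˡ_; _∉_ to _∉ˡ_)
import Data.List.Membership.Propositional.Properties as List
open import Data.List.Relation.Unary.All as All using (All; []; _∷_)
import Data.List.Relation.Unary.All.Properties as All
open import Data.List.Relation.Unary.AllPairs using (AllPairs; []; _∷_)
open import Data.List.Relation.Unary.Any using (here; there; any?)
open import Data.List.Relation.Unary.Linked using (Linked; []; [-]; _∷_)
open import Data.List.Relation.Unary.Unique.Propositional using (Unique)
open import Data.Maybe as Maybe using (Maybe; just; nothing; fromMaybe)
import Data.Maybe.Properties as Maybe
open import Data.Nat as ℕ using (ℕ; zero; suc; _∸_; z≤n; s≤s)
import Data.Nat.Properties as ℕ
open import Data.Product using (∃; _×_; _,_; proj₁; proj₂)
open import Data.Sum using (_⊎_; inj₁; inj₂; [_,_]′)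
import Data.Sum.Properties as Sum
open import Data.Vec as Vec using (Vec; []; _∷_; lookup; _[_]%=_; _[_]≔_)
import Data.Vec.Properties as Vec
open import Function using (_∘_; id; mk⇔)
open import Level using (Level; _⊔_)
open import Relation.Binary.Definitions using (Tri; tri<; tri≈; tri>)
open import Relation.Binary.PropositionalEquality as ≡ using (_≡_; _≢_)
open import Relation.Binary.Structures using (IsStrictTotalOrder)
open import Relation.Nullary using (¬_; Dec; yes; no; does; contradiction)
open import Relation.Nullary.Decidable using (¬?; _×-dec_; dec-true; dec-false; does-⇔; map′)

-- The system is compared coefficient by coefficient. Multiplication by w_e raises the exponent of
-- `e`, so a coefficient of S(e) is zero or is fixed by coefficients of total degree one less; no
-- determinant has to be inverted. The monomials of N(e) and D are squarefree, hence edge sets, and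
-- the main distinction is whether the set already contains `e`. Perfection acts through one fact:
-- where an edge set is balanced, at most one of its edges enters and at most one leaves. Hence the
-- walk of a flow is forced, and the cycle of the cancelling case visits no vertex twice although
-- walks are only required not to repeat edges. Which of the walks from f and g runs round the cycle
-- is not known beforehand: if the walk from f misses `e`, its complement is conservative and
-- contains `e` and g, so the walk from g has to follow it up to `e`. Vertices may have equal
-- abscissas, since only edges are required not to be parallel to 𝔩. The comparison of vertices is
-- therefore completed by an arbitrary tie-break, and the lemmas on positions allow weak
-- inequalities. Disjointness of segments enters through Cramer's rule and signs of determinants.

private
  variable
    n m q : ℕ

-- Order and sign rules in an ordered field

module OrderedFieldProperties {c ℓ₁ ℓ₂ : Level} (K : OrderedField c ℓ₁ ℓ₂) where
  open OrderedField K hiding (zero)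
  open OverField K
  open IsStrictTotalOrder isStrictTotalOrder public
    using (compare; <-resp-≈) renaming (trans to <-trans; irrefl to <-irrefl; asym to <-asym)
  open import Algebra.Properties.Ring ring
  open import Relation.Binary.Reasoning.Setoid setoid

  -- A ring solver with integer coefficients, so that it knows 1 - 1 = 0.

  module RingSolver where
    open import Algebra.Solver.Ring.AlmostCommutativeRing
    open import Algebra.Properties.Semiring.Mult.TCOptimised semiring
      using (×-homo-+; ×1-homo-*) renaming (_×_ to _·_)
    private module S where
      open import Algebra.Solver.Ring.NaturalCoefficients.Default commutativeSemiring public

    ⟦_⟧ᶻ : ℤ → Carrier
    ⟦ + k ⟧ᶻ      = k · 1#
    ⟦ -[1+ k ] ⟧ᶻ = - (suc k · 1#)

    ⊖-homo : ∀ k l → ⟦ k ℤ.⊖ l ⟧ᶻ ≈ k · 1# - l · 1#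
    ⊖-homo zero    zero    = sym (-‿inverseʳ 0#)
    ⊖-homo zero    (suc l) = sym (+-identityˡ _)
    ⊖-homo (suc k) zero    = sym (trans (+-congˡ -0#≈0#) (+-identityʳ _))
    ⊖-homo (suc k) (suc l) = begin
      ⟦ suc k ℤ.⊖ suc l ⟧ᶻ           ≡⟨ ≡.cong ⟦_⟧ᶻ (ℤ.[1+m]⊖[1+n]≡m⊖n k l) ⟩
      ⟦ k ℤ.⊖ l ⟧ᶻ                   ≈⟨ ⊖-homo k l ⟩
      k · 1# - l · 1#                ≈⟨ +-identityˡ _ ⟨
      0# + (k · 1# - l · 1#)         ≈⟨ +-congʳ (-‿inverseʳ 1#) ⟨
      (1# - 1#) + (k · 1# - l · 1#)
        ≈⟨ S.solve 4 (λ a b c d → (a S.:+ b) S.:+ (c S.:+ d) S.:= (a S.:+ c) S.:+ (b S.:+ d)) refl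
             1# (- 1#) (k · 1#) (- (l · 1#)) ⟩
      (1# + k · 1#) + (- 1# - l · 1#)
        ≈⟨ +-cong (sym (×-homo-+ 1# 1 k)) (trans (-‿+-comm _ _) (-‿cong (sym (×-homo-+ 1# 1 l)))) ⟩
      suc k · 1# - suc l · 1#        ∎

    +-homo : ∀ i j → ⟦ i ℤ.+ j ⟧ᶻ ≈ ⟦ i ⟧ᶻ + ⟦ j ⟧ᶻ
    +-homo (+ k)    (+ l)    = ×-homo-+ 1# k l
    +-homo (+ k)    -[1+ l ] = ⊖-homo k (suc l)
    +-homo -[1+ k ] (+ l)    = trans (⊖-homo l (suc k)) (+-comm _ _)
    +-homo -[1+ k ] -[1+ l ] = begin
      - (suc (suc (k ℕ.+ l)) · 1#)    ≡⟨ ≡.cong (λ z → - (suc z · 1#)) (ℕ.+-suc k l) ⟨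
      - ((suc k ℕ.+ suc l) · 1#)      ≈⟨ -‿cong (×-homo-+ 1# (suc k) (suc l)) ⟩
      - (suc k · 1# + suc l · 1#)     ≈⟨ -‿+-comm _ _ ⟨
      - (suc k · 1#) - suc l · 1#     ∎

    -‿homo : ∀ i → ⟦ ℤ.- i ⟧ᶻ ≈ - ⟦ i ⟧ᶻ
    -‿homo (+ zero)  = sym -0#≈0#
    -‿homo (+ suc k) = refl
    -‿homo -[1+ k ]  = sym (-‿involutive _)

    *-homo⁺ : ∀ k j → ⟦ + k ℤ.* j ⟧ᶻ ≈ k · 1# * ⟦ j ⟧ᶻ
    *-homo⁺ k (+ l)    = begin
      ⟦ + k ℤ.* + l ⟧ᶻ   ≡⟨ ≡.cong ⟦_⟧ᶻ (ℤ.pos-* k l) ⟨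
      (k ℕ.* l) · 1#     ≈⟨ ×1-homo-* k l ⟩
      k · 1# * l · 1#    ∎
    *-homo⁺ k -[1+ l ] = begin
      ⟦ + k ℤ.* -[1+ l ] ⟧ᶻ         ≡⟨ ≡.cong ⟦_⟧ᶻ (ℤ.neg-distribʳ-* (+ k) (+ suc l)) ⟨
      ⟦ ℤ.- (+ k ℤ.* + suc l) ⟧ᶻ    ≈⟨ -‿homo (+ k ℤ.* + suc l) ⟩
      - ⟦ + k ℤ.* + suc l ⟧ᶻ        ≈⟨ -‿cong (*-homo⁺ k (+ suc l)) ⟩
      - (k · 1# * suc l · 1#)       ≈⟨ -‿distribʳ-* _ _ ⟩
      k · 1# * - (suc l · 1#)       ∎
    *-homo : ∀ i j → ⟦ i ℤ.* j ⟧ᶻ ≈ ⟦ i ⟧ᶻ * ⟦ j ⟧ᶻ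
    *-homo (+ k)    j = *-homo⁺ k j
    *-homo -[1+ k ] j = begin
      ⟦ -[1+ k ] ℤ.* j ⟧ᶻ           ≡⟨ ≡.cong ⟦_⟧ᶻ (ℤ.neg-distribˡ-* (+ suc k) j) ⟨
      ⟦ ℤ.- (+ suc k ℤ.* j) ⟧ᶻ      ≈⟨ -‿homo (+ suc k ℤ.* j) ⟩
      - ⟦ + suc k ℤ.* j ⟧ᶻ          ≈⟨ -‿cong (*-homo⁺ (suc k) j) ⟩
      - (suc k · 1# * ⟦ j ⟧ᶻ)       ≈⟨ -‿distribˡ-* _ _ ⟩
      - (suc k · 1#) * ⟦ j ⟧ᶻ       ∎

    homo : ℤ.+-*-rawRing -Raw-AlmostCommutative⟶ fromCommutativeRing commutativeRing
    homo = record
      { ⟦_⟧ = ⟦_⟧ᶻ ; +-homo = +-homo ; *-homo = *-homo ; -‿homo = -‿homo ; 0-homo = refl ; 1-homo = refl }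

    equal? : ∀ i j → Maybe (⟦ i ⟧ᶻ ≈ ⟦ j ⟧ᶻ)
    equal? i j with i ℤ.≟ j
    ... | yes i≡j = just (reflexive (≡.cong ⟦_⟧ᶻ i≡j))
    ... | no _    = nothing

    open import Algebra.Solver.Ring ℤ.+-*-rawRing (fromCommutativeRing commutativeRing) homo equal? public
      renaming (Polynomial to Expression)
      using (solve; _:+_; _:*_; _:-_; :-_; _:=_; con)

    infixl 6 _:-ₚ_
    -- Syntactic copies of the operations on points, by which identities between determinants are
    -- handed to the solver.
    _:-ₚ_ : ∀ {k} → Expression k × Expression k → Expression k × Expression k → Expression k × Expression k
    (x₁ , x₂) :-ₚ (y₁ , y₂) = x₁ :- y₁ , x₂ :- y₂

    :cross : ∀ {k} → Expression k × Expression k → Expression k × Expression k → Expression k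
    :cross (x₁ , x₂) (y₁ , y₂) = x₁ :* y₂ :- x₂ :* y₁

    :turn : ∀ {k} (p r s : Expression k × Expression k) → Expression k
    :turn p r s = :cross (r :-ₚ p) (s :-ₚ p)

  open RingSolver

  0<⇒≉0 : ∀ {x} → 0# < x → ¬ (x ≈ 0#)
  0<⇒≉0 0<x x≈0 = <-irrefl (sym x≈0) 0<x

  <0⇒≉0 : ∀ {x} → x < 0# → ¬ (x ≈ 0#)
  <0⇒≉0 x<0 x≈0 = <-irrefl x≈0 x<0

  <-resp : ∀ {x x′ y y′} → x ≈ x′ → y ≈ y′ → x < y → x′ < y′
  <-resp p r x<y = proj₁ <-resp-≈ r (proj₂ <-resp-≈ p x<y)

  ≤-resp : ∀ {x x′ y y′} → x ≈ x′ → y ≈ y′ → x ≤ y → x′ ≤ y′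
  ≤-resp p r (inj₁ x<y) = inj₁ (<-resp p r x<y)
  ≤-resp p r (inj₂ x≈y) = inj₂ (trans (sym p) (trans x≈y r))

  ≤-refl : ∀ {x} → x ≤ x
  ≤-refl = inj₂ refl

  ≤-trans : ∀ {x y z} → x ≤ y → y ≤ z → x ≤ z
  ≤-trans (inj₁ p) (inj₁ r) = inj₁ (<-trans p r)
  ≤-trans (inj₁ p) (inj₂ r) = inj₁ (<-resp refl r p)
  ≤-trans (inj₂ p) r        = ≤-resp (sym p) refl r

  ≤-<-trans : ∀ {x y z} → x ≤ y → y < z → x < z
  ≤-<-trans (inj₁ p) r = <-trans p r
  ≤-<-trans (inj₂ p) r = <-resp (sym p) refl r

  <-≤-trans : ∀ {x y z} → x < y → y ≤ z → x < z
  <-≤-trans p (inj₁ r) = <-trans p r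
  <-≤-trans p (inj₂ r) = <-resp refl r p

  ≮⇒≥ : ∀ {x y} → ¬ (x < y) → y ≤ x
  ≮⇒≥ {x} {y} x≮y with compare x y
  ... | tri< x<y _ _ = contradiction x<y x≮y
  ... | tri≈ _ x≈y _ = inj₂ (sym x≈y)
  ... | tri> _ _ y<x = inj₁ y<x

  ≤⇒≯ : ∀ {x y} → x ≤ y → ¬ (y < x)
  ≤⇒≯ x≤y y<x = <-irrefl refl (≤-<-trans x≤y y<x)

  <⇒0<- : ∀ {x y} → x < y → 0# < y - x
  <⇒0<- {x} x<y = <-resp (-‿inverseʳ x) refl (+-monoˡ-< (- x) x<y)

  0<-⇒< : ∀ {x y} → 0# < y - x → x < y
  0<-⇒< {x} {y} h = <-resp (+-identityˡ x)
    (solve 2 (λ x y → (y :- x) :+ x := y) refl x y) (+-monoˡ-< x h)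

  ≤⇒0≤- : ∀ {x y} → x ≤ y → 0# ≤ y - x
  ≤⇒0≤- (inj₁ h) = inj₁ (<⇒0<- h)
  ≤⇒0≤- {x} {y} (inj₂ h) = inj₂ (trans (sym (-‿inverseʳ y)) (+-congˡ (-‿cong (sym h))))

  0≤-⇒≤ : ∀ {x y} → 0# ≤ y - x → x ≤ y
  0≤-⇒≤ (inj₁ h) = inj₁ (0<-⇒< h)
  0≤-⇒≤ {x} {y} (inj₂ h) = inj₂ (trans (sym (+-identityˡ x)) (trans (+-congʳ h)
    (solve 2 (λ x y → (y :- x) :+ x := y) refl x y)))

  <0⇒0<- : ∀ {x} → x < 0# → 0# < - x
  <0⇒0<- h = <-resp refl (+-identityˡ _) (<⇒0<- h)

  0<-⇒<0 : ∀ {x} → 0# < - x → x < 0#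
  0<-⇒<0 h = 0<-⇒< (<-resp refl (sym (+-identityˡ _)) h)

  0<⇒-<0 : ∀ {x} → 0# < x → - x < 0#
  0<⇒-<0 h = 0<-⇒<0 (<-resp refl (sym (-‿involutive _)) h)

  -<0⇒0< : ∀ {x} → - x < 0# → 0# < x
  -<0⇒0< h = <-resp refl (-‿involutive _) (<0⇒0<- h)

  +-mono-< : ∀ {x y z w} → x < y → z < w → x + z < y + w
  +-mono-< p r = <-trans (+-monoˡ-< _ p) (<-resp (+-comm _ _) (+-comm _ _) (+-monoˡ-< _ r))

  +-pos-< : ∀ {x y} → 0# < x → 0# < y → 0# < x + y
  +-pos-< p r = <-resp (+-identityˡ 0#) refl (+-mono-< p r)

  0≤+ : ∀ {x y} → 0# ≤ x → 0# ≤ y → 0# ≤ x + y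
  0≤+ (inj₁ p) (inj₁ r) = inj₁ (+-pos-< p r)
  0≤+ (inj₁ p) (inj₂ r) = inj₁ (<-resp refl (trans (sym (+-identityʳ _)) (+-congˡ r)) p)
  0≤+ (inj₂ p) r = ≤-resp refl (trans (sym (+-identityˡ _)) (+-congʳ p)) r

  0<+ : ∀ {x y} → 0# < x → 0# ≤ y → 0# < x + y
  0<+ p (inj₁ r) = +-pos-< p r
  0<+ p (inj₂ r) = <-resp refl (trans (sym (+-identityʳ _)) (+-congˡ r)) p

  0≤* : ∀ {x y} → 0# ≤ x → 0# ≤ y → 0# ≤ x * y
  0≤* (inj₁ p) (inj₁ r) = inj₁ (*-pos p r)
  0≤* {x} (inj₁ p) (inj₂ r) = inj₂ (trans (sym (zeroʳ x)) (*-congˡ r))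
  0≤* {_} {y} (inj₂ p) r = inj₂ (trans (sym (zeroˡ y)) (*-congʳ p))

  *-neg : ∀ {x y} → x < 0# → y < 0# → 0# < x * y
  *-neg {x} {y} p r = <-resp refl (solve 2 (λ x y → :- x :* :- y := x :* y) refl x y)
    (*-pos (<0⇒0<- p) (<0⇒0<- r))

  *-pos-neg : ∀ {x y} → 0# < x → y < 0# → x * y < 0#
  *-pos-neg {x} {y} p r = 0<-⇒<0 (<-resp refl (solve 2 (λ x y → x :* :- y := :- (x :* y)) refl x y)
    (*-pos p (<0⇒0<- r)))

  0<*⁻¹ : ∀ {x y} → 0# < x → 0# < x * y → 0# < y
  0<*⁻¹ {x} {y} 0<x 0<xy with compare y 0#
  ... | tri< y<0 _ _ = contradiction 0<xy (<-asym (*-pos-neg 0<x y<0))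
  ... | tri≈ _ y≈0 _ = contradiction (trans (*-congˡ y≈0) (zeroʳ x)) (0<⇒≉0 0<xy)
  ... | tri> _ _ 0<y = 0<y

  0≤*⁻¹ : ∀ {x y} → 0# < x → 0# ≤ x * y → 0# ≤ y
  0≤*⁻¹ {x} {y} 0<x 0≤xy = ≮⇒≥ λ y<0 → ≤⇒≯ 0≤xy (*-pos-neg 0<x y<0)

  inverse-pos : ∀ {x y} → x * y ≈ 1# → 0# < x → 0# < y
  inverse-pos p 0<x = 0<*⁻¹ 0<x (<-resp refl (sym p) 0<1)

  inverse-neg : ∀ {x y} → x * y ≈ 1# → x < 0# → y < 0#
  inverse-neg {x} {y} p x<0 = 0<-⇒<0 (inverse-pos
    (trans (solve 2 (λ x y → :- x :* :- y := x :* y) refl x y) p) (<0⇒0<- x<0))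

  *-zero⁻¹ : ∀ {x y} → ¬ (x ≈ 0#) → x * y ≈ 0# → y ≈ 0#
  *-zero⁻¹ {x} {y} x≉0 p = begin
    y                ≈⟨ *-identityˡ y ⟨
    1# * y           ≈⟨ *-congʳ (trans (*-comm i x) (proj₂ (inverse x x≉0))) ⟨
    i * x * y        ≈⟨ *-assoc i x y ⟩
    i * (x * y)      ≈⟨ *-congˡ p ⟩
    i * 0#           ≈⟨ zeroʳ i ⟩
    0#               ∎
    where i = proj₁ (inverse x x≉0)

-- Sums modulo 2 and selection by horizontal position

xorSum : ∀ {a} {A : Set a} → (A → Bool) → List A → Bool
xorSum h = foldr (λ x b → h x xor b) false

-- The first two arguments tell whether the two ends of a segment lie to the left of a point. If
-- they agree, the point is outside the horizontal extent; otherwise they give the direction of the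
-- segment, which decides how the sign of a determinant is to be read.
sel : Bool → Bool → Bool → Bool → Bool
sel l r p n = if l then (if r then false else p) else (if r then n else false)

sel-swap : ∀ l r p n → sel l r p n ≡ sel r l n p
sel-swap false false p n = ≡.refl
sel-swap false true  p n = ≡.refl
sel-swap true  false p n = ≡.refl
sel-swap true  true  p n = ≡.refl

sel-false : ∀ l r → sel l r false false ≡ false
sel-false false false = ≡.refl
sel-false false true  = ≡.refl
sel-false true  false = ≡.refl
sel-false true  true  = ≡.refl

-- Plane geometry: determinants and disjoint segments

module Plane {c ℓ₁ ℓ₂ : Level} (K : OrderedField c ℓ₁ ℓ₂) where
  open OrderedField K hiding (zero)
  open OverField K
  open OrderedFieldProperties K
  open RingSolver
  open import Relation.Binary.Reasoning.Setoid setoid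

  pos? neg? : Carrier → Bool
  pos? x = does (0# <? x)
  neg? x = does (x <? 0#)

  pos?-true : ∀ {x} → 0# < x → pos? x ≡ true
  pos?-true = dec-true (_ <? _)

  pos?-false : ∀ {x} → ¬ (0# < x) → pos? x ≡ false
  pos?-false = dec-false (_ <? _)

  neg?-false : ∀ {x} → ¬ (x < 0#) → neg? x ≡ false
  neg?-false = dec-false (_ <? _)

  pos?-neg : ∀ {x y} → y ≈ - x → pos? y ≡ neg? x
  pos?-neg {x} {y} y≈-x with x <? 0#
  ... | yes x<0 = pos?-true (<-resp refl (sym y≈-x) (<0⇒0<- x<0))
  ... | no  x≮0 = pos?-false λ 0<y → x≮0 (0<-⇒<0 (<-resp refl y≈-x 0<y))

  neg?-pos : ∀ {x y} → y ≈ - x → neg? y ≡ pos? x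
  neg?-pos {x} {y} y≈-x = ≡.sym (pos?-neg (trans (sym (solve 1 (λ x → :- (:- x) := x) refl x)) (-‿cong (sym y≈-x))))

  pos?-cong : ∀ {x y} → x ≈ y → pos? x ≡ pos? y
  pos?-cong {x} {y} x≈y = ≡.trans (pos?-neg (trans x≈y (solve 1 (λ x → x := :- (:- x)) refl y)))
    (≡.sym (pos?-neg (solve 1 (λ x → x := :- (:- x)) refl y)))

  neg?-cong : ∀ {x y} → x ≈ y → neg? x ≡ neg? y
  neg?-cong x≈y = ≡.trans (≡.sym (pos?-neg refl)) (≡.trans (pos?-cong (-‿cong x≈y)) (pos?-neg refl))

  neg?≡pos? : ∀ {x y} → ¬ (x ≈ 0#) → ¬ (y ≈ 0#) → ¬ (x < 0# × y < 0#) → ¬ (0# < x × 0# < y) →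
              neg? x ≡ pos? y
  neg?≡pos? {x} {y} x≉0 y≉0 ¬neg ¬pos with compare x 0# | compare y 0#
  ... | tri≈ _ x≈0 _ | _            = contradiction x≈0 x≉0
  ... | _            | tri≈ _ y≈0 _ = contradiction y≈0 y≉0
  ... | tri< x<0 _ _ | tri< y<0 _ _ = contradiction (x<0 , y<0) ¬neg
  ... | tri> _ _ 0<x | tri> _ _ 0<y = contradiction (0<x , 0<y) ¬pos
  ... | tri< x<0 _ _ | tri> _ _ 0<y = ≡.sym (pos?-true 0<y)
  ... | tri> _ _ 0<x | tri< y<0 _ _ = ≡.sym (pos?-false (<-asym y<0))

  between₀ : ∀ p r → between p r 0# ≈ₚ p
  between₀ (p₁ , p₂) (r₁ , r₂) = at₀ p₁ r₁ , at₀ p₂ r₂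
    where
    at₀ : ∀ p r → p + 0# * (r - p) ≈ p
    at₀ p r = trans (+-congˡ (zeroˡ _)) (+-identityʳ p)

  between₁ : ∀ p r → between p r 1# ≈ₚ r
  between₁ (p₁ , p₂) (r₁ , r₂) = at₁ p₁ r₁ , at₁ p₂ r₂
    where
    at₁ : ∀ p r → p + 1# * (r - p) ≈ r
    at₁ p r = trans (+-congˡ (*-identityˡ _)) (solve 2 (λ p r → p :+ (r :- p) := r) refl p r)

  between-flip : ∀ p r t → between p r t ≈ₚ between r p (1# - t)
  between-flip (p₁ , p₂) (r₁ , r₂) t = flip₁ p₁ r₁ , flip₁ p₂ r₂
    where
    flip₁ : ∀ p r → p + t * (r - p) ≈ r + (1# - t) * (p - r)
    flip₁ p r = solve 3 (λ p r t → p :+ t :* (r :- p) := r :+ (con (+ 1) :- t) :* (p :- r)) (refl) p r t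

  Unit-flip : ∀ {t} → Unit t → Unit (1# - t)
  Unit-flip {t} (0≤t , t≤1) = ≤⇒0≤- t≤1 ,
    0≤-⇒≤ (≤-resp refl (solve 1 (λ t → t := con (+ 1) :- (con (+ 1) :- t)) refl t) 0≤t)

  ≈ₚ-sym : ∀ {p r} → p ≈ₚ r → r ≈ₚ p
  ≈ₚ-sym (p , r) = sym p , sym r

  ≈ₚ-trans : ∀ {p r s} → p ≈ₚ r → r ≈ₚ s → p ≈ₚ s
  ≈ₚ-trans (p , p′) (r , r′) = trans p r , trans p′ r′

  Unit-0 : Unit 0#
  Unit-0 = ≤-refl , inj₁ 0<1

  Unit-1 : Unit 1#
  Unit-1 = inj₁ 0<1 , ≤-refl

  turn : Point → Point → Point → Carrier
  turn p r s = cross (r -ₚ p) (s -ₚ p)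

  turn-start : ∀ p r → turn p r p ≈ 0#
  turn-start (p₁ , p₂) (r₁ , r₂) = solve 4 (λ p₁ p₂ r₁ r₂ → let p = p₁ , p₂ ; r = r₁ , r₂ in
    :turn p r p := con (+ 0)) refl p₁ p₂ r₁ r₂

  turn-end : ∀ p r → turn p r r ≈ 0#
  turn-end (p₁ , p₂) (r₁ , r₂) = solve 4 (λ p₁ p₂ r₁ r₂ → let p = p₁ , p₂ ; r = r₁ , r₂ in
    :turn p r r := con (+ 0)) refl p₁ p₂ r₁ r₂

  turn-swap : ∀ p r s → turn r p s ≈ - turn p r s
  turn-swap (p₁ , p₂) (r₁ , r₂) (s₁ , s₂) = solve 6 (λ p₁ p₂ r₁ r₂ s₁ s₂ →
    let p = p₁ , p₂ ; r = r₁ , r₂ ; s = s₁ , s₂ in :turn r p s := :- :turn p r s) refl p₁ p₂ r₁ r₂ s₁ s₂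

  turn-rotate : ∀ p r s → turn r s p ≈ turn p r s
  turn-rotate (p₁ , p₂) (r₁ , r₂) (s₁ , s₂) = solve 6 (λ p₁ p₂ r₁ r₂ s₁ s₂ →
    let p = p₁ , p₂ ; r = r₁ , r₂ ; s = s₁ , s₂ in :turn r s p := :turn p r s) refl p₁ p₂ r₁ r₂ s₁ s₂

  turn-cross : ∀ p r s → cross (r -ₚ p) (s -ₚ r) ≈ turn p r s
  turn-cross (p₁ , p₂) (r₁ , r₂) (s₁ , s₂) = solve 6 (λ p₁ p₂ r₁ r₂ s₁ s₂ →
    let p = p₁ , p₂ ; r = r₁ , r₂ ; s = s₁ , s₂ in :cross (r :-ₚ p) (s :-ₚ r) := :turn p r s) refl p₁ p₂ r₁ r₂ s₁ s₂

  Disjoint : Point → Point → Point → Point → Set (c ⊔ ℓ₁ ⊔ ℓ₂)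
  Disjoint a b c d = ∀ {s t} → Unit s → Unit t → ¬ (between a b s ≈ₚ between c d t)

  -- The coordinate abscissa is constant along the direction 𝔩, which is
  -- thought of as pointing upwards.

  module Direction (𝔩 : Point) where

    abscissa : Point → Carrier
    abscissa p = cross p 𝔩

    abscissa-- : ∀ p r → cross (r -ₚ p) 𝔩 ≈ abscissa r - abscissa p
    abscissa-- (p₁ , p₂) (r₁ , r₂) = solve 6 (λ p₁ p₂ r₁ r₂ l₁ l₂ →
      let p = p₁ , p₂ ; r = r₁ , r₂ ; l = l₁ , l₂ in :cross (r :-ₚ p) l := :cross r l :- :cross p l)
      refl p₁ p₂ r₁ r₂ (proj₁ 𝔩) (proj₂ 𝔩)

    abscissa--ʳ : ∀ p r → cross 𝔩 (r -ₚ p) ≈ abscissa p - abscissa r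
    abscissa--ʳ (p₁ , p₂) (r₁ , r₂) = solve 6 (λ p₁ p₂ r₁ r₂ l₁ l₂ →
      let p = p₁ , p₂ ; r = r₁ , r₂ ; l = l₁ , l₂ in :cross l (r :-ₚ p) := :cross p l :- :cross r l)
      refl p₁ p₂ r₁ r₂ (proj₁ 𝔩) (proj₂ 𝔩)

    abscissa-between : ∀ p r t → abscissa (between p r t) ≈ abscissa p + t * (abscissa r - abscissa p)
    abscissa-between (p₁ , p₂) (r₁ , r₂) t = solve 7 (λ p₁ p₂ r₁ r₂ l₁ l₂ t →
      let p = p₁ , p₂ ; r = r₁ , r₂ ; l = l₁ , l₂ in
      :cross (p₁ :+ t :* (r₁ :- p₁) , p₂ :+ t :* (r₂ :- p₂)) l := :cross p l :+ t :* (:cross r l :- :cross p l))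
      refl p₁ p₂ r₁ r₂ (proj₁ 𝔩) (proj₂ 𝔩) t

    abscissa-cong : ∀ {p r} → p ≈ₚ r → abscissa p ≈ abscissa r
    abscissa-cong (p , r) = +-cong (*-congʳ p) (-‿cong (*-congʳ r))

    -- The quotient of the abscissa differences is the parameter; collinearity makes both
    -- coordinates agree with it.
    touch : ∀ {p r s} → turn p r s ≈ 0# → abscissa p ≤ abscissa s → abscissa s ≤ abscissa r →
            abscissa p < abscissa r → ∃ λ t → Unit t × s ≈ₚ between p r t
    touch {p@(p₁ , p₂)} {r@(r₁ , r₂)} {s@(s₁ , s₂)} turn≈0 p≤s s≤r p<r =
      t , (0≤t , t≤1) , on₁ , on₂
      where
      w i t : Carrier
      w = abscissa r - abscissa p
      i = proj₁ (inverse w (0<⇒≉0 (<⇒0<- p<r)))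
      t = (abscissa s - abscissa p) * i
      wi : w * i ≈ 1#
      wi = proj₂ (inverse w (0<⇒≉0 (<⇒0<- p<r)))
      0≤i : 0# ≤ i
      0≤i = inj₁ (inverse-pos wi (<⇒0<- p<r))
      0≤t : 0# ≤ t
      0≤t = 0≤* (≤⇒0≤- p≤s) 0≤i
      t≤1 : t ≤ 1#
      t≤1 = 0≤-⇒≤ (≤-resp refl (begin
        (abscissa r - abscissa s) * i
          ≈⟨ solve 4 (λ r s p i → (r :- s) :* i := (r :- p) :* i :- (s :- p) :* i)
               refl (abscissa r) (abscissa s) (abscissa p) i ⟩
        w * i - t ≈⟨ +-congʳ wi ⟩
        1# - t ∎) (0≤* (≤⇒0≤- s≤r) 0≤i))
      solved : ∀ x y g → w * x - (abscissa s - abscissa p) * y ≈ turn p r s * g → x ≈ t * y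
      solved x y g h = begin
        x                  ≈⟨ *-identityˡ x ⟨
        1# * x             ≈⟨ *-congʳ wi ⟨
        w * i * x          ≈⟨ solve 5 (λ w i x y z → w :* i :* x := (w :* x :- z :* y) :* i :+ z :* i :* y)
                                refl w i x y (abscissa s - abscissa p) ⟩
        (w * x - (abscissa s - abscissa p) * y) * i + t * y
          ≈⟨ +-congʳ (*-congʳ (trans h (trans (*-congʳ turn≈0) (zeroˡ g)))) ⟩
        0# * i + t * y     ≈⟨ trans (+-congʳ (zeroˡ i)) (+-identityˡ _) ⟩
        t * y              ∎
      shift : ∀ {x y z} → x - y ≈ z → x ≈ y + z
      shift {x} {y} h = trans (solve 2 (λ x y → x := y :+ (x :- y)) refl x y) (+-congˡ h)
      on₁ : s₁ ≈ p₁ + t * (r₁ - p₁)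
      on₁ = shift (solved _ _ (proj₁ 𝔩) (solve 8 (λ p₁ p₂ r₁ r₂ s₁ s₂ l₁ l₂ →
        let p = p₁ , p₂ ; r = r₁ , r₂ ; s = s₁ , s₂ ; l = l₁ , l₂ in
        (:cross r l :- :cross p l) :* (s₁ :- p₁) :- (:cross s l :- :cross p l) :* (r₁ :- p₁) := :turn p r s :* l₁)
        refl p₁ p₂ r₁ r₂ s₁ s₂ (proj₁ 𝔩) (proj₂ 𝔩)))
      on₂ : s₂ ≈ p₂ + t * (r₂ - p₂)
      on₂ = shift (solved _ _ (proj₂ 𝔩) (solve 8 (λ p₁ p₂ r₁ r₂ s₁ s₂ l₁ l₂ →
        let p = p₁ , p₂ ; r = r₁ , r₂ ; s = s₁ , s₂ ; l = l₁ , l₂ in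
        (:cross r l :- :cross p l) :* (s₂ :- p₂) :- (:cross s l :- :cross p l) :* (r₂ :- p₂) := :turn p r s :* l₂)
        refl p₁ p₂ r₁ r₂ s₁ s₂ (proj₁ 𝔩) (proj₂ 𝔩)))

    module Meeting {a b c d : Point} (a<b : abscissa a < abscissa b) (c<d : abscissa c < abscissa d)
                   (disjoint : Disjoint a b c d) where
      D : Carrier
      D = cross (b -ₚ a) (d -ₚ c)

      D≈ : D ≈ turn c d a - turn c d b
      D≈ = identity a b c d
        where
        identity : ∀ a b c d → cross (b -ₚ a) (d -ₚ c) ≈ turn c d a - turn c d b
        identity (a₁ , a₂) (b₁ , b₂) (c₁ , c₂) (d₁ , d₂) = solve 8 (λ a₁ a₂ b₁ b₂ c₁ c₂ d₁ d₂ →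
          let a = a₁ , a₂ ; b = b₁ , b₂ ; c = c₁ , c₂ ; d = d₁ , d₂ in
          :cross (b :-ₚ a) (d :-ₚ c) := :turn c d a :- :turn c d b) refl a₁ a₂ b₁ b₂ c₁ c₂ d₁ d₂

      -- If `turn c d b` and `turn a b c` have the same sign, this identity reveals the sign of `D`,
      -- because `abscissa b - abscissa c` is nonnegative in the alternating position.
      balance : D * (abscissa b - abscissa c) ≈
        - (turn a b c * (abscissa d - abscissa c) + turn c d b * (abscissa b - abscissa a))
      balance = identity a b c d 𝔩
        where
        identity : ∀ a b c d l → cross (b -ₚ a) (d -ₚ c) * (cross b l - cross c l) ≈
          - (turn a b c * (cross d l - cross c l) + turn c d b * (cross b l - cross a l))
        identity (a₁ , a₂) (b₁ , b₂) (c₁ , c₂) (d₁ , d₂) (l₁ , l₂) =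
          solve 10 (λ a₁ a₂ b₁ b₂ c₁ c₂ d₁ d₂ l₁ l₂ →
          let a = a₁ , a₂ ; b = b₁ , b₂ ; c = c₁ , c₂ ; d = d₁ , d₂ ; l = l₁ , l₂ in
          :cross (b :-ₚ a) (d :-ₚ c) :* (:cross b l :- :cross c l)
          := :- (:turn a b c :* (:cross d l :- :cross c l) :+ :turn c d b :* (:cross b l :- :cross a l)))
          refl a₁ a₂ b₁ b₂ c₁ c₂ d₁ d₂ l₁ l₂

      -- The lines ab and cd meet at the parameters s and t (Cramer).

      module _ (i : Carrier) (Di : D * i ≈ 1#) where
        s t : Carrier
        s = turn c d a * i
        t = - turn a b c * i

        1-s : 1# - s ≈ - turn c d b * i
        1-s = begin
          1# - s                                        ≈⟨ +-congʳ (trans (*-congʳ (sym D≈)) Di) ⟨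
          (turn c d a - turn c d b) * i - turn c d a * i
            ≈⟨ solve 3 (λ x y i → (x :- y) :* i :- x :* i := :- y :* i) refl (turn c d a) (turn c d b) i ⟩
          - turn c d b * i ∎

        meet : between a b s ≈ₚ between c d t
        meet = meet₁ a b c d Di , meet₂ a b c d Di
          where
          finish : ∀ {x y e z} → e * i ≈ 1# → e * (x - y) + z ≈ 0# → x + z * i ≈ y
          finish {x} {y} {e} {z} ei h = begin
            x + z * i
              ≈⟨ solve 3 (λ x y w → x :+ w := y :+ (con (+ 1) :* (x :- y) :+ w)) refl x y (z * i) ⟩
            y + (1# * (x - y) + z * i)        ≈⟨ +-congˡ (+-congʳ (*-congʳ ei)) ⟨
            y + (e * i * (x - y) + z * i)
              ≈⟨ solve 5 (λ x y z e i → y :+ (e :* i :* (x :- y) :+ z :* i) := y :+ (e :* (x :- y) :+ z) :* i) refl x y z e i ⟩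
            y + (e * (x - y) + z) * i         ≈⟨ +-congˡ (trans (*-congʳ h) (zeroˡ i)) ⟩
            y + 0#                            ≈⟨ +-identityʳ y ⟩
            y                                 ∎
          gather : ∀ x y u v r w → x + (u * r - - v * w) * i ≈ y → x + u * i * r ≈ y + - v * i * w
          gather x y u v r w h = trans
            (solve 6 (λ x u v r w i → x :+ u :* i :* r := (x :+ (u :* r :- :- v :* w) :* i) :+ :- v :* i :* w) refl x u v r w i)
            (+-congʳ h)
          meet₁ : ∀ a b c d → cross (b -ₚ a) (d -ₚ c) * i ≈ 1# →
            proj₁ (between a b (turn c d a * i)) ≈ proj₁ (between c d (- turn a b c * i))
          meet₁ (a₁ , a₂) (b₁ , b₂) (c₁ , c₂) (d₁ , d₂) Di = gather _ _ _ _ _ _ (finish Di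
            (solve 8 (λ a₁ a₂ b₁ b₂ c₁ c₂ d₁ d₂ →
              let a = a₁ , a₂ ; b = b₁ , b₂ ; c = c₁ , c₂ ; d = d₁ , d₂ in
              :cross (b :-ₚ a) (d :-ₚ c) :* (a₁ :- c₁)
              :+ (:turn c d a :* (b₁ :- a₁) :- :- :turn a b c :* (d₁ :- c₁)) := con (+ 0))
              refl a₁ a₂ b₁ b₂ c₁ c₂ d₁ d₂))
          meet₂ : ∀ a b c d → cross (b -ₚ a) (d -ₚ c) * i ≈ 1# →
            proj₂ (between a b (turn c d a * i)) ≈ proj₂ (between c d (- turn a b c * i))
          meet₂ (a₁ , a₂) (b₁ , b₂) (c₁ , c₂) (d₁ , d₂) Di = gather _ _ _ _ _ _ (finish Di
            (solve 8 (λ a₁ a₂ b₁ b₂ c₁ c₂ d₁ d₂ →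
              let a = a₁ , a₂ ; b = b₁ , b₂ ; c = c₁ , c₂ ; d = d₁ , d₂ in
              :cross (b :-ₚ a) (d :-ₚ c) :* (a₂ :- c₂)
              :+ (:turn c d a :* (b₂ :- a₂) :- :- :turn a b c :* (d₂ :- c₂)) := con (+ 0))
              refl a₁ a₂ b₁ b₂ c₁ c₂ d₁ d₂))

        abscissa-meet : abscissa a + s * (abscissa b - abscissa a) ≈ abscissa c + t * (abscissa d - abscissa c)
        abscissa-meet = trans (sym (abscissa-between a b s)) (trans (abscissa-cong meet) (abscissa-between c d t))

        -- Signs of turns supply only two of the four bounds on `s` and `t`. The other two, such as
        -- this one, come from comparing abscissas at the meeting point.
        0≤s : abscissa a ≤ abscissa c → 0# ≤ t → 0# ≤ s
        0≤s a≤c 0≤t = 0≤*⁻¹ (<⇒0<- a<b) (≤-resp refl (begin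
          (abscissa c - abscissa a) + (abscissa d - abscissa c) * t
            ≈⟨ solve 4 (λ a c d t → (c :- a) :+ (d :- c) :* t := (c :+ t :* (d :- c)) :- a) refl
                 (abscissa a) (abscissa c) (abscissa d) t ⟩
          (abscissa c + t * (abscissa d - abscissa c)) - abscissa a
            ≈⟨ +-congʳ abscissa-meet ⟨
          (abscissa a + s * (abscissa b - abscissa a)) - abscissa a
            ≈⟨ solve 3 (λ a b s → (a :+ s :* (b :- a)) :- a := (b :- a) :* s) refl (abscissa a) (abscissa b) s ⟩
          (abscissa b - abscissa a) * s ∎)
          (0≤+ (≤⇒0≤- a≤c) (0≤* (≤⇒0≤- (inj₁ c<d)) 0≤t)))

        0≤t : abscissa c ≤ abscissa a → 0# ≤ s → 0# ≤ t
        0≤t c≤a 0≤s = 0≤*⁻¹ (<⇒0<- c<d) (≤-resp refl (begin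
          (abscissa a - abscissa c) + (abscissa b - abscissa a) * s
            ≈⟨ solve 4 (λ a c d t → (c :- a) :+ (d :- c) :* t := (c :+ t :* (d :- c)) :- a) refl
                 (abscissa c) (abscissa a) (abscissa b) s ⟩
          (abscissa a + s * (abscissa b - abscissa a)) - abscissa c
            ≈⟨ +-congʳ abscissa-meet ⟩
          (abscissa c + t * (abscissa d - abscissa c)) - abscissa c
            ≈⟨ solve 3 (λ a b s → (a :+ s :* (b :- a)) :- a := (b :- a) :* s) refl (abscissa c) (abscissa d) t ⟩
          (abscissa d - abscissa c) * t ∎)
          (0≤+ (≤⇒0≤- c≤a) (0≤* (≤⇒0≤- (inj₁ a<b)) 0≤s)))

        t≤1 : abscissa b ≤ abscissa d → 0# ≤ 1# - s → t ≤ 1#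
        t≤1 b≤d 0≤1-s = 0≤-⇒≤ (0≤*⁻¹ (<⇒0<- c<d) (≤-resp refl (begin
          (abscissa d - abscissa b) + (abscissa b - abscissa a) * (1# - s)
            ≈⟨ solve 4 (λ a b d s → (d :- b) :+ (b :- a) :* (con (+ 1) :- s) := d :- (a :+ s :* (b :- a))) refl
                 (abscissa a) (abscissa b) (abscissa d) s ⟩
          abscissa d - (abscissa a + s * (abscissa b - abscissa a))
            ≈⟨ +-congˡ (-‿cong abscissa-meet) ⟩
          abscissa d - (abscissa c + t * (abscissa d - abscissa c))
            ≈⟨ solve 3 (λ c d t → d :- (c :+ t :* (d :- c)) := (d :- c) :* (con (+ 1) :- t)) refl
                 (abscissa c) (abscissa d) t ⟩
          (abscissa d - abscissa c) * (1# - t) ∎)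
          (0≤+ (≤⇒0≤- b≤d) (0≤* (≤⇒0≤- (inj₁ a<b)) 0≤1-s))))

        ¬alternating : abscissa a ≤ abscissa c → abscissa b ≤ abscissa d →
                       0# < - turn a b c * i → ¬ (0# < - turn c d b * i)
        ¬alternating a≤c b≤d 0<t 0<1-s = disjoint
          (0≤s a≤c (inj₁ 0<t) , 0≤-⇒≤ 0≤1-s) (inj₁ 0<t , t≤1 b≤d 0≤1-s) meet
          where
          0≤1-s : 0# ≤ 1# - s
          0≤1-s = inj₁ (<-resp refl (sym 1-s) 0<1-s)

        ¬nested : abscissa c ≤ abscissa a → abscissa b ≤ abscissa d →
                  0# < turn c d a * i → ¬ (0# < - turn c d b * i)
        ¬nested c≤a b≤d 0<s 0<1-s = disjoint
          (inj₁ 0<s , 0≤-⇒≤ 0≤1-s) (0≤t c≤a (inj₁ 0<s) , t≤1 b≤d 0≤1-s) meet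
          where
          0≤1-s : 0# ≤ 1# - s
          0≤1-s = inj₁ (<-resp refl (sym 1-s) 0<1-s)

      positive-factor : ∀ {x y} → 0# ≤ y → 0# < x * y → 0# < x
      positive-factor (inj₁ 0<y) h = 0<*⁻¹ 0<y (<-resp refl (*-comm _ _) h)
      positive-factor {x} (inj₂ 0≈y) h = contradiction (trans (*-congˡ (sym 0≈y)) (zeroʳ x)) (0<⇒≉0 h)

      -- Over the common extent, from `c` to `b`, equal signs would mean that the vertical order of
      -- the two segments at `c` is the opposite of the one at `b`, so that they cross in between.
      alternating : abscissa a ≤ abscissa c → abscissa c ≤ abscissa b → abscissa b ≤ abscissa d →
        ¬ (turn c d b < 0# × turn a b c < 0#) × ¬ (0# < turn c d b × 0# < turn a b c)
      alternating a≤c c≤b b≤d = both-negative , both-positive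
        where
        both-negative : ¬ (turn c d b < 0# × turn a b c < 0#)
        both-negative (α<0 , β<0) = ¬alternating (proj₁ D⁻¹) (proj₂ D⁻¹) a≤c b≤d
          (*-pos (<0⇒0<- β<0) 0<i) (*-pos (<0⇒0<- α<0) 0<i)
          where
          0<D : 0# < D
          0<D = positive-factor (≤⇒0≤- c≤b) (<-resp refl (trans
            (solve 4 (λ x y z w → :- x :* y :+ :- z :* w := :- (x :* y :+ z :* w)) refl _ _ _ _) (sym balance))
            (+-pos-< (*-pos (<0⇒0<- β<0) (<⇒0<- c<d)) (*-pos (<0⇒0<- α<0) (<⇒0<- a<b))))
          D⁻¹ : ∃ λ i → D * i ≈ 1#
          D⁻¹ = inverse D (0<⇒≉0 0<D)
          0<i : 0# < proj₁ D⁻¹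
          0<i = inverse-pos (proj₂ D⁻¹) 0<D

        both-positive : ¬ (0# < turn c d b × 0# < turn a b c)
        both-positive (0<α , 0<β) = ¬alternating (proj₁ D⁻¹) (proj₂ D⁻¹) a≤c b≤d
          (*-neg (0<⇒-<0 0<β) i<0) (*-neg (0<⇒-<0 0<α) i<0)
          where
          D<0 : D < 0#
          D<0 = 0<-⇒<0 (positive-factor (≤⇒0≤- c≤b) (<-resp refl (trans (trans
            (solve 1 (λ x → x := :- (:- x)) refl _) (-‿cong (sym balance)))
            (solve 2 (λ x y → :- (x :* y) := :- x :* y) refl _ _))
            (+-pos-< (*-pos 0<β (<⇒0<- c<d)) (*-pos 0<α (<⇒0<- a<b)))))
          D⁻¹ : ∃ λ i → D * i ≈ 1#
          D⁻¹ = inverse D (<0⇒≉0 D<0)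
          i<0 : proj₁ D⁻¹ < 0#
          i<0 = inverse-neg (proj₂ D⁻¹) D<0

      -- Ends of `ab` on different sides of `cd`, both within its horizontal extent, would force a
      -- crossing. By `D≈` the sign of `D` is immediate here.
      nested : abscissa c ≤ abscissa a → abscissa b ≤ abscissa d →
        ¬ (turn c d a < 0# × 0# < turn c d b) × ¬ (0# < turn c d a × turn c d b < 0#)
      nested c≤a b≤d = rising , falling
        where
        rising : ¬ (turn c d a < 0# × 0# < turn c d b)
        rising (α₁<0 , 0<α₂) = ¬nested (proj₁ D⁻¹) (proj₂ D⁻¹) c≤a b≤d
          (*-neg α₁<0 i<0) (*-neg (0<⇒-<0 0<α₂) i<0)
          where
          D<0 : D < 0#
          D<0 = 0<-⇒<0 (<-resp refl (trans (solve 2 (λ x y → :- x :+ y := :- (x :- y)) refl _ _) (-‿cong (sym D≈)))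
            (+-pos-< (<0⇒0<- α₁<0) 0<α₂))
          D⁻¹ : ∃ λ i → D * i ≈ 1#
          D⁻¹ = inverse D (<0⇒≉0 D<0)
          i<0 : proj₁ D⁻¹ < 0#
          i<0 = inverse-neg (proj₂ D⁻¹) D<0

        falling : ¬ (0# < turn c d a × turn c d b < 0#)
        falling (0<α₁ , α₂<0) = ¬nested (proj₁ D⁻¹) (proj₂ D⁻¹) c≤a b≤d
          (*-pos 0<α₁ 0<i) (*-pos (<0⇒0<- α₂<0) 0<i)
          where
          0<D : 0# < D
          0<D = <-resp refl (sym D≈) (+-pos-< 0<α₁ (<0⇒0<- α₂<0))
          D⁻¹ : ∃ λ i → D * i ≈ 1#
          D⁻¹ = inverse D (0<⇒≉0 0<D)
          0<i : 0# < proj₁ D⁻¹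
          0<i = inverse-pos (proj₂ D⁻¹) 0<D

-- Parity, and telescoping along chains of edges

odd : ℕ → Bool
odd zero    = false
odd (suc k) = not (odd k)

oddℤ : ℤ → Bool
oddℤ i = odd ℤ.∣ i ∣

not-xorˡ : ∀ x y → not x xor y ≡ not (x xor y)
not-xorˡ false y = ≡.refl
not-xorˡ true  y = ≡.sym (Bool.not-involutive y)

not-xorʳ : ∀ x y → x xor not y ≡ not (x xor y)
not-xorʳ false y = ≡.refl
not-xorʳ true  y = ≡.refl

odd-+ : ∀ k l → odd (k ℕ.+ l) ≡ odd k xor odd l
odd-+ zero    l = ≡.refl
odd-+ (suc k) l = ≡.trans (≡.cong not (odd-+ k l)) (≡.sym (not-xorˡ (odd k) (odd l)))

oddℤ-⊖ : ∀ k l → oddℤ (k ℤ.⊖ l) ≡ odd k xor odd l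
oddℤ-⊖ zero    zero    = ≡.refl
oddℤ-⊖ zero    (suc l) = ≡.refl
oddℤ-⊖ (suc k) zero    = ≡.sym (Bool.xor-identityʳ _)
oddℤ-⊖ (suc k) (suc l) = ≡.trans (≡.cong oddℤ (ℤ.[1+m]⊖[1+n]≡m⊖n k l)) (≡.trans (oddℤ-⊖ k l)
  (≡.sym (≡.trans (not-xorˡ (odd k) _) (≡.trans (≡.cong not (not-xorʳ (odd k) (odd l))) (Bool.not-involutive _)))))

oddℤ-+ : ∀ i j → oddℤ (i ℤ.+ j) ≡ oddℤ i xor oddℤ j
oddℤ-+ (+ k)    (+ l)    = odd-+ k l
oddℤ-+ (+ k)    -[1+ l ] = oddℤ-⊖ k (suc l)
oddℤ-+ -[1+ k ] (+ l)    = ≡.trans (oddℤ-⊖ l (suc k)) (Bool.xor-comm (odd l) _)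
oddℤ-+ -[1+ k ] -[1+ l ] = ≡.trans (≡.cong not (≡.cong odd (≡.sym (ℕ.+-suc k l)))) (odd-+ (suc k) (suc l))

xorSum-cong : ∀ {a} {A : Set a} {g h : A → Bool} xs → All (λ x → g x ≡ h x) xs → xorSum g xs ≡ xorSum h xs
xorSum-cong []       []       = ≡.refl
xorSum-cong (x ∷ xs) (p ∷ ps) = ≡.cong₂ _xor_ p (xorSum-cong xs ps)

xorSum-false : ∀ {a} {A : Set a} {h : A → Bool} xs → All (λ x → h x ≡ false) xs → xorSum h xs ≡ false
xorSum-false []       []       = ≡.refl
xorSum-false (x ∷ xs) (p ∷ ps) = ≡.cong₂ _xor_ p (xorSum-false xs ps)

xorSum-++ : ∀ {a} {A : Set a} (h : A → Bool) xs ys → xorSum h (xs ++ ys) ≡ xorSum h xs xor xorSum h ys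
xorSum-++ h []       ys = ≡.refl
xorSum-++ h (x ∷ xs) ys = ≡.trans (≡.cong (h x xor_) (xorSum-++ h xs ys)) (≡.sym (Bool.xor-assoc (h x) _ _))

xorSum-xor : ∀ {a} {A : Set a} (g h : A → Bool) xs → xorSum (λ x → g x xor h x) xs ≡ xorSum g xs xor xorSum h xs
xorSum-xor g h []       = ≡.refl
xorSum-xor g h (x ∷ xs) = ≡.trans (≡.cong ((g x xor h x) xor_) (xorSum-xor g h xs))
  (solve 4 (λ a b c d → (a :+ b) :+ (c :+ d) := (a :+ c) :+ (b :+ d)) ≡.refl (g x) (h x) _ _)
  where open xor-∧-Solver

module Chain {a v} {E : Set a} {V : Set v} (src tgt : E → V) where

  Chained : List E → Set (a ⊔ v)
  Chained = Linked (λ e f → tgt e ≡ src f)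

  end : E → List E → V
  end e []      = tgt e
  end e (f ∷ L) = end f L

  telescope : ∀ (h : V → Bool) e L → Chained (e ∷ L) →
              xorSum (λ f → h (src f) xor h (tgt f)) (e ∷ L) ≡ h (src e) xor h (end e L)
  telescope h e []      [-]     = Bool.xor-identityʳ _
  telescope h e (f ∷ L) (p ∷ ps) = ≡.trans (≡.cong ((h (src e) xor h (tgt e)) xor_) (telescope h f L ps))
    (≡.trans (≡.cong (λ x → (h (src e) xor h x) xor (h (src f) xor h (end f L))) p)
      (solve 3 (λ a b c → (a :+ b) :+ (b :+ c) := a :+ c) ≡.refl (h (src e)) (h (src f)) _))
    where open xor-∧-Solver

  turns : (E → E → Bool) → List E → Bool
  turns w []          = false
  turns w (e ∷ [])    = false
  turns w (e ∷ f ∷ L) = w e f xor turns w (f ∷ L)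

-- Vertical position of vertices relative to edges

module Polygon {c ℓ₁ ℓ₂ v : Level} (K : OrderedField c ℓ₁ ℓ₂) {V : Set v}
               (pos : V → OverField.Point K) (𝔩 : OverField.Point K)
               (before : V → V → Bool) (before-anti : ∀ {u w} → u ≢ w → before u w ≡ not (before w u)) where
  open OrderedField K hiding (zero)
  open OverField K
  open OrderedFieldProperties K
  open RingSolver
  open Plane K
  open Direction 𝔩
  open import Algebra.Properties.Ring ring using (-0#≈0#; -‿involutive)

  x : V → Carrier
  x u = abscissa (pos u)

  -- Ties may be broken arbitrarily: only the antisymmetry of left is needed.

  left : V → V → Bool
  left u w with compare (x u) (x w)
  ... | tri< _ _ _ = true
  ... | tri≈ _ _ _ = before u w
  ... | tri> _ _ _ = false

  left-anti : ∀ {u w} → u ≢ w → left u w ≡ not (left w u)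
  left-anti {u} {w} u≢w with compare (x u) (x w) | compare (x w) (x u)
  ... | tri< _ _ _   | tri> _ _ _   = ≡.refl
  ... | tri≈ _ _ _   | tri≈ _ _ _   = before-anti u≢w
  ... | tri> _ _ _   | tri< _ _ _   = ≡.refl
  ... | tri< p _ ¬p  | tri< p′ _ _  = contradiction p′ ¬p
  ... | tri< _ ¬p _  | tri≈ _ p _   = contradiction (sym p) ¬p
  ... | tri≈ _ p _   | tri< _ ¬p _  = contradiction (sym p) ¬p
  ... | tri≈ _ p _   | tri> _ ¬p _  = contradiction (sym p) ¬p
  ... | tri> _ ¬p _  | tri≈ _ p _   = contradiction (sym p) ¬p
  ... | tri> ¬p _ p  | tri> _ _ p′  = contradiction p′ ¬p

  left-true : ∀ {u w} → left u w ≡ true → x u ≤ x w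
  left-true {u} {w} h with compare (x u) (x w)
  ... | tri< p _ _ = inj₁ p
  ... | tri≈ _ p _ = inj₂ p
  left-true {u} {w} () | tri> _ _ _

  left-false : ∀ {u w} → left u w ≡ false → x w ≤ x u
  left-false {u} {w} h with compare (x u) (x w)
  left-false {u} {w} () | tri< p _ _
  ... | tri≈ _ p _ = inj₂ (sym p)
  ... | tri> _ _ p = inj₁ p

  <⇒left : ∀ {u w} → x u < x w → left u w ≡ true
  <⇒left {u} {w} h with compare (x u) (x w)
  ... | tri< _ _ _ = ≡.refl
  ... | tri≈ ¬p _ _ = contradiction h ¬p
  ... | tri> ¬p _ _ = contradiction h ¬p

  >⇒¬left : ∀ {u w} → x w < x u → left u w ≡ false
  >⇒¬left {u} {w} h with compare (x u) (x w)
  ... | tri< _ _ ¬p = contradiction h ¬p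
  ... | tri≈ _ _ ¬p = contradiction h ¬p
  ... | tri> _ _ _ = ≡.refl

  κ : V → V → V → Carrier
  κ s t u = turn (pos s) (pos t) (pos u)

  -- u lies strictly below (above) the segment st, within its horizontal extent.

  under over : V → V → V → Bool
  under s t u = sel (left s u) (left t u) (neg? (κ s t u)) (pos? (κ s t u))
  over  s t u = sel (left s u) (left t u) (pos? (κ s t u)) (neg? (κ s t u))

  under-swap : ∀ s t u → under t s u ≡ under s t u
  under-swap s t u = ≡.trans (≡.cong₂ (sel (left t u) (left s u))
    (neg?-pos (turn-swap (pos s) (pos t) (pos u))) (pos?-neg (turn-swap (pos s) (pos t) (pos u))))
    (sel-swap (left t u) (left s u) _ _)

  over-swap : ∀ s t u → over t s u ≡ over s t u
  over-swap s t u = ≡.trans (≡.cong₂ (sel (left t u) (left s u))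
    (pos?-neg (turn-swap (pos s) (pos t) (pos u))) (neg?-pos (turn-swap (pos s) (pos t) (pos u))))
    (sel-swap (left t u) (left s u) _ _)

  pos?-zero : ∀ {y} → y ≈ 0# → pos? y ≡ false
  pos?-zero y≈0 = pos?-false (<-irrefl (sym y≈0))

  neg?-zero : ∀ {y} → y ≈ 0# → neg? y ≡ false
  neg?-zero y≈0 = neg?-false (<-irrefl y≈0)

  collinear-under : ∀ s t u → κ s t u ≈ 0# → under s t u ≡ false
  collinear-under s t u h = ≡.trans (≡.cong₂ (sel (left s u) (left t u)) (neg?-zero h) (pos?-zero h))
    (sel-false (left s u) (left t u))

  collinear-over : ∀ s t u → κ s t u ≈ 0# → over s t u ≡ false
  collinear-over s t u h = ≡.trans (≡.cong₂ (sel (left s u) (left t u)) (pos?-zero h) (neg?-zero h))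
    (sel-false (left s u) (left t u))

  under-start : ∀ s t → under s t s ≡ false
  under-start s t = collinear-under s t s (turn-start (pos s) (pos t))

  over-start : ∀ s t → over s t s ≡ false
  over-start s t = collinear-over s t s (turn-start (pos s) (pos t))

  under-end : ∀ s t → under s t t ≡ false
  under-end s t = collinear-under s t t (turn-end (pos s) (pos t))

  over-end : ∀ s t → over s t t ≡ false
  over-end s t = collinear-over s t t (turn-end (pos s) (pos t))

  Separate : V → V → V → V → Set (c ⊔ ℓ₁ ⊔ ℓ₂)
  Separate s t u w = Disjoint (pos s) (pos t) (pos u) (pos w)

  Touches : V → V → V → Set (c ⊔ ℓ₁ ⊔ ℓ₂)
  Touches s t u = ∃ λ r → Unit r × pos u ≈ₚ between (pos s) (pos t) r

  separate-sym : ∀ {s t u w} → Separate s t u w → Separate u w s t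
  separate-sym h p r e = h r p (≈ₚ-sym e)

  separate-swapˡ : ∀ {s t u w} → Separate s t u w → Separate t s u w
  separate-swapˡ h p r e = h (Unit-flip p) r (≈ₚ-trans (≈ₚ-sym (between-flip _ _ _)) e)

  separate-touchˡ : ∀ {s t u w} → Separate s t u w → ¬ Touches u w s
  separate-touchˡ h (r , p , e) = h Unit-0 p (≈ₚ-trans (between₀ _ _) e)

  separate-touchʳ : ∀ {s t u w} → Separate s t u w → ¬ Touches u w t
  separate-touchʳ h (r , p , e) = h Unit-1 p (≈ₚ-trans (between₁ _ _) e)

  -- The bounds on `u` are weak, so that ties of abscissas are covered whichever way they are
  -- broken.
  κ≉0 : ∀ {s t u} → ¬ Touches s t u → x s < x t → x s ≤ x u → x u ≤ x t → ¬ (κ s t u ≈ 0#)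
  κ≉0 ¬touch s<t s≤u u≤t h = ¬touch (touch h s≤u u≤t s<t)

  -- Modulo 2, the ends of the first edge below the second one and the ends of the second edge above
  -- the first one. The asymmetry makes a corner register turns through 𝔩 but not turns through the
  -- opposite direction.
  interplay : V → V → V → V → Bool
  interplay s t u w = (under u w s xor under u w t) xor (over s t u xor over s t w)

  module Ordered {a b u w : V} (a≢u : a ≢ u) (a≢w : a ≢ w) (b≢u : b ≢ u) (b≢w : b ≢ w)
                 (a<b : x a < x b) (u<w : x u < x w) (h : Separate a b u w) where

    neg≈0 : ∀ {y} → - y ≈ 0# → y ≈ 0#
    neg≈0 {y} e = trans (sym (-‿involutive y)) (trans (-‿cong e) -0#≈0#)

    cancel : ∀ {y z} → y ≡ z → (y xor false) xor (false xor z) ≡ false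
    cancel {y} ≡.refl = ≡.trans (≡.cong (_xor y) (Bool.xor-identityʳ y)) (Bool.xor-same y)

    -- The common horizontal extent has two ends, each contributed by an end of one of the segments.
    -- Disjoint segments keep their vertical order over it, so both ends count or neither does. The
    -- first four clauses are impossible orders, and in the next two the extents are disjoint.
    cases : ∀ l₁ l₂ l₃ l₄ → left a u ≡ l₁ → left a w ≡ l₂ → left b u ≡ l₃ → left b w ≡ l₄ →
      (sel (not l₁) (not l₂) (neg? (κ u w a)) (pos? (κ u w a)) xor
       sel (not l₃) (not l₄) (neg? (κ u w b)) (pos? (κ u w b))) xor
      (sel l₁ l₃ (pos? (κ a b u)) (neg? (κ a b u)) xor
       sel l₂ l₄ (pos? (κ a b w)) (neg? (κ a b w))) ≡ false
    cases true  false _     _     p₁ p₂ p₃ p₄ =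
      contradiction (<-≤-trans (≤-<-trans (left-true p₁) u<w) (left-false p₂)) (<-irrefl refl)
    cases _     _     true  false p₁ p₂ p₃ p₄ =
      contradiction (<-≤-trans (≤-<-trans (left-true p₃) u<w) (left-false p₄)) (<-irrefl refl)
    cases false _     true  _     p₁ p₂ p₃ p₄ =
      contradiction (<-≤-trans a<b (≤-trans (left-true p₃) (left-false p₁))) (<-irrefl refl)
    cases _     false _     true  p₁ p₂ p₃ p₄ =
      contradiction (<-≤-trans a<b (≤-trans (left-true p₄) (left-false p₂))) (<-irrefl refl)
    cases false false false false p₁ p₂ p₃ p₄ = ≡.refl
    cases true  true  true  true  p₁ p₂ p₃ p₄ = ≡.refl
    cases false true  false false p₁ p₂ p₃ p₄ = cancel (neg?≡pos?
      (κ≉0 (separate-touchˡ h) u<w u≤a a≤w) (κ≉0 (separate-touchʳ (separate-sym h)) a<b a≤w w≤b)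
      (λ (α , β) → proj₁ alternate (β , α)) (λ (α , β) → proj₂ alternate (β , α)))
      where
      u≤a = left-false p₁
      a≤w = left-true p₂
      w≤b = left-false p₄
      alternate = Meeting.alternating u<w a<b (separate-sym h) u≤a a≤w w≤b
    cases false true  false true  p₁ p₂ p₃ p₄ = ≡.trans (Bool.xor-identityʳ _) (same
      (neg?≡pos? (κ≉0 (separate-touchˡ h) u<w u≤a (≤-trans (inj₁ a<b) b≤w))
        (λ e → κ≉0 (separate-touchʳ h) u<w (≤-trans u≤a (inj₁ a<b)) b≤w (neg≈0 e))
        (λ (α , β) → proj₁ nest (α , -<0⇒0< β)) (λ (α , β) → proj₂ nest (α , 0<-⇒<0 β))))
      where
      u≤a = left-false p₁
      b≤w = left-true p₄
      nest = Meeting.nested a<b u<w h u≤a b≤w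
      same : ∀ {y} {α} → y ≡ pos? (- α) → y xor neg? α ≡ false
      same {α = α} e = ≡.trans (≡.cong (_xor neg? α) (≡.trans e (pos?-neg refl))) (Bool.xor-same (neg? α))
    cases true  true  false false p₁ p₂ p₃ p₄ = same
      (neg?≡pos? (λ e → κ≉0 (separate-touchˡ (separate-sym h)) a<b a≤u (≤-trans (inj₁ u<w) w≤b) (neg≈0 e))
        (κ≉0 (separate-touchʳ (separate-sym h)) a<b (≤-trans a≤u (inj₁ u<w)) w≤b)
        (λ (α , β) → proj₂ nest (-<0⇒0< α , β)) (λ (α , β) → proj₁ nest (0<-⇒<0 α , β)))
      where
      a≤u = left-true p₁
      w≤b = left-false p₄
      nest = Meeting.nested u<w a<b (separate-sym h) a≤u w≤b
      same : ∀ {y} {α} → neg? (- α) ≡ y → pos? α xor y ≡ false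
      same {α = α} e = ≡.trans (≡.cong (pos? α xor_) (≡.trans (≡.sym e) (neg?-pos refl))) (Bool.xor-same (pos? α))
    cases true  true  false true  p₁ p₂ p₃ p₄ = ≡.trans (≡.cong (neg? (κ u w b) xor_) (Bool.xor-identityʳ _))
      (≡.trans (≡.cong (_xor pos? (κ a b u)) (neg?≡pos?
        (κ≉0 (separate-touchʳ h) u<w u≤b b≤w) (κ≉0 (separate-touchˡ (separate-sym h)) a<b a≤u u≤b)
        (proj₁ alternate) (proj₂ alternate))) (Bool.xor-same (pos? (κ a b u))))
      where
      a≤u = left-true p₁
      u≤b = left-false p₃
      b≤w = left-true p₄
      alternate = Meeting.alternating a<b u<w h a≤u u≤b b≤w

    ordered : interplay a b u w ≡ false
    ordered rewrite left-anti (a≢u ∘ ≡.sym) | left-anti (a≢w ∘ ≡.sym)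
                  | left-anti (b≢u ∘ ≡.sym) | left-anti (b≢w ∘ ≡.sym) =
      cases (left a u) (left a w) (left b u) (left b w) ≡.refl ≡.refl ≡.refl ≡.refl

  interplay-swapˡ : ∀ a b u w → interplay b a u w ≡ interplay a b u w
  interplay-swapˡ a b u w = ≡.cong₂ _xor_ (Bool.xor-comm (under u w b) _)
    (≡.cong₂ _xor_ (over-swap a b u) (over-swap a b w))

  interplay-swapʳ : ∀ a b u w → interplay a b w u ≡ interplay a b u w
  interplay-swapʳ a b u w = ≡.cong₂ _xor_ (≡.cong₂ _xor_ (under-swap u w a) (under-swap u w b))
    (Bool.xor-comm (over a b w) _)

  -- Reversing a segment does not change `interplay`, so both may be taken to point to the right.
  separate⇒interplay : ∀ {a b u w} → a ≢ u → a ≢ w → b ≢ u → b ≢ w → ¬ (x a ≈ x b) → ¬ (x u ≈ x w) →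
                       Separate a b u w → interplay a b u w ≡ false
  separate⇒interplay {a} {b} {u} {w} a≢u a≢w b≢u b≢w a≉b u≉w h with compare (x a) (x b) | compare (x u) (x w)
  ... | tri≈ _ p _   | _            = contradiction p a≉b
  ... | _            | tri≈ _ p _   = contradiction p u≉w
  ... | tri< a<b _ _ | tri< u<w _ _ = Ordered.ordered a≢u a≢w b≢u b≢w a<b u<w h
  ... | tri< a<b _ _ | tri> _ _ w<u = ≡.trans (≡.sym (interplay-swapʳ a b u w))
    (Ordered.ordered a≢w a≢u b≢w b≢u a<b w<u (separate-sym (separate-swapˡ (separate-sym h))))
  ... | tri> _ _ b<a | tri< u<w _ _ = ≡.trans (≡.sym (interplay-swapˡ a b u w))
    (Ordered.ordered b≢u b≢w a≢u a≢w b<a u<w (separate-swapˡ h))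
  ... | tri> _ _ b<a | tri> _ _ w<u = ≡.trans (≡.sym (≡.trans (interplay-swapˡ a b w u) (interplay-swapʳ a b u w)))
    (Ordered.ordered b≢w b≢u a≢w a≢u b<a w<u (separate-swapˡ (separate-sym (separate-swapˡ (separate-sym h)))))

  orientation-pos : ∀ {p r} → 0# < cross p r → orientation p r ≡ + 1
  orientation-pos {p} {r} h with compare (cross p r) 0#
  ... | tri< _ _ ¬h = contradiction h ¬h
  ... | tri≈ _ _ ¬h = contradiction h ¬h
  ... | tri> _ _ _  = ≡.refl

  orientation-neg : ∀ {p r} → cross p r < 0# → orientation p r ≡ -[1+ 0 ]
  orientation-neg {p} {r} h with compare (cross p r) 0#
  ... | tri< _ _ _  = ≡.refl
  ... | tri≈ ¬h _ _ = contradiction h ¬h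
  ... | tri> ¬h _ _ = contradiction h ¬h

  windAt : V → V → V → Bool
  windAt u v w = oddℤ (windFrom (orientation (pos v -ₚ pos u) (pos w -ₚ pos v))
                                (orientation (pos v -ₚ pos u) 𝔩) (orientation 𝔩 (pos w -ₚ pos v)))

  -- At a vertex with both edges on its left (right) the path turns through
  -- 𝔩 if and only if it turns left (right).

  data Shape (u v w : V) : Set (c ⊔ ℓ₁ ⊔ ℓ₂) where
    forward   : x u < x v → x v < x w → windAt u v w ≡ false            → Shape u v w
    backward  : x v < x u → x w < x v → windAt u v w ≡ false            → Shape u v w
    rightmost : x u < x v → x w < x v → windAt u v w ≡ pos? (κ u v w)   → Shape u v w
    leftmost  : x v < x u → x v < x w → windAt u v w ≡ neg? (κ u v w)   → Shape u v w

  orientation-odd : ∀ p r → (oddℤ (windFrom (orientation p r) (+ 1) (+ 1)) ≡ pos? (cross p r)) ×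
                            (oddℤ (windFrom (orientation p r) -[1+ 0 ] -[1+ 0 ]) ≡ neg? (cross p r)) ×
                            (oddℤ (windFrom (orientation p r) (+ 1) -[1+ 0 ]) ≡ false) ×
                            (oddℤ (windFrom (orientation p r) -[1+ 0 ] (+ 1)) ≡ false)
  orientation-odd p r with compare (cross p r) 0#
  ... | tri< h _ ¬h  = ≡.sym (pos?-false ¬h) , ≡.refl , ≡.refl , ≡.refl
  ... | tri≈ _ _ ¬g = ≡.sym (pos?-false ¬g) , ≡.refl , ≡.refl , ≡.refl
  ... | tri> _ _ h  = ≡.sym (pos?-true h) , ≡.refl , ≡.refl , ≡.refl

  orientationˡ-right : ∀ {u v} → x u < x v → orientation (pos v -ₚ pos u) 𝔩 ≡ + 1
  orientationˡ-right h = orientation-pos (<-resp refl (sym (abscissa-- _ _)) (<⇒0<- h))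

  orientationˡ-left : ∀ {u v} → x v < x u → orientation (pos v -ₚ pos u) 𝔩 ≡ -[1+ 0 ]
  orientationˡ-left h = orientation-neg (<-resp
    (trans (solve 2 (λ a b → :- (a :- b) := b :- a) refl _ _) (sym (abscissa-- _ _))) refl (0<⇒-<0 (<⇒0<- h)))

  orientationʳ-left : ∀ {u v} → x v < x u → orientation 𝔩 (pos v -ₚ pos u) ≡ + 1
  orientationʳ-left h = orientation-pos (<-resp refl (sym (abscissa--ʳ _ _)) (<⇒0<- h))

  orientationʳ-right : ∀ {u v} → x u < x v → orientation 𝔩 (pos v -ₚ pos u) ≡ -[1+ 0 ]
  orientationʳ-right h = orientation-neg (<-resp
    (trans (solve 2 (λ a b → :- (a :- b) := b :- a) refl _ _) (sym (abscissa--ʳ _ _))) refl (0<⇒-<0 (<⇒0<- h)))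

  shape : ∀ u v w → ¬ (x u ≈ x v) → ¬ (x v ≈ x w) → Shape u v w
  shape u v w u≉v v≉w = by (compare (x u) (x v)) (compare (x v) (x w))
    where
    wind : ∀ {a b} → orientation (pos v -ₚ pos u) 𝔩 ≡ a → orientation 𝔩 (pos w -ₚ pos v) ≡ b →
           windAt u v w ≡ oddℤ (windFrom (orientation (pos v -ₚ pos u) (pos w -ₚ pos v)) a b)
    wind = ≡.cong₂ (λ a b → oddℤ (windFrom (orientation (pos v -ₚ pos u) (pos w -ₚ pos v)) a b))
    odds = orientation-odd (pos v -ₚ pos u) (pos w -ₚ pos v)
    by : Tri (x u < x v) (x u ≈ x v) (x v < x u) → Tri (x v < x w) (x v ≈ x w) (x w < x v) → Shape u v w
    by (tri≈ _ p _)   _              = contradiction p u≉v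
    by _              (tri≈ _ p _)   = contradiction p v≉w
    by (tri< u<v _ _) (tri< v<w _ _) = forward u<v v<w
      (≡.trans (wind (orientationˡ-right u<v) (orientationʳ-right v<w)) (proj₁ (proj₂ (proj₂ odds))))
    by (tri> _ _ v<u) (tri> _ _ w<v) = backward v<u w<v
      (≡.trans (wind (orientationˡ-left v<u) (orientationʳ-left w<v)) (proj₂ (proj₂ (proj₂ odds))))
    by (tri< u<v _ _) (tri> _ _ w<v) = rightmost u<v w<v
      (≡.trans (wind (orientationˡ-right u<v) (orientationʳ-left w<v))
        (≡.trans (proj₁ odds) (pos?-cong (turn-cross _ _ _))))
    by (tri> _ _ v<u) (tri< v<w _ _) = leftmost v<u v<w
      (≡.trans (wind (orientationˡ-left v<u) (orientationʳ-right v<w))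
        (≡.trans (proj₁ (proj₂ odds)) (neg?-cong (turn-cross _ _ _))))

  neg?≡not-pos? : ∀ {y} → ¬ (y ≈ 0#) → neg? y ≡ not (pos? y)
  neg?≡not-pos? {y} y≉0 with compare y 0#
  ... | tri< p _ ¬p = ≡.cong not (≡.sym (pos?-false ¬p))
  ... | tri≈ _ p _  = contradiction p y≉0
  ... | tri> _ _ p  = ≡.cong not (≡.sym (pos?-true p))

  under-by : ∀ {s t u l r n p} → left s u ≡ l → left t u ≡ r → neg? (κ s t u) ≡ n → pos? (κ s t u) ≡ p →
             under s t u ≡ sel l r n p
  under-by ≡.refl ≡.refl ≡.refl ≡.refl = ≡.refl

  over-by : ∀ {s t u l r n p} → left s u ≡ l → left t u ≡ r → neg? (κ s t u) ≡ n → pos? (κ s t u) ≡ p →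
            over s t u ≡ sel l r p n
  over-by ≡.refl ≡.refl ≡.refl ≡.refl = ≡.refl

  xor-falseʳ : ∀ {a b c} → a ≡ b → c ≡ false → a xor c ≡ b
  xor-falseʳ {a} ≡.refl ≡.refl = Bool.xor-identityʳ a

  module Corner {u v w : V} (u≢w : u ≢ w) (u≉v : ¬ (x u ≈ x v)) (v≉w : ¬ (x v ≈ x w)) where

    rotate⁺ : pos? (κ v w u) ≡ pos? (κ u v w)
    rotate⁺ = pos?-cong (turn-rotate (pos u) (pos v) (pos w))

    rotate⁻ : neg? (κ v w u) ≡ neg? (κ u v w)
    rotate⁻ = neg?-cong (turn-rotate (pos u) (pos v) (pos w))

    left-wu : left w u ≡ not (left u w)
    left-wu = left-anti (u≢w ∘ ≡.sym)

    -- The position of w relative to u does not matter: in the shapes rightmost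
    -- and leftmost both values of left u w give the same result.

    corner : under v w u xor over u v w ≡ windAt u v w
    corner with shape u v w u≉v v≉w
    ... | forward u<v v<w wind = ≡.trans (≡.cong₂ _xor_
      (under-by (>⇒¬left u<v) (>⇒¬left (<-trans u<v v<w)) ≡.refl ≡.refl)
      (over-by (<⇒left (<-trans u<v v<w)) (<⇒left v<w) ≡.refl ≡.refl)) (≡.sym wind)
    ... | backward v<u w<v wind = ≡.trans (≡.cong₂ _xor_
      (under-by (<⇒left v<u) (<⇒left (<-trans w<v v<u)) ≡.refl ≡.refl)
      (over-by (>⇒¬left (<-trans w<v v<u)) (>⇒¬left w<v) ≡.refl ≡.refl)) (≡.sym wind)
    ... | rightmost u<v w<v wind = ≡.trans (≡.cong₂ _xor_
      (under-by (>⇒¬left u<v) left-wu rotate⁻ rotate⁺)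
      (over-by ≡.refl (>⇒¬left w<v) ≡.refl ≡.refl))
      (≡.trans (by (left u w) (neg? (κ u v w)) (pos? (κ u v w))) (≡.sym wind))
      where
      by : ∀ l n p → sel false (not l) n p xor sel l false p n ≡ p
      by true  n p = ≡.refl
      by false n p = Bool.xor-identityʳ _
    ... | leftmost v<u v<w wind = ≡.trans (≡.cong₂ _xor_
      (under-by (<⇒left v<u) left-wu rotate⁻ rotate⁺)
      (over-by ≡.refl (<⇒left v<w) ≡.refl ≡.refl))
      (≡.trans (by (left u w) (neg? (κ u v w)) (pos? (κ u v w))) (≡.sym wind))
      where
      by : ∀ l n p → sel true (not l) n p xor sel l true p n ≡ n
      by true  n p = Bool.xor-identityʳ _
      by false n p = ≡.refl

    interplay-corner : interplay u v v w ≡ windAt u v w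
    interplay-corner = ≡.trans (≡.cong₂ _xor_ (xor-falseʳ {under v w u} ≡.refl (under-start v w))
      (≡.cong (_xor over u v w) (over-end u v))) corner

    module _ (¬touch : ¬ Touches u v w) (¬touch′ : ¬ Touches v w u) where

      κ-swap : κ u v w ≈ 0# → κ v u w ≈ 0#
      κ-swap e = trans (turn-swap (pos u) (pos v) (pos w)) (trans (-‿cong e) -0#≈0#)

      κ-rotate : κ u v w ≈ 0# → κ v w u ≈ 0#
      κ-rotate e = trans (turn-rotate (pos u) (pos v) (pos w)) e

      κ-swap-rotate : κ u v w ≈ 0# → κ w v u ≈ 0#
      κ-swap-rotate e = trans (turn-swap (pos v) (pos w) (pos u)) (trans (-‿cong (κ-rotate e)) -0#≈0#)

      touches-swap : ∀ {s t z} → Touches s t z → Touches t s z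
      touches-swap (r , p , e) = 1# - r , Unit-flip p , ≈ₚ-trans e (between-flip _ _ _)

      -- Collinear edges on the same side of `v` overlap, so the end of the one with the smaller
      -- horizontal extent would lie on the other.
      rightmost≉0 : x u < x v → x w < x v → ¬ (κ u v w ≈ 0#)
      rightmost≉0 u<v w<v e = by (left u w) ≡.refl
        where
        by : ∀ l → left u w ≡ l → ⊥
        by true  l = κ≉0 ¬touch u<v (left-true l) (inj₁ w<v) e
        by false l = κ≉0 (¬touch′ ∘ touches-swap) w<v (left-false l) (inj₁ u<v) (κ-swap-rotate e)

      leftmost≉0 : x v < x u → x v < x w → ¬ (κ u v w ≈ 0#)
      leftmost≉0 v<u v<w e = by (left u w) ≡.refl
        where
        by : ∀ l → left u w ≡ l → ⊥
        by true  l = κ≉0 ¬touch′ v<w (inj₁ v<u) (left-true l) (κ-rotate e)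
        by false l = κ≉0 (¬touch ∘ touches-swap) v<u (inj₁ v<w) (left-false l) (κ-swap e)

      -- Compared with `corner`, below and above are exchanged, which at a rightmost or leftmost `v`
      -- complements the answer because the edges are not collinear. Where the path runs on in one
      -- direction neither end counts, and there the two `left` terms differ and supply the 1.
      opposite-corner : (under u v w xor over v w u) xor (left w v xor left u v) ≡ not (windAt u v w)
      opposite-corner with shape u v w u≉v v≉w
      ... | forward u<v v<w wind = ≡.trans (≡.cong₂ _xor_ (≡.cong₂ _xor_
        (under-by (<⇒left (<-trans u<v v<w)) (<⇒left v<w) ≡.refl ≡.refl)
        (over-by (>⇒¬left u<v) (>⇒¬left (<-trans u<v v<w)) ≡.refl ≡.refl))
        (≡.cong₂ _xor_ (>⇒¬left v<w) (<⇒left u<v))) (≡.cong not (≡.sym wind))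
      ... | backward v<u w<v wind = ≡.trans (≡.cong₂ _xor_ (≡.cong₂ _xor_
        (under-by (>⇒¬left (<-trans w<v v<u)) (>⇒¬left w<v) ≡.refl ≡.refl)
        (over-by (<⇒left v<u) (<⇒left (<-trans w<v v<u)) ≡.refl ≡.refl))
        (≡.cong₂ _xor_ (<⇒left w<v) (>⇒¬left v<u))) (≡.cong not (≡.sym wind))
      ... | rightmost u<v w<v wind = ≡.trans (≡.cong₂ _xor_ (≡.cong₂ _xor_
        (under-by ≡.refl (>⇒¬left w<v) ≡.refl ≡.refl)
        (over-by (>⇒¬left u<v) left-wu rotate⁻ rotate⁺))
        (≡.cong₂ _xor_ (<⇒left w<v) (<⇒left u<v)))
        (≡.trans (by (left u w) (neg? (κ u v w)) (pos? (κ u v w))) (≡.trans (neg?≡not-pos? (rightmost≉0 u<v w<v)) (≡.cong not (≡.sym wind))))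
        where
        by : ∀ l n p → (sel l false n p xor sel false (not l) p n) xor false ≡ n
        by true  n p = ≡.trans (Bool.xor-identityʳ _) (Bool.xor-identityʳ _)
        by false n p = Bool.xor-identityʳ _
      ... | leftmost v<u v<w wind = ≡.trans (≡.cong₂ _xor_ (≡.cong₂ _xor_
        (under-by ≡.refl (<⇒left v<w) ≡.refl ≡.refl)
        (over-by (<⇒left v<u) left-wu rotate⁻ rotate⁺))
        (≡.cong₂ _xor_ (>⇒¬left v<w) (>⇒¬left v<u)))
        (≡.trans (by (left u w) (neg? (κ u v w)) (pos? (κ u v w))) (≡.trans
          (≡.trans (≡.sym (Bool.not-involutive _)) (≡.cong not (≡.sym (neg?≡not-pos? (leftmost≉0 v<u v<w)))))
          (≡.cong not (≡.sym wind))))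
        where
        by : ∀ l n p → (sel l true n p xor sel true (not l) p n) xor false ≡ p
        by true  n p = Bool.xor-identityʳ _
        by false n p = ≡.trans (Bool.xor-identityʳ _) (Bool.xor-identityʳ _)

      -- The closing corner enters with the opposite orientation; this is what
      -- makes the total turning of a simple polygon odd.

      closing-corner : interplay v w u v xor (left w v xor left u v) ≡ not (windAt u v w)
      closing-corner = ≡.trans (≡.cong (_xor (left w v xor left u v)) (≡.cong₂ _xor_
        (≡.cong (_xor under u v w) (under-end u v)) (xor-falseʳ {over v w u} ≡.refl (over-start v w)))) opposite-corner

-- Total turning of a simple polygon modulo 2

fresh : ∀ {a v} {E : Set a} {V : Set v} (src tgt : E → V) → let open Chain src tgt in
        ∀ {s} e L → Chained (e ∷ L) → All (λ g → s ≢ src g) L → s ≢ end e L → All (λ g → s ≢ tgt g) (e ∷ L)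
fresh src tgt e []      [-]      []       s≢ = s≢ ∷ []
fresh src tgt e (f ∷ L) (p ∷ ps) (s≢f ∷ r) s≢ = (λ s≡ → s≢f (≡.trans s≡ p)) ∷ fresh src tgt f L ps r s≢

module SimplePolygon {c ℓ₁ ℓ₂ v a : Level} (K : OrderedField c ℓ₁ ℓ₂) {V : Set v}
  (pos : V → OverField.Point K) (𝔩 : OverField.Point K)
  (before : V → V → Bool) (before-anti : ∀ {u w} → u ≢ w → before u w ≡ not (before w u))
  {E : Set a} (src tgt : E → V) where
  open OrderedField K hiding (zero)
  open OverField K
  open OrderedFieldProperties K
  open Plane K
  open Polygon K pos 𝔩 before before-anti
  open Chain src tgt

  module _
    (slanted  : ∀ e → ¬ (x (src e) ≈ x (tgt e)))
    (separate : ∀ e f → src e ≢ src f → src e ≢ tgt f → tgt e ≢ src f → tgt e ≢ tgt f →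
                Separate (src e) (tgt e) (src f) (tgt f))
    (avoids   : ∀ e f u → u ≡ src e ⊎ u ≡ tgt e → u ≢ src f → u ≢ tgt f → ¬ Touches (src f) (tgt f) u)
    (wind     : E → E → Bool)
    (wind≡    : ∀ e f → tgt e ≡ src f → wind e f ≡ windAt (src e) (tgt e) (tgt f))
    where

    loopless : ∀ e → src e ≢ tgt e
    loopless e p = slanted e (reflexive (≡.cong x p))

    pair : E → E → Bool
    pair e f = interplay (src e) (tgt e) (src f) (tgt f)

    pairs : List E → Bool
    pairs []      = false
    pairs (e ∷ L) = xorSum (pair e) L xor pairs L

    -- Every vertex between the first and the last one enters twice.

    pairs-telescope : ∀ e L → Chained (e ∷ L) → pairs (e ∷ L) ≡
      xorSum (λ f → under (src f) (tgt f) (src e)) (e ∷ L) xor xorSum (λ f → over (src f) (tgt f) (end e L)) (e ∷ L)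
    pairs-telescope e [] [-] = ≡.sym (≡.cong₂ _xor_ (≡.cong (_xor false) (under-start (src e) (tgt e)))
                                                  (≡.cong (_xor false) (over-end (src e) (tgt e))))
    pairs-telescope e (f ∷ L) (p ∷ ps) = ≡.trans (≡.cong₂ _xor_ first (pairs-telescope f L ps)) (≡.trans
      (≡.cong (λ s → ((A xor xorSum (λ g → under (src g) (tgt g) s) (f ∷ L)) xor O) xor (B xor C)) p)
      (≡.trans (cancel A B O C) (≡.sym (≡.cong (λ s → (s xor A) xor (O xor C)) (under-start (src e) (tgt e))))))
      where
      A = xorSum (λ g → under (src g) (tgt g) (src e)) (f ∷ L)
      B = xorSum (λ g → under (src g) (tgt g) (src f)) (f ∷ L)
      C = xorSum (λ g → over (src g) (tgt g) (end f L)) (f ∷ L)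
      O = over (src e) (tgt e) (end f L)
      cancel : ∀ a b o d → ((a xor b) xor o) xor (b xor d) ≡ a xor (o xor d)
      cancel = solve 4 (λ a b o d → ((a :+ b) :+ o) :+ (b :+ d) := a :+ (o :+ d)) ≡.refl
        where open xor-∧-Solver
      first : xorSum (pair e) (f ∷ L) ≡ (A xor xorSum (λ g → under (src g) (tgt g) (tgt e)) (f ∷ L)) xor O
      first = ≡.trans (xorSum-xor (λ g → under (src g) (tgt g) (src e) xor under (src g) (tgt g) (tgt e))
                          (λ g → over (src e) (tgt e) (src g) xor over (src e) (tgt e) (tgt g)) (f ∷ L))
        (≡.cong₂ _xor_ (xorSum-xor (λ g → under (src g) (tgt g) (src e)) (λ g → under (src g) (tgt g) (tgt e)) (f ∷ L))
        (≡.trans (telescope (over (src e) (tgt e)) f L ps)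
          (≡.cong (_xor O) (≡.trans (≡.cong (over (src e) (tgt e)) (≡.sym p)) (over-end (src e) (tgt e))))))

    SrcDistinct : List E → Set (v ⊔ a)
    SrcDistinct = AllPairs (λ e f → src e ≢ src f)

    pair-corner : ∀ e f → tgt e ≡ src f → src e ≢ tgt f → pair e f ≡ wind e f
    pair-corner e f p s≢t = ≡.trans (≡.cong (λ s → interplay (src e) (tgt e) s (tgt f)) (≡.sym p))
      (≡.trans (Corner.interplay-corner s≢t (slanted e) (λ q → slanted f (trans (reflexive (≡.cong x (≡.sym p))) q)))
        (≡.sym (wind≡ e f p)))

    pair-separate : ∀ e f → src e ≢ src f → src e ≢ tgt f → tgt e ≢ src f → tgt e ≢ tgt f → pair e f ≡ false
    pair-separate e f ss st ts tt = separate⇒interplay ss st ts tt (slanted e) (slanted f) (separate e f ss st ts tt)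

    pair-others : ∀ {e f} → tgt e ≡ src f → ∀ {L} →
                  All (λ g → src e ≢ src g) L → All (λ g → src e ≢ tgt g) L →
                  All (λ g → src f ≢ src g) L → All (λ g → src f ≢ tgt g) L → All (λ g → pair e g ≡ false) L
    pair-others         p []       []       []       []       = []
    pair-others {e} {f} p (a ∷ as) (b ∷ bs) (c ∷ cs) (d ∷ ds) =
      pair-separate e _ a b (λ q → c (≡.trans (≡.sym p) q)) (λ q → d (≡.trans (≡.sym p) q)) ∷ pair-others p as bs cs ds

    -- No vertex is visited twice, so edges that are not consecutive have no common vertex and
    -- contribute nothing; every consecutive pair contributes its turn.
    pairs-turns : ∀ e L → Chained (e ∷ L) → SrcDistinct (e ∷ L) → All (λ g → src g ≢ end e L) (e ∷ L) →
                  pairs (e ∷ L) ≡ turns wind (e ∷ L)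
    pairs-turns e []      _        _              _            = ≡.refl
    pairs-turns e (f ∷ L) (p ∷ ps) ((e≢f ∷ e≢) ∷ ds@(f≢ ∷ _)) (e≢end ∷ ends@(f≢end ∷ _)) =
      ≡.cong₂ _xor_ first (pairs-turns f L ps ds ends)
      where
      e≢tgt : All (λ g → src e ≢ tgt g) (f ∷ L)
      e≢tgt = fresh src tgt f L ps e≢ e≢end
      first : xorSum (pair e) (f ∷ L) ≡ wind e f
      first = ≡.trans (≡.cong₂ _xor_ (pair-corner e f p (All.head e≢tgt))
        (xorSum-false L (pair-others p e≢ (All.tail e≢tgt) f≢ (All.tail (fresh src tgt f L ps f≢ f≢end))))) (Bool.xor-identityʳ _)

    -- Either side says whether the vertical line through `u` meets the edge. In the form on the
    -- right it is a difference between the two ends of the edge and telescopes along a path.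
    spans : ∀ f u → u ≢ src f → u ≢ tgt f → ¬ Touches (src f) (tgt f) u →
            under (src f) (tgt f) u xor over (src f) (tgt f) u ≡ left (src f) u xor left (tgt f) u
    spans f u u≢s u≢t ¬touch = by (left (src f) u) (left (tgt f) u) ≡.refl ≡.refl
      where
      neg = neg? (κ (src f) (tgt f) u)
      pos⁺ = pos? (κ (src f) (tgt f) u)
      κ-nonzero : left (src f) u xor left (tgt f) u ≡ true → ¬ (κ (src f) (tgt f) u ≈ 0#)
      κ-nonzero h = ordered (left (src f) u) (left (tgt f) u) ≡.refl ≡.refl h
        where
        ordered : ∀ l r → left (src f) u ≡ l → left (tgt f) u ≡ r → l xor r ≡ true → ¬ (κ (src f) (tgt f) u ≈ 0#)
        ordered true  false l r _ = κ≉0 ¬touch (strict (≤-trans (left-true l) (left-false r))) (left-true l) (left-false r)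
          where
          strict : x (src f) ≤ x (tgt f) → x (src f) < x (tgt f)
          strict (inj₁ h) = h
          strict (inj₂ h) = contradiction h (slanted f)
        ordered false true  l r _ e = κ≉0 (λ (t , i , q) → ¬touch (1# - t , Unit-flip i , ≈ₚ-trans q (between-flip _ _ _)))
          (strict (≤-trans (left-true r) (left-false l))) (left-true r) (left-false l)
          (trans (turn-swap (pos (src f)) (pos (tgt f)) (pos u)) (trans (-‿cong e) -0#≈0#))
          where
          open import Algebra.Properties.Ring ring using (-0#≈0#)
          strict : x (tgt f) ≤ x (src f) → x (tgt f) < x (src f)
          strict (inj₁ h) = h
          strict (inj₂ h) = contradiction (sym h) (slanted f)
      one-sign : ∀ {y} → ¬ (y ≈ 0#) → neg? y xor pos? y ≡ true
      one-sign y≉0 = ≡.trans (≡.cong (_xor pos? _) (neg?≡not-pos? y≉0)) (≡.trans (not-xorˡ (pos? _) (pos? _)) (≡.cong not (Bool.xor-same (pos? _))))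
      by : ∀ l r → left (src f) u ≡ l → left (tgt f) u ≡ r → sel l r neg pos⁺ xor sel l r pos⁺ neg ≡ l xor r
      by false false _ _ = ≡.refl
      by true  true  _ _ = ≡.refl
      by true  false l r = one-sign (κ-nonzero (≡.cong₂ _xor_ l r))
      by false true  l r = ≡.trans (Bool.xor-comm pos⁺ neg) (one-sign (κ-nonzero (≡.cong₂ _xor_ l r)))

    end-++ : ∀ e M z → end e (M ++ z ∷ []) ≡ tgt z
    end-++ e []      z = ≡.refl
    end-++ e (f ∷ M) z = end-++ f M z

    chained-++ : ∀ e M z → Chained (e ∷ M ++ z ∷ []) → Chained (e ∷ M) × end e M ≡ src z
    chained-++ e []      z (p ∷ [-]) = [-] , p
    chained-++ e (f ∷ M) z (p ∷ ps) = let cs , q = chained-++ f M z ps in p ∷ cs , q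

    -- The sum over all pairs is evaluated twice: pair by pair, where the corners and the pair of
    -- `e` and `z` survive, and by telescoping, where only the neighbours of `src e` survive. The
    -- list has at least three edges, so that `e` and `z` share one vertex and not two.
    polygon-odd : ∀ e f M z → let L = e ∷ f ∷ M ++ z ∷ [] in Chained L → tgt z ≡ src e → SrcDistinct L →
                  turns wind L xor wind z e ≡ true
    polygon-odd e f M z chain@(p ∷ ps) closed distinct@((e≢f ∷ e≢) ∷ ds@(f≢ ∷ _)) =
      conclude (wind e f) (pair e z) (turns wind (f ∷ M ++ z ∷ []))
        (left (tgt e) (src e)) (left (src z) (src e)) (wind z e)
        (≡.trans (≡.sym (≡.cong₂ _xor_ first rest)) total) closing
      where
      L = f ∷ M ++ z ∷ []
      chain-M = proj₁ (chained-++ f M z ps)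
      end-M = proj₂ (chained-++ f M z ps)
      e≢z = All.head (All.++⁻ʳ M e≢)
      f≢z = All.head (All.++⁻ʳ M f≢)
      end-L : end f (M ++ z ∷ []) ≡ src e
      end-L = ≡.trans (end-++ f M z) closed

      e≢tgt : All (λ g → src e ≢ tgt g) (f ∷ M)
      e≢tgt = fresh src tgt f M chain-M (All.++⁻ˡ M e≢) (λ q → e≢z (≡.trans q end-M))

      f≢tgt : All (λ g → src f ≢ tgt g) (f ∷ M)
      f≢tgt = fresh src tgt f M chain-M (All.++⁻ˡ M f≢) (λ q → f≢z (≡.trans q end-M))

      first : xorSum (pair e) L ≡ wind e f xor pair e z
      first = ≡.cong₂ _xor_ (pair-corner e f p (All.head e≢tgt)) (≡.trans (xorSum-++ (pair e) M (z ∷ []))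
        (≡.cong₂ _xor_ (xorSum-false M (pair-others p (All.++⁻ˡ M e≢) (All.tail e≢tgt) (All.++⁻ˡ M f≢) (All.tail f≢tgt)))
                       (Bool.xor-identityʳ (pair e z))))

      rest : pairs L ≡ turns wind L
      rest = pairs-turns f (M ++ z ∷ []) ps ds
        (All.map (λ e≢g q → e≢g (≡.trans (≡.sym end-L) (≡.sym q))) (e≢f ∷ e≢))

      above below span : E → Bool
      below g = under (src g) (tgt g) (src e)
      above g = over (src g) (tgt g) (src e)
      span  g = left (src g) (src e) xor left (tgt g) (src e)

      middle : All (λ g → below g xor above g ≡ span g) (f ∷ M)
      middle = go (e≢f ∷ All.++⁻ˡ M e≢) e≢tgt
        where
        go : ∀ {L} → All (λ g → src e ≢ src g) L → All (λ g → src e ≢ tgt g) L →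
             All (λ g → below g xor above g ≡ span g) L
        go []                 []       = []
        go (_∷_ {x = g} a as) (b ∷ bs) = spans g (src e) a b (avoids e g (src e) (inj₁ ≡.refl) a b) ∷ go as bs

      -- The path ends where it starts, so both telescoped sums concern the single vertex `src e`.
      -- The edges `e` and `z` have it as an end and drop out; over the others `span` telescopes.
      total : pairs (e ∷ L) ≡ left (tgt e) (src e) xor left (src z) (src e)
      total = ≡.trans (pairs-telescope e L chain) (≡.trans
        (≡.cong (λ s → xorSum below (e ∷ L) xor xorSum (λ g → over (src g) (tgt g) s) (e ∷ L)) end-L)
        (≡.trans (≡.sym (xorSum-xor below above (e ∷ L)))
        (≡.trans (≡.cong₂ _xor_ (≡.cong₂ _xor_ (under-start (src e) (tgt e)) (over-start (src e) (tgt e)))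
                                (xorSum-++ (λ g → below g xor above g) (f ∷ M) (z ∷ [])))
        (≡.trans (≡.cong₂ _xor_ (≡.trans (xorSum-cong (f ∷ M) middle) (telescope (λ s → left s (src e)) f M chain-M))
          (≡.cong (_xor false) (≡.trans (≡.cong (λ s → under (src z) (tgt z) s xor over (src z) (tgt z) s) (≡.sym closed))
            (≡.cong₂ _xor_ (under-end (src z) (tgt z)) (over-end (src z) (tgt z))))))
        (≡.trans (Bool.xor-identityʳ _)
          (≡.cong₂ (λ s t → left s (src e) xor left t (src e)) (≡.sym p) end-M))))))

      z≢e : src z ≢ tgt e
      z≢e q = f≢z (≡.trans (≡.sym p) (≡.sym q))

      closing : pair e z xor (left (tgt e) (src e) xor left (src z) (src e)) ≡ not (wind z e)
      closing = ≡.trans (≡.cong (λ s → interplay (src e) (tgt e) (src z) s xor (left (tgt e) (src e) xor left (src z) (src e))) closed)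
        (≡.trans (Corner.closing-corner z≢e (λ q → slanted z (trans q (reflexive (≡.cong x (≡.sym closed))))) (slanted e)
          (λ touch → avoids e z (tgt e) (inj₂ ≡.refl) (λ q → z≢e (≡.sym q)) (λ q → loopless e (≡.trans (≡.sym closed) (≡.sym q)))
            (≡.subst (λ s → Touches (src z) s (tgt e)) (≡.sym closed) touch))
          (avoids z e (src z) (inj₁ ≡.refl) (λ q → e≢z (≡.sym q)) z≢e))
          (≡.cong not (≡.trans (≡.cong (λ s → windAt (src z) s (tgt e)) (≡.sym closed)) (≡.sym (wind≡ z e closed)))))

      conclude : ∀ a b t l r w → (a xor b) xor t ≡ l xor r → b xor (l xor r) ≡ not w → (a xor t) xor w ≡ true
      conclude a b t l r w h h′ = ≡.trans
        (≡.cong (_xor w) (≡.trans (solve 3 (λ a b t → a :+ t := b :+ ((a :+ b) :+ t)) ≡.refl a b t)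
          (≡.trans (≡.cong (b xor_) h) h′)))
        (≡.trans (not-xorˡ w w) (≡.cong not (Bool.xor-same w)))
        where open xor-∧-Solver

-- Parity of a count, and an order of the vertices

odd-filter : ∀ {a p} {A : Set a} {P : A → Set p} (P? : ∀ z → Dec (P z)) zs →
             odd (length (filter P? zs)) ≡ xorSum (λ z → does (P? z)) zs
odd-filter P? []       = ≡.refl
odd-filter P? (z ∷ zs) with does (P? z)
... | true  = ≡.cong not (odd-filter P? zs)
... | false = odd-filter P? zs

-- An arbitrary order, used as the tie-break between vertices of equal abscissa.
_≺ᵥ_ : Vertex n m → Vertex n m → Bool
inj₁ i ≺ᵥ inj₁ j = does (i Fin.<? j)
inj₁ i ≺ᵥ inj₂ v = true
inj₂ u ≺ᵥ inj₁ j = false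
inj₂ u ≺ᵥ inj₂ v = does (u Fin.<? v)

<?-anti : ∀ {i j : Fin n} → i ≢ j → does (i Fin.<? j) ≡ not (does (j Fin.<? i))
<?-anti {i = i} {j} i≢j with Fin.<-cmp i j
... | tri< i<j _ ¬p = ≡.trans (dec-true (i Fin.<? j) i<j) (≡.cong not (≡.sym (dec-false (j Fin.<? i) ¬p)))
... | tri≈ _ i≡j _  = contradiction i≡j i≢j
... | tri> ¬p _ j<i = ≡.trans (dec-false (i Fin.<? j) ¬p) (≡.cong not (≡.sym (dec-true (j Fin.<? i) j<i)))

≺ᵥ-anti : ∀ {u v : Vertex n m} → u ≢ v → u ≺ᵥ v ≡ not (v ≺ᵥ u)
≺ᵥ-anti {u = inj₁ i} {inj₁ j} u≢v = <?-anti (u≢v ∘ ≡.cong inj₁)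
≺ᵥ-anti {u = inj₁ i} {inj₂ v} _   = ≡.refl
≺ᵥ-anti {u = inj₂ u} {inj₁ j} _   = ≡.refl
≺ᵥ-anti {u = inj₂ u} {inj₂ v} u≢v = <?-anti (u≢v ∘ ≡.cong inj₂)

-- Convexity of the disk and zeros along a segment

module Convexity {c ℓ₁ ℓ₂ : Level} (K : OrderedField c ℓ₁ ℓ₂) where
  open OrderedField K hiding (zero)
  open OverField K
  open OrderedFieldProperties K
  open RingSolver
  open Plane K
  open import Algebra.Properties.Ring ring using (-0#≈0#; -‿involutive)
  open import Relation.Binary.Reasoning.Setoid setoid

  interior-resp : ∀ {ℓ} {R : Point → Set ℓ} {p r} → p ≈ₚ r → Interior R p → Interior R r
  interior-resp (e₁ , e₂) (ε , 0<ε , ball) = ε , 0<ε , λ w ((l₁ , u₁) , (l₂ , u₂)) → ball w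
    ( (≤-resp (+-congʳ (sym e₁)) refl l₁ , ≤-resp refl (+-congʳ (sym e₁)) u₁)
    , (≤-resp (+-congʳ (sym e₂)) refl l₂ , ≤-resp refl (+-congʳ (sym e₂)) u₂))

  interior⇒ : ∀ {ℓ} {R : Point → Set ℓ} {p} → Interior R p → R p
  interior⇒ {p = p} (ε , 0<ε , ball) = ball p ((down , up) , (down , up))
    where
    down : ∀ {x} → x - ε ≤ x
    down {x} = 0≤-⇒≤ (≤-resp refl (solve 2 (λ x ε → ε := x :- (x :- ε)) refl x ε) (inj₁ 0<ε))
    up : ∀ {x} → x ≤ x + ε
    up {x} = 0≤-⇒≤ (≤-resp refl (solve 2 (λ x ε → ε := (x :+ ε) :- x) refl x ε) (inj₁ 0<ε))

  -- The homothety with centre `p` and factor `s` maps the region into itself by convexity, and the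
  -- square of radius `ε` about `r` onto the one of radius `s * ε` about the point in question.
  -- `stretch` is its inverse.
  interior-between : ∀ {ℓ} (D : Disk ℓ) → ∀ {p r s} → Disk.Region D p → Interior (Disk.Region D) r →
                     0# < s → s ≤ 1# → Interior (Disk.Region D) (between p r s)
  interior-between D {p@(p₁ , p₂)} {r@(r₁ , r₂)} {s} inP (ε , 0<ε , ball) 0<s s≤1 =
    s * ε , *-pos 0<s 0<ε , λ w@(w₁ , w₂) (near₁ , near₂) →
      resp (recover p₁ r₁ w₁ , recover p₂ r₂ w₂)
        (convex inP (ball (stretch p₁ r₁ w₁ , stretch p₂ r₂ w₂) (near p₁ r₁ w₁ near₁ , near p₂ r₂ w₂ near₂))
          (inj₁ 0<s , s≤1))
    where
    open Disk D using (resp; convex)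
    i : Carrier
    i = proj₁ (inverse s (0<⇒≉0 0<s))
    si : s * i ≈ 1#
    si = proj₂ (inverse s (0<⇒≉0 0<s))
    0≤i : 0# ≤ i
    0≤i = inj₁ (inverse-pos si 0<s)
    stretch : Carrier → Carrier → Carrier → Carrier
    stretch p r w = r + (w - (p + s * (r - p))) * i
    unscale : ∀ x → s * x * i ≈ x
    unscale x = trans (solve 3 (λ s x i → s :* x :* i := (s :* i) :* x) refl s x i) (trans (*-congʳ si) (*-identityˡ x))
    recover : ∀ p r w → p + s * (stretch p r w - p) ≈ w
    recover p r w = begin
      p + s * (stretch p r w - p)
        ≈⟨ solve 5 (λ p r w s i → p :+ s :* ((r :+ (w :- (p :+ s :* (r :- p))) :* i) :- p)
             := p :+ s :* (r :- p) :+ s :* (w :- (p :+ s :* (r :- p))) :* i) refl p r w s i ⟩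
      p + s * (r - p) + s * (w - (p + s * (r - p))) * i
        ≈⟨ +-congˡ (unscale _) ⟩
      p + s * (r - p) + (w - (p + s * (r - p)))
        ≈⟨ solve 2 (λ z w → z :+ (w :- z) := w) refl (p + s * (r - p)) w ⟩
      w ∎
    near : ∀ p r w → let z = p + s * (r - p) in z - s * ε ≤ w × w ≤ z + s * ε →
           r - ε ≤ stretch p r w × stretch p r w ≤ r + ε
    near p r w (l , u) =
      0≤-⇒≤ (≤-resp refl (begin
        (w - (z - s * ε)) * i
          ≈⟨ solve 5 (λ w z s ε i → (w :- (z :- s :* ε)) :* i := s :* ε :* i :+ (w :- z) :* i) refl w z s ε i ⟩
        s * ε * i + (w - z) * i   ≈⟨ +-congʳ (unscale ε) ⟩
        ε + (w - z) * i
          ≈⟨ solve 3 (λ r ε x → ε :+ x := (r :+ x) :- (r :- ε)) refl r ε _ ⟩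
        stretch p r w - (r - ε) ∎) (0≤* (≤⇒0≤- l) 0≤i)) ,
      0≤-⇒≤ (≤-resp refl (begin
        ((z + s * ε) - w) * i
          ≈⟨ solve 5 (λ w z s ε i → ((z :+ s :* ε) :- w) :* i := s :* ε :* i :- (w :- z) :* i) refl w z s ε i ⟩
        s * ε * i - (w - z) * i   ≈⟨ +-congʳ (unscale ε) ⟩
        ε - (w - z) * i
          ≈⟨ solve 3 (λ r ε x → ε :- x := (r :+ ε) :- (r :+ x)) refl r ε _ ⟩
        (r + ε) - stretch p r w ∎) (0≤* (≤⇒0≤- u) 0≤i))
      where z = p + s * (r - p)

  parallel : ∀ {g l} → ¬ (l ≈ₚ (0# , 0#)) → cross g l ≈ 0# → ∃ λ t → g ≈ₚ t ·ₚ l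
  parallel {g₁ , g₂} {l₁ , l₂} l≉0 cr≈0 with l₁ ≟ 0# | l₂ ≟ 0#
  ... | yes p | yes r = contradiction (p , r) l≉0
  ... | no l₁≉0 | _ = g₁ * i , at₁ , at₂
    where
    i = proj₁ (inverse l₁ l₁≉0)
    li : l₁ * i ≈ 1#
    li = proj₂ (inverse l₁ l₁≉0)
    at₁ : g₁ ≈ g₁ * i * l₁
    at₁ = sym (trans (solve 3 (λ g i l → g :* i :* l := g :* (l :* i)) refl g₁ i l₁) (trans (*-congˡ li) (*-identityʳ g₁)))
    at₂ : g₂ ≈ g₁ * i * l₂
    at₂ = sym (begin
      g₁ * i * l₂
        ≈⟨ solve 5 (λ g₁ g₂ l₁ l₂ i → g₁ :* i :* l₂ := g₂ :* (l₁ :* i) :+ (g₁ :* l₂ :- g₂ :* l₁) :* i) refl g₁ g₂ l₁ l₂ i ⟩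
      g₂ * (l₁ * i) + cross (g₁ , g₂) (l₁ , l₂) * i
        ≈⟨ +-cong (trans (*-congˡ li) (*-identityʳ g₂)) (trans (*-congʳ cr≈0) (zeroˡ i)) ⟩
      g₂ + 0# ≈⟨ +-identityʳ g₂ ⟩
      g₂ ∎)
  ... | yes _ | no l₂≉0 = g₂ * i , at₁ , at₂
    where
    i = proj₁ (inverse l₂ l₂≉0)
    li : l₂ * i ≈ 1#
    li = proj₂ (inverse l₂ l₂≉0)
    at₂ : g₂ ≈ g₂ * i * l₂
    at₂ = sym (trans (solve 3 (λ g i l → g :* i :* l := g :* (l :* i)) refl g₂ i l₂) (trans (*-congˡ li) (*-identityʳ g₂)))
    at₁ : g₁ ≈ g₂ * i * l₁
    at₁ = sym (begin
      g₂ * i * l₁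
        ≈⟨ solve 5 (λ g₁ g₂ l₁ l₂ i → g₂ :* i :* l₁ := g₁ :* (l₂ :* i) :- (g₁ :* l₂ :- g₂ :* l₁) :* i) refl g₁ g₂ l₁ l₂ i ⟩
      g₁ * (l₂ * i) - cross (g₁ , g₂) (l₁ , l₂) * i
        ≈⟨ +-cong (trans (*-congˡ li) (*-identityʳ g₁)) (trans (-‿cong (trans (*-congʳ cr≈0) (zeroˡ i))) (-0#≈0#)) ⟩
      g₁ + 0# ≈⟨ +-identityʳ g₁ ⟩
      g₁ ∎)

  positive-combination : ∀ {s y z} → Unit s → 0# < y → 0# < z → ¬ (y + s * (z - y) ≈ 0#)
  positive-combination {s} {y} {z} (inj₁ 0<s , s≤1) 0<y 0<z h = 0<⇒≉0 (0<+ (*-pos 0<s 0<z) (0≤* (≤⇒0≤- s≤1) (inj₁ 0<y)))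
    (trans (solve 3 (λ s y z → s :* z :+ (con (+ 1) :- s) :* y := y :+ s :* (z :- y)) refl s y z) h)
  positive-combination {s} {y} {z} (inj₂ 0≈s , s≤1) 0<y 0<z h = 0<⇒≉0 0<y
    (trans (sym (trans (+-congˡ (trans (*-congʳ (sym 0≈s)) (zeroˡ _))) (+-identityʳ y))) h)

  negate-combination : ∀ s y z → - y + s * (- z - - y) ≈ - (y + s * (z - y))
  negate-combination = solve 3 (λ s y z → :- y :+ s :* (:- z :- :- y) := :- (y :+ s :* (z :- y))) refl

  same-sign : ∀ {s y z} → Unit s → ¬ (y ≈ 0#) → ¬ (z ≈ 0#) → pos? y ≡ pos? z → ¬ (y + s * (z - y) ≈ 0#)
  same-sign {s} {y} {z} s∈ y≉0 z≉0 e h with compare y 0# | compare z 0#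
  ... | tri≈ _ p _ | _ = contradiction p y≉0
  ... | _ | tri≈ _ p _ = contradiction p z≉0
  ... | tri< y<0 _ _ | tri> _ _ 0<z = contradiction (≡.trans (≡.sym (pos?-true 0<z)) (≡.trans (≡.sym e) (pos?-false (<-asym y<0)))) λ ()
  ... | tri> _ _ 0<y | tri< z<0 _ _ = contradiction (≡.trans (≡.sym (pos?-true 0<y)) (≡.trans e (pos?-false (<-asym z<0)))) λ ()
  ... | tri> _ _ 0<y | tri> _ _ 0<z = positive-combination s∈ 0<y 0<z h
  ... | tri< y<0 _ _ | tri< z<0 _ _ = positive-combination s∈ (<0⇒0<- y<0) (<0⇒0<- z<0)
    (trans (negate-combination s y z) (trans (-‿cong h) -0#≈0#))

  falling-zero : ∀ {y z} → 0# < y → z < 0# → ∃ λ s → 0# < s × s ≤ 1# × y + s * (z - y) ≈ 0#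
  falling-zero {y} {z} 0<y z<0 = y * i , *-pos 0<y 0<i , 0≤-⇒≤ (≤-resp refl (begin
      - z * i                     ≈⟨ solve 3 (λ y z i → :- z :* i := (y :- z) :* i :- y :* i) refl y z i ⟩
      (y - z) * i - y * i         ≈⟨ +-congʳ wi ⟩
      1# - y * i                  ∎) (inj₁ (*-pos (<0⇒0<- z<0) 0<i))) , (begin
      y + y * i * (z - y)
        ≈⟨ solve 3 (λ y z i → y :+ y :* i :* (z :- y) := y :- y :* ((y :- z) :* i)) refl y z i ⟩
      y - y * ((y - z) * i)       ≈⟨ +-congˡ (-‿cong (trans (*-congˡ wi) (*-identityʳ y))) ⟩
      y - y                       ≈⟨ -‿inverseʳ y ⟩
      0# ∎)
    where
    0<w : 0# < y - z
    0<w = +-pos-< 0<y (<0⇒0<- z<0)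
    i = proj₁ (inverse (y - z) (0<⇒≉0 0<w))
    wi : (y - z) * i ≈ 1#
    wi = proj₂ (inverse (y - z) (0<⇒≉0 0<w))
    0<i : 0# < i
    0<i = inverse-pos wi 0<w

  zero-between : ∀ {y z} → ¬ (y ≈ 0#) → ¬ (z ≈ 0#) → pos? y ≢ pos? z →
                 ∃ λ s → 0# < s × s ≤ 1# × y + s * (z - y) ≈ 0#
  zero-between {y} {z} y≉0 z≉0 e with compare y 0# | compare z 0#
  ... | tri≈ _ p _ | _ = contradiction p y≉0
  ... | _ | tri≈ _ p _ = contradiction p z≉0
  ... | tri< y<0 _ _ | tri< z<0 _ _ = contradiction (≡.trans (pos?-false (<-asym y<0)) (≡.sym (pos?-false (<-asym z<0)))) e
  ... | tri> _ _ 0<y | tri> _ _ 0<z = contradiction (≡.trans (pos?-true 0<y) (≡.sym (pos?-true 0<z))) e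
  ... | tri> _ _ 0<y | tri< z<0 _ _ = falling-zero 0<y z<0
  ... | tri< y<0 _ _ | tri> _ _ 0<z =
    let s , 0<s , s≤1 , h = falling-zero (<0⇒0<- y<0) (0<⇒-<0 0<z) in
    s , 0<s , s≤1 , trans (sym (-‿involutive _)) (trans (-‿cong (trans (sym (negate-combination s y z)) h)) -0#≈0#)

-- Gauge rays, planarity and the parity of a cycle in the network

module NetworkGeometry {c ℓ₁ ℓ₂ ℓ : Level} (K : OrderedField c ℓ₁ ℓ₂) {n m q : ℕ}
                       (N : OverField.Network K ℓ n m q) where
  open OrderedField K hiding (zero)
  open OverField K
  open OrderedFieldProperties K
  open RingSolver
  open Plane K
  open Convexity K
  open Network N
  open Direction 𝔩
  open Polygon K pos 𝔩 _≺ᵥ_ ≺ᵥ-anti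
  open Chain src tgt
  open import Relation.Binary.Reasoning.Setoid setoid
  open import Algebra.Properties.Ring ring using (-0#≈0#)

  Internal : Vertex n m → Set
  Internal v = ∃ λ u → v ≡ inj₂ u

  b-boundary : ∀ i → ¬ Interior Region (b i)
  b-boundary i h = let t , t∈ , e = on-segment i in proj₂ (flat t∈) (interior-resp e h)

  -- Otherwise `b i` would lie on the segment from the interior point that `𝔩-inward` provides to
  -- the interior point `z`, and would itself be interior.
  ahead : ∀ i {z t} → Interior Region z → z ≈ₚ b i +ₚ t ·ₚ 𝔩 → 0# < t
  ahead i {z₁ , z₂} {t} inZ (e₁ , e₂) with 0# <? t
  ... | yes 0<t = 0<t
  ... | no  0≮t = ⊥-elim (b-boundary i (interior-resp (≈ₚ-sym (eq e₁ , eq e₂))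
      (interior-between disk (interior⇒ inY) inZ 0<s s≤1)))
    where
    t′ = proj₁ (𝔩-inward i)
    0<t′ = proj₁ (proj₂ (𝔩-inward i))
    inY = proj₂ (proj₂ (𝔩-inward i))
    t≤0 : t ≤ 0#
    t≤0 = ≮⇒≥ 0≮t
    w = t′ - t
    0≤-t : 0# ≤ - t
    0≤-t = ≤-resp refl (+-identityˡ _) (≤⇒0≤- t≤0)
    0<w : 0# < w
    0<w = 0<+ 0<t′ 0≤-t
    r = proj₁ (inverse w (0<⇒≉0 0<w))
    wr : w * r ≈ 1#
    wr = proj₂ (inverse w (0<⇒≉0 0<w))
    0<r : 0# < r
    0<r = inverse-pos wr 0<w
    -- The quotient of `t′` by `t′ - t` is the parameter of `b i` on the segment from the inward
    -- point to `z`.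
    s = t′ * r
    0<s : 0# < s
    0<s = *-pos 0<t′ 0<r
    s≤1 : s ≤ 1#
    s≤1 = 0≤-⇒≤ (≤-resp refl (trans
      (solve 3 (λ t′ t r → :- t :* r := (t′ :- t) :* r :- t′ :* r) refl t′ t r) (+-congʳ wr))
      (0≤* 0≤-t (inj₁ 0<r)))
    eq : ∀ {β l z} → z ≈ β + t * l → β ≈ (β + t′ * l) + s * (z - (β + t′ * l))
    eq {β} {l} {z} e = sym (begin
      (β + t′ * l) + s * (z - (β + t′ * l))
        ≈⟨ +-congˡ (*-congˡ (+-congʳ e)) ⟩
      (β + t′ * l) + s * ((β + t * l) - (β + t′ * l))
        ≈⟨ solve 5 (λ β t′ t l r → (β :+ t′ :* l) :+ t′ :* r :* ((β :+ t :* l) :- (β :+ t′ :* l))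
             := β :+ t′ :* l :* (con (+ 1) :- (t′ :- t) :* r)) refl β t′ t l r ⟩
      β + t′ * l * (1# - w * r)
        ≈⟨ +-congˡ (trans (*-congˡ (trans (+-congˡ (-‿cong wr)) (-‿inverseʳ 1#))) (zeroʳ _)) ⟩
      β + 0#  ≈⟨ +-identityʳ β ⟩
      β ∎)

  offset : Fin n → Vertex n m → Carrier
  offset i v = cross (pos v -ₚ b i) 𝔩

  -- In the interior of the disk the line of a gauge ray has no points behind the base point, so
  -- meeting the ray can be tested by the vanishing of a determinant.
  on-ray : ∀ i {z} → Interior Region z → cross (z -ₚ b i) 𝔩 ≈ 0# → ∃ λ t → 0# < t × z ≈ₚ b i +ₚ t ·ₚ 𝔩
  on-ray i {z} inZ h = let t , e = parallel 𝔩-nonzero h ; at = shift (proj₁ e) , shift (proj₂ e) in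
    t , ahead i inZ at , at
    where
    shift : ∀ {x y z} → x - y ≈ z → x ≈ y + z
    shift {x} {y} h = trans (solve 2 (λ x y → x := y :+ (x :- y)) refl x y) (+-congˡ h)

  offset≉0 : ∀ i v → ¬ (offset i (inj₂ v) ≈ 0#)
  offset≉0 i v h = let t , 0<t , e = on-ray i (inside-disk v) h in 𝔩-generic i v (inj₁ 0<t) e

  side : Fin n → Vertex n m → Bool
  side i v = pos? (offset i v)

  offset-between : ∀ i u v s → cross (between (pos u) (pos v) s -ₚ b i) 𝔩 ≈
                   offset i u + s * (offset i v - offset i u)
  offset-between i u v s = identity (pos u) (pos v) (b i) 𝔩 s
    where
    identity : ∀ p r z l s → cross (between p r s -ₚ z) l ≈
               cross (p -ₚ z) l + s * (cross (r -ₚ z) l - cross (p -ₚ z) l)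
    identity (p₁ , p₂) (r₁ , r₂) (z₁ , z₂) (l₁ , l₂) s = solve 9 (λ p₁ p₂ r₁ r₂ z₁ z₂ l₁ l₂ s →
      let p = p₁ , p₂ ; r = r₁ , r₂ ; z = z₁ , z₂ ; l = l₁ , l₂ in
      :cross ((p₁ :+ s :* (r₁ :- p₁) , p₂ :+ s :* (r₂ :- p₂)) :-ₚ z) l
      := :cross (p :-ₚ z) l :+ s :* (:cross (r :-ₚ z) l :- :cross (p :-ₚ z) l))
      refl p₁ p₂ r₁ r₂ z₁ z₂ l₁ l₂ s

  offset-ray : ∀ {z β l t} → z ≈ₚ β +ₚ t ·ₚ l → cross (z -ₚ β) l ≈ 0#
  offset-ray {z₁ , z₂} {β₁ , β₂} {l₁ , l₂} {t} (e₁ , e₂) = trans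
    (+-cong (*-congʳ (+-congʳ e₁)) (-‿cong (*-congʳ (+-congʳ e₂))))
    (solve 5 (λ β₁ β₂ l₁ l₂ t → (β₁ :+ t :* l₁ :- β₁) :* l₂ :- (β₂ :+ t :* l₂ :- β₂) :* l₁ := con (+ 0))
      refl β₁ β₂ l₁ l₂ t)

  crosses-sides : ∀ i u v (cr : ¬ (cross (pos (inj₂ v) -ₚ pos (inj₂ u)) 𝔩 ≈ 0#)) →
    does (crosses? (pos (inj₂ u)) (pos (inj₂ v)) (b i) 𝔩 cr) ≡ side i (inj₂ u) xor side i (inj₂ v)
  crosses-sides i u v cr with side i (inj₂ u) Bool.≟ side i (inj₂ v)
  ... | yes same = ≡.trans (dec-false (crosses? _ _ _ _ _) no-crossing)
      (≡.sym (≡.trans (≡.cong (_xor side i (inj₂ v)) same) (Bool.xor-same (side i (inj₂ v)))))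
    where
    no-crossing : ¬ Crosses (pos (inj₂ u)) (pos (inj₂ v)) (b i) 𝔩
    no-crossing (s , t , s∈ , _ , e) = same-sign s∈ (offset≉0 i u) (offset≉0 i v) same
      (trans (sym (offset-between i (inj₂ u) (inj₂ v) s)) (offset-ray e))
  ... | no differ = ≡.trans (dec-true (crosses? _ _ _ _ _) crossing) (≡.sym (distinct differ))
    where
    distinct : ∀ {x y} → x ≢ y → x xor y ≡ true
    distinct {false} {false} h = contradiction ≡.refl h
    distinct {false} {true}  h = ≡.refl
    distinct {true}  {false} h = ≡.refl
    distinct {true}  {true}  h = contradiction ≡.refl h
    crossing : Crosses (pos (inj₂ u)) (pos (inj₂ v)) (b i) 𝔩
    crossing = let s , 0<s , s≤1 , h = zero-between (offset≉0 i u) (offset≉0 i v) differ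
                   t , 0<t , e = on-ray i (interior-between disk (interior⇒ (inside-disk u)) (inside-disk v) 0<s s≤1)
                                   (trans (offset-between i (inj₂ u) (inj₂ v) s) h)
               in s , t , (inj₁ 0<s , s≤1) , 0<t , e

  ray-side : Vertex n m → Bool
  ray-side v = xorSum (λ i → side i v) (sources graph)

  int-sides : ∀ e → Internal (src e) → Internal (tgt e) → odd (int N e) ≡ ray-side (src e) xor ray-side (tgt e)
  int-sides e (u , p) (v , r) = ≡.trans (odd-filter _ (sources graph))
    (≡.trans (xorSum-cong (sources graph) (All.universal (λ i → sides (src e) (tgt e) p r i (𝔩-nonparallel e)) _))
      (xorSum-xor (λ i → side i (src e)) (λ i → side i (tgt e)) (sources graph)))
    where
    sides : ∀ s t → s ≡ inj₂ u → t ≡ inj₂ v → ∀ i (cr : ¬ (cross (pos t -ₚ pos s) 𝔩 ≈ 0#)) →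
            does (crosses? (pos s) (pos t) (b i) 𝔩 cr) ≡ side i s xor side i t
    sides _ _ ≡.refl ≡.refl i cr = crosses-sides i u v cr

  closed-int : ∀ e L → Chained (e ∷ L) → end e L ≡ src e →
               All (λ f → Internal (src f) × Internal (tgt f)) (e ∷ L) →
               xorSum (λ f → odd (int N f)) (e ∷ L) ≡ false
  closed-int e L chain closed internal = ≡.trans
    (xorSum-cong (e ∷ L) (All.map (λ {f} (s , t) → int-sides f s t) internal))
    (≡.trans (telescope ray-side e L chain)
      (≡.trans (≡.cong (λ v → ray-side (src e) xor ray-side v) closed) (Bool.xor-same (ray-side (src e)))))

  slanted : ∀ e → ¬ (x (src e) ≈ x (tgt e))
  slanted e h = 𝔩-nonparallel e (trans (abscissa-- _ _) (trans (+-congˡ (-‿cong h)) (-‿inverseʳ _)))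

  separate : ∀ e f → src e ≢ src f → src e ≢ tgt f → tgt e ≢ src f → tgt e ≢ tgt f →
             Separate (src e) (tgt e) (src f) (tgt f)
  separate e f ss st ts tt s∈ t∈ meet with planar (λ e≡f → ss (≡.cong src e≡f)) s∈ t∈ meet
  ... | v , _ , inj₁ p , inj₁ r = ss (≡.trans (≡.sym p) r)
  ... | v , _ , inj₁ p , inj₂ r = st (≡.trans (≡.sym p) r)
  ... | v , _ , inj₂ p , inj₁ r = ts (≡.trans (≡.sym p) r)
  ... | v , _ , inj₂ p , inj₂ r = tt (≡.trans (≡.sym p) r)

  avoids : ∀ e f u → u ≡ src e ⊎ u ≡ tgt e → u ≢ src f → u ≢ tgt f → ¬ Touches (src f) (tgt f) u
  avoids e f u u∈e u≢s u≢t (t , t∈ , on) = finish (planar e≢f s∈ t∈ (≈ₚ-trans at on))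
    where
    e≢f : e ≢ f
    e≢f ≡.refl = [ u≢s , u≢t ]′ u∈e
    parameter : u ≡ src e ⊎ u ≡ tgt e → ∃ λ s → Unit s × edgePoint e s ≈ₚ pos u
    parameter (inj₁ ≡.refl) = 0# , Unit-0 , between₀ _ _
    parameter (inj₂ ≡.refl) = 1# , Unit-1 , between₁ _ _
    s∈ = proj₁ (proj₂ (parameter u∈e))
    at = proj₂ (proj₂ (parameter u∈e))
    finish : ¬ ∃ λ v → pos v ≈ₚ edgePoint e (proj₁ (parameter u∈e)) × Endpoint v e × Endpoint v f
    finish (v , v≈ , _ , v∈f) with pos-injective (≈ₚ-trans v≈ at)
    ... | ≡.refl = [ u≢s , u≢t ]′ v∈f

  -- Both edges would be the same straight segment and share its midpoint (`h` is one half), which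
  -- is no end of either, against planarity. Hence a cycle has the three edges that `polygon-odd`
  -- requires.
  no-digon : ∀ e f → tgt e ≡ src f → tgt f ≢ src e
  no-digon e f p r = finish (planar e≢f h∈ h∈ meet)
    where
    e≢f : e ≢ f
    e≢f ≡.refl = nondegenerate e (≡.sym p)
    0<2 : 0# < 1# + 1#
    0<2 = +-pos-< 0<1 0<1
    h = proj₁ (inverse (1# + 1#) (0<⇒≉0 0<2))
    2h : (1# + 1#) * h ≈ 1#
    2h = proj₂ (inverse (1# + 1#) (0<⇒≉0 0<2))
    0<h : 0# < h
    0<h = inverse-pos 2h 0<2
    1-h : 1# - h ≈ h
    1-h = trans (+-congʳ (sym 2h)) (solve 1 (λ h → (con (+ 1) :+ con (+ 1)) :* h :- h := h) refl h)
    h∈ : Unit h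
    h∈ = inj₁ 0<h , 0≤-⇒≤ (inj₁ (<-resp refl (sym 1-h) 0<h))
    between-congᵗ : ∀ {z y s t} → s ≈ t → between z y s ≈ₚ between z y t
    between-congᵗ e = +-congˡ (*-congʳ e) , +-congˡ (*-congʳ e)
    meet : edgePoint e h ≈ₚ edgePoint f h
    meet = ≡.subst₂ (λ s t → edgePoint e h ≈ₚ between (pos s) (pos t) h) p (≡.sym r)
      (≈ₚ-trans (between-flip _ _ _) (between-congᵗ 1-h))
    h-scaled : ∀ {y z} → y ≈ y + h * (z - y) → z ≈ y
    h-scaled {y} {z} w = trans (solve 2 (λ y z → z := y :+ (z :- y)) refl y z)
      (trans (+-congˡ (*-zero⁻¹ (0<⇒≉0 0<h) (trans
        (solve 2 (λ y w → w := (y :+ w) :- y) refl y (h * (z - y))) (trans (+-congʳ (sym w)) (-‿inverseʳ y)))))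
        (+-identityʳ y))
    at-source : ¬ (pos (src e) ≈ₚ edgePoint e h)
    at-source w = slanted e (sym (h-scaled (trans (abscissa-cong w) (abscissa-between _ _ _))))
    at-target : ¬ (pos (tgt e) ≈ₚ edgePoint e h)
    at-target w = slanted e (h-scaled (trans (abscissa-cong (≈ₚ-trans w
      (≈ₚ-trans (between-flip _ _ _) (between-congᵗ 1-h)))) (abscissa-between _ _ _)))
    finish : ¬ ∃ λ v → pos v ≈ₚ edgePoint e h × Endpoint v e × Endpoint v f
    finish (v , v≈ , inj₁ ≡.refl , _) = at-source v≈
    finish (v , v≈ , inj₂ ≡.refl , _) = at-target v≈

  wind : Fin q → Fin q → Bool
  wind e f = oddℤ (windEdges N e f)

  wind≡ : ∀ e f → tgt e ≡ src f → wind e f ≡ windAt (src e) (tgt e) (tgt f)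
  wind≡ e f p = ≡.cong (λ s → oddℤ (windFrom (orientation (vec e) (pos (tgt f) -ₚ pos s))
    (orientation (vec e) 𝔩) (orientation 𝔩 (pos (tgt f) -ₚ pos s)))) (≡.sym p)

  module Simple = SimplePolygon K pos 𝔩 _≺ᵥ_ ≺ᵥ-anti src tgt

  cycle-odd : ∀ e X z → let L = e ∷ X ++ z ∷ [] in Chained L → tgt z ≡ src e →
              AllPairs (λ f g → src f ≢ src g) L → All (λ f → Internal (src f) × Internal (tgt f)) L →
              (turns wind L xor wind z e) xor xorSum (λ f → odd (int N f)) L ≡ true
  cycle-odd e []      z (p ∷ _) closed distinct internal = contradiction closed (no-digon e z p)
  cycle-odd e (f ∷ X) z chain   closed distinct internal = ≡.cong₂ _xor_
    (Simple.polygon-odd slanted separate avoids wind wind≡ e f X z chain closed distinct)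
    (closed-int e (f ∷ X ++ z ∷ []) chain
      (≡.trans (Simple.end-++ slanted separate avoids wind wind≡ f X z) closed) internal)

-- Finite sums over lists

module ListSum {c ℓ : Level} (M : CommutativeMonoid c ℓ) where
  open CommutativeMonoid M
  open import Relation.Binary.Reasoning.Setoid setoid
  open import Algebra.Properties.CommutativeSemigroup commutativeSemigroup using (interchange)

  -- For the addition of the field this unfolds to `∑`; the instance for natural numbers serves to
  -- count edges.
  sum : ∀ {a} {A : Set a} → List A → (A → Carrier) → Carrier
  sum xs f = foldr (λ x s → f x ∙ s) ε xs

  sum-cong : ∀ {a} {A : Set a} {f g : A → Carrier} xs → (∀ x → f x ≈ g x) → sum xs f ≈ sum xs g
  sum-cong []       h = refl
  sum-cong (x ∷ xs) h = ∙-cong (h x) (sum-cong xs h)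

  sum-ε : ∀ {a} {A : Set a} {f : A → Carrier} xs → (∀ x → f x ≈ ε) → sum xs f ≈ ε
  sum-ε []       h = refl
  sum-ε (x ∷ xs) h = trans (∙-cong (h x) (sum-ε xs h)) (identityˡ ε)

  sum-∙ : ∀ {a} {A : Set a} (f g : A → Carrier) xs → sum xs (λ x → f x ∙ g x) ≈ sum xs f ∙ sum xs g
  sum-∙ f g []       = sym (identityˡ ε)
  sum-∙ f g (x ∷ xs) = trans (∙-congˡ (sum-∙ f g xs)) (interchange (f x) (g x) _ _)

  sum-swap : ∀ {a b} {A : Set a} {B : Set b} (f : A → B → Carrier) xs ys →
             sum xs (λ x → sum ys (f x)) ≈ sum ys (λ y → sum xs (λ x → f x y))
  sum-swap f []       ys = sym (sum-ε ys (λ _ → refl))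
  sum-swap f (x ∷ xs) ys = trans (∙-congˡ (sum-swap f xs ys)) (sym (sum-∙ (f x) _ ys))

  sum-++ : ∀ {a} {A : Set a} (f : A → Carrier) xs ys → sum (xs ++ ys) f ≈ sum xs f ∙ sum ys f
  sum-++ f []       ys = sym (identityˡ _)
  sum-++ f (x ∷ xs) ys = trans (∙-congˡ (sum-++ f xs ys)) (sym (assoc _ _ _))

  sum-map : ∀ {a b} {A : Set a} {B : Set b} (f : B → Carrier) (g : A → B) xs →
            sum (List.map g xs) f ≡ sum xs (f ∘ g)
  sum-map f g []       = ≡.refl
  sum-map f g (x ∷ xs) = ≡.cong (f (g x) ∙_) (sum-map f g xs)

  sum-product : ∀ {a b d} {A : Set a} {B : Set b} {D : Set d} (f : D → Carrier) (g : A → B → D) xs ys →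
                sum (cartesianProductWith g xs ys) f ≈ sum xs (λ x → sum ys (λ y → f (g x y)))
  sum-product f g []       ys = refl
  sum-product f g (x ∷ xs) ys = trans (sum-++ f (List.map (g x) ys) _)
    (∙-cong (reflexive (sum-map f (g x) ys)) (sum-product f g xs ys))

  sum-filter : ∀ {a p} {A : Set a} {P : A → Set p} (P? : ∀ x → Dec (P x)) (f : A → Carrier) xs →
               sum (filter P? xs) f ≈ sum xs (λ x → if does (P? x) then f x else ε)
  sum-filter P? f []       = refl
  sum-filter P? f (x ∷ xs) with does (P? x)
  ... | true  = ∙-congˡ (sum-filter P? f xs)
  ... | false = trans (sum-filter P? f xs) (sym (identityˡ _))

  sum-allFin : ∀ {k} (f : Fin (suc k) → Carrier) → sum (allFin (suc k)) f ≈ f zero ∙ sum (allFin k) (f ∘ suc)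
  sum-allFin f = ∙-congˡ (reflexive (≡.trans (≡.cong (λ xs → sum xs f) (≡.sym (List.map-tabulate id suc)))
    (sum-map f suc (allFin _))))

  sum-single : ∀ {k} (f : Fin k → Carrier) i → (∀ j → j ≢ i → f j ≈ ε) → sum (allFin k) f ≈ f i
  sum-single f zero    h = begin
    sum (allFin _) f                       ≈⟨ sum-allFin f ⟩
    f zero ∙ sum (allFin _) (f ∘ suc)      ≈⟨ ∙-congˡ (sum-ε (allFin _) (λ j → h (suc j) λ ())) ⟩
    f zero ∙ ε                             ≈⟨ identityʳ _ ⟩
    f zero                                 ∎
  sum-single f (suc i) h = begin
    sum (allFin _) f                       ≈⟨ sum-allFin f ⟩
    f zero ∙ sum (allFin _) (f ∘ suc)      ≈⟨ ∙-congʳ (h zero λ ()) ⟩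
    ε ∙ sum (allFin _) (f ∘ suc)           ≈⟨ identityˡ _ ⟩
    sum (allFin _) (f ∘ suc)               ≈⟨ sum-single (f ∘ suc) i (λ j j≢i → h (suc j) (j≢i ∘ Fin.suc-injective)) ⟩
    f (suc i)                              ∎

-- Counting edges

bit : Bool → ℕ
bit b = if b then 1 else 0

module ℕSum = ListSum ℕ.+-0-commutativeMonoid

indicator : ∀ {p} {P : Set p} → Dec P → ℕ
indicator P? = bit (does P?)

count : ∀ {p} {P : Fin q → Set p} → (∀ f → Dec (P f)) → ℕ
count P? = length (filter P? (allFin _))

length-filter≡sum : ∀ {a p} {A : Set a} {P : A → Set p} (P? : ∀ z → Dec (P z)) zs →
                    length (filter P? zs) ≡ ℕSum.sum zs (indicator ∘ P?)
length-filter≡sum P? []       = ≡.refl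
length-filter≡sum P? (z ∷ zs) with does (P? z)
... | true  = ≡.cong suc (length-filter≡sum P? zs)
... | false = length-filter≡sum P? zs

count≡sum : ∀ {p} {P : Fin q → Set p} (P? : ∀ f → Dec (P f)) → count P? ≡ ℕSum.sum (allFin q) (indicator ∘ P?)
count≡sum P? = length-filter≡sum P? (allFin _)

module Count {q : ℕ} where

  count-cong : ∀ {p r} {P : Fin q → Set p} {Q : Fin q → Set r} (P? : ∀ f → Dec (P f)) (Q? : ∀ f → Dec (Q f)) →
               (∀ {f} → P f → Q f) → (∀ {f} → Q f → P f) → count P? ≡ count Q?
  count-cong P? Q? to from = ≡.trans (count≡sum P?) (≡.trans
    (ℕSum.sum-cong (allFin q) (λ f → ≡.cong bit (does-⇔ (mk⇔ to from) (P? f) (Q? f))))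
    (≡.sym (count≡sum Q?)))

  count-zero : ∀ {p} {P : Fin q → Set p} (P? : ∀ f → Dec (P f)) → (∀ f → ¬ P f) → count P? ≡ 0
  count-zero P? none = ≡.trans (count≡sum P?) (ℕSum.sum-ε (allFin q)
    (λ f → ≡.cong bit (dec-false (P? f) (none f))))

  count-insert : ∀ {p r} {P : Fin q → Set p} {Q : Fin q → Set r} (P? : ∀ f → Dec (P f)) (Q? : ∀ f → Dec (Q f)) e →
                 P e → ¬ Q e → (∀ {f} → P f → f ≢ e → Q f) → (∀ {f} → Q f → P f) → count P? ≡ suc (count Q?)
  count-insert {P = P} {Q} P? Q? e Pe ¬Qe to from = ≡.trans (count≡sum P?) (≡.trans
    (ℕSum.sum-cong (allFin q) pointwise) (≡.trans
    (ℕSum.sum-∙ (indicator ∘ (Fin._≟ e)) (indicator ∘ Q?) (allFin q))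
    (≡.cong₂ ℕ._+_ (≡.trans (ℕSum.sum-single _ e λ f f≢e → ≡.cong bit (dec-false (f Fin.≟ e) f≢e))
      (≡.cong bit (dec-true (e Fin.≟ e) ≡.refl))) (≡.sym (count≡sum Q?)))))
    where
    pointwise : ∀ f → indicator (P? f) ≡ indicator (f Fin.≟ e) ℕ.+ indicator (Q? f)
    pointwise f with f Fin.≟ e
    ... | yes ≡.refl = ≡.trans (≡.cong bit (dec-true (P? f) Pe))
      (≡.cong (suc ∘ bit) (≡.sym (dec-false (Q? f) ¬Qe)))
    ... | no f≢e = ≡.cong bit (does-⇔ (mk⇔ (λ Pf → to Pf f≢e) from) (P? f) (Q? f))

  module _ {p} {P : Fin q → Set p} (P? : ∀ f → Dec (P f)) where

    count-remove : ∀ {e} → P e → count P? ≡ suc (count (λ f → P? f ×-dec ¬? (f Fin.≟ e)))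
    count-remove {e} Pe = count-insert P? _ e Pe (λ (_ , e≢e) → e≢e ≡.refl) _,_ proj₁

    count-positive : ∀ {e} → P e → 1 ℕ.≤ count P?
    count-positive Pe = ℕ.≤-trans (s≤s z≤n) (ℕ.≤-reflexive (≡.sym (count-remove Pe)))

    count-witness : 1 ℕ.≤ count P? → ∃ P
    count-witness h with Fin.any? P?
    ... | yes w = w
    ... | no none = contradiction (ℕ.≤-trans h (ℕ.≤-reflexive (count-zero P? (λ f Pf → none (f , Pf))))) λ ()

    count-unique : count P? ℕ.≤ 1 → ∀ {e f} → P e → P f → e ≡ f
    count-unique h {e} {f} Pe Pf with f Fin.≟ e
    ... | yes f≡e = ≡.sym f≡e
    ... | no f≢e = contradiction (ℕ.≤-trans (s≤s (count-positive′ (Pf , f≢e)))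
        (ℕ.≤-trans (ℕ.≤-reflexive (≡.sym (count-remove Pe))) h)) λ { (s≤s ()) }
      where
      count-positive′ : P f × f ≢ e → 1 ℕ.≤ count (λ f → P? f ×-dec ¬? (f Fin.≟ e))
      count-positive′ w = ℕ.≤-trans (s≤s z≤n) (ℕ.≤-reflexive (≡.sym
        (count-insert _ (λ g → (P? g ×-dec ¬? (g Fin.≟ e)) ×-dec ¬? (g Fin.≟ f)) f w (λ (_ , f≢f) → f≢f ≡.refl) _,_ proj₁)))

  count-mono : ∀ {p r} {P : Fin q → Set p} {Q : Fin q → Set r} (P? : ∀ f → Dec (P f)) (Q? : ∀ f → Dec (Q f)) →
               (∀ {f} → P f → Q f) → count P? ℕ.≤ count Q?
  count-mono P? Q? to = ≡.subst₂ ℕ._≤_ (≡.sym (count≡sum P?)) (≡.sym (count≡sum Q?)) (mono (allFin q))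
    where
    le : ∀ f → indicator (P? f) ℕ.≤ indicator (Q? f)
    le f with P? f | Q? f
    ... | yes Pf | yes _ = s≤s z≤n
    ... | yes Pf | no ¬Q = contradiction (to Pf) ¬Q
    ... | no _   | _     = z≤n
    mono : ∀ fs → ℕSum.sum fs (indicator ∘ P?) ℕ.≤ ℕSum.sum fs (indicator ∘ Q?)
    mono []       = z≤n
    mono (f ∷ fs) = ℕ.+-mono-≤ (le f) (mono fs)

open Count public

-- Edge sets and searching for a walk

_∖_ _⊕_ : Subset q → Fin q → Subset q
F ∖ e = F [ e ]≔ outside
F ⊕ e = F [ e ]≔ inside

∈-∖⁻ : ∀ {F : Subset q} {e x} → x ∈ F ∖ e → x ∈ F × x ≢ e
∈-∖⁻ {F = F} {e} {x} h with x Fin.≟ e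
... | yes ≡.refl = contradiction (≡.trans (≡.sym (Vec.[]=⇒lookup h)) (Vec.lookup∘update e F outside)) λ ()
... | no x≢e = Vec.lookup⇒[]= x F (≡.trans (≡.sym (Vec.lookup∘update′ x≢e F outside)) (Vec.[]=⇒lookup h)) , x≢e

∈-∖⁺ : ∀ {F : Subset q} {e x} → x ∈ F → x ≢ e → x ∈ F ∖ e
∈-∖⁺ {F = F} {e} {x} h x≢e = Vec.lookup⇒[]= x _ (≡.trans (Vec.lookup∘update′ x≢e F outside) (Vec.[]=⇒lookup h))

∈-⊕ : ∀ {F : Subset q} {e} → e ∈ F ⊕ e
∈-⊕ {F = F} {e} = Vec.[]≔-updates F e

lookup-∉ : ∀ {F : Subset q} {e} → e ∉ F → lookup F e ≡ outside
lookup-∉ {F = F} {e} e∉F = Bool.¬-not (λ h → e∉F (Vec.lookup⇒[]= e F h))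

⊕-∖ : ∀ {F : Subset q} {e} → e ∉ F → (F ⊕ e) ∖ e ≡ F
⊕-∖ {F = F} {e} e∉F = ≡.trans (Vec.[]≔-idempotent F e)
  (≡.trans (≡.cong (F [ e ]≔_) (≡.sym (lookup-∉ e∉F))) (Vec.[]≔-lookup F e))

∈-edgeSet⁺ : ∀ {P : List (Fin q)} {x} → x ∈ˡ P → x ∈ edgeSet P
∈-edgeSet⁺ {P = p ∷ P} (here ≡.refl) = Subset.x∈p∪q⁺ (inj₁ (Subset.x∈⁅x⁆ p))
∈-edgeSet⁺ {P = p ∷ P} (there h)     = Subset.x∈p∪q⁺ (inj₂ (∈-edgeSet⁺ h))

∈-edgeSet⁻ : ∀ (P : List (Fin q)) {x} → x ∈ edgeSet P → x ∈ˡ P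
∈-edgeSet⁻ []      h = contradiction h Subset.∉⊥
∈-edgeSet⁻ (p ∷ P) h with Subset.x∈p∪q⁻ ⁅ p ⁆ (edgeSet P) h
... | inj₁ x∈p = here (Subset.x∈⁅y⁆⇒x≡y p x∈p)
... | inj₂ x∈P = there (∈-edgeSet⁻ P x∈P)

filter-head : ∀ {a p} {A : Set a} {P : A → Set p} (P? : ∀ z → Dec (P z)) {y} zs →
              y ∈ˡ zs → P y → (∀ {z} → P z → z ≡ y) → head (filter P? zs) ≡ just y
filter-head P? (z ∷ zs) y∈ Py only with P? z
... | yes Pz = ≡.cong just (only Pz)
filter-head P? (z ∷ zs) (here ≡.refl) Py only | no ¬Py = contradiction Py ¬Py
filter-head P? (z ∷ zs) (there y∈)    Py only | no _   = filter-head P? zs y∈ Py only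

∈-sequences : ∀ (P : List (Fin q)) → P ∈ˡ sequences q (length P)
∈-sequences []      = here ≡.refl
∈-sequences (e ∷ P) = List.∈-cartesianProductWith⁺ _∷_ (List.∈-allFin e) (∈-sequences P)

-- Edge flows: removing and adding the first edge

module Flows {n m q : ℕ} (G : Digraph n m q) (color : Fin m → Color) (plabic : IsPlabic G color)
             (loopless : ∀ e → Digraph.src G e ≢ Digraph.tgt G e) where
  open Digraph G
  open IsPlabic plabic

  through? : (h : Fin q → Vertex n m) → ∀ F v f → Dec (f ∈ F × h f ≡ v)
  through? h F v f = (f Subset.∈? F) ×-dec (h f ≟ᵥ v)

  -- With `tgt` and `src` for the first argument this is `arriving` and `leaving`, so facts about
  -- both are proved once.
  through : (Fin q → Vertex n m) → Subset q → Vertex n m → ℕ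
  through h F v = count (through? h F v)

  through-∖ : ∀ h {F e v} → e ∈ F → h e ≡ v → through h F v ≡ suc (through h (F ∖ e) v)
  through-∖ h {F} {e} {v} e∈F p = count-insert (through? h F v) (through? h (F ∖ e) v) e (e∈F , p) (λ (r , _) → proj₂ (∈-∖⁻ r) ≡.refl)
    (λ (r , s) f≢e → ∈-∖⁺ r f≢e , s) (λ (r , s) → proj₁ (∈-∖⁻ r) , s)

  through-∖′ : ∀ h {F e v} → h e ≢ v → through h F v ≡ through h (F ∖ e) v
  through-∖′ h {F} {e} {v} e≢v = count-cong (through? h F v) (through? h (F ∖ e) v)
    (λ (r , s) → ∈-∖⁺ r (λ { ≡.refl → e≢v s }) , s) (λ (r , s) → proj₁ (∈-∖⁻ r) , s)

  through-zero : ∀ h {F v} → (∀ f → f ∈ F → h f ≢ v) → through h F v ≡ 0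
  through-zero h {F} {v} none = count-zero (through? h F v) (λ f (f∈F , p) → none f f∈F p)

  through-positive : ∀ h {F e v} → e ∈ F → h e ≡ v → 1 ℕ.≤ through h F v
  through-positive h {F} {e} {v} e∈F p = count-positive (through? h F v) (e∈F , p)

  through-witness : ∀ h {F v} → 1 ℕ.≤ through h F v → ∃ λ e → e ∈ F × h e ≡ v
  through-witness h {F} {v} = count-witness (through? h F v)

  through-unique : ∀ h {F v} → through h F v ℕ.≤ 1 → ∀ {e f} → e ∈ F → f ∈ F → h e ≡ v → h f ≡ v → e ≡ f
  through-unique h {F} {v} le e∈F f∈F p r = count-unique (through? h F v) le (e∈F , p) (f∈F , r)

  through-degree : ∀ h {F v} → through h F v ℕ.≤ count (λ f → h f ≟ᵥ v)
  through-degree h {F} {v} = count-mono (through? h F v) (λ f → h f ≟ᵥ v) proj₂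

  boundary≢internal : ∀ {i : Fin n} {v : Fin m} → inj₁ i ≢ inj₂ v
  boundary≢internal ()

  boundary-once : ∀ {i e f} → tgt e ≡ inj₁ i → src f ≢ inj₁ i
  boundary-once {i} p r = contradiction
    (ℕ.≤-trans (ℕ.+-mono-≤ (count-positive (λ f → tgt f ≟ᵥ inj₁ i) p) (count-positive (λ f → src f ≟ᵥ inj₁ i) r))
      (ℕ.≤-reflexive (boundary-degree i)))
    λ { (s≤s ()) }

  -- A white vertex has only one incoming edge, a black one only one outgoing edge. Combined with a
  -- balance condition, either bound gives the other.
  narrow : ∀ F v → arriving G F (inj₂ v) ℕ.≤ 1 ⊎ leaving G F (inj₂ v) ℕ.≤ 1
  narrow F v with color v | perfect v
  ... | white | one = inj₁ (ℕ.≤-trans (through-degree tgt) (ℕ.≤-reflexive one))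
  ... | black | one = inj₂ (ℕ.≤-trans (through-degree src) (ℕ.≤-reflexive one))

  Balanced : Subset q → Set
  Balanced F = ∀ v → arriving G F (inj₂ v) ≡ leaving G F (inj₂ v)

  balanced-unique : ∀ {F v} → arriving G F (inj₂ v) ≡ leaving G F (inj₂ v) →
                    ∀ {e f} → e ∈ F → f ∈ F → src e ≡ inj₂ v → src f ≡ inj₂ v → e ≡ f
  balanced-unique {F} {v} bal = through-unique src
    ([ (λ le → ≡.subst (ℕ._≤ 1) bal le) , id ]′ (narrow F v))

  -- Summed over the internal vertices, the balance says that as many edges of `F` end inside as
  -- start inside. All of them start inside, so all of them end inside.
  no-sinks : ∀ {F} → Balanced F → (∀ f → f ∈ F → ∀ i → src f ≢ inj₁ i) → ∀ f → f ∈ F → ∀ i → tgt f ≢ inj₁ i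
  no-sinks {F} bal no-sources g g∈F i p = ℕ.<-irrefl total strict
    where
    Internal : Vertex n m → Set
    Internal u = ∃ λ v → u ≡ inj₂ v
    internal? : ∀ u → Dec (Internal u)
    internal? (inj₁ _) = no λ { (_ , ()) }
    internal? (inj₂ v) = yes (v , ≡.refl)
    end? : (h : Fin q → Vertex n m) → ∀ f → Dec (f ∈ F × Internal (h f))
    end? h f = (f Subset.∈? F) ×-dec internal? (h f)
    ends : (Fin q → Vertex n m) → ℕ
    ends h = count (end? h)
    pointwise : ∀ b u → bit (b Bool.∧ does (internal? u)) ≡
                ℕSum.sum (allFin m) (λ v → bit (b Bool.∧ does (u ≟ᵥ inj₂ v)))
    pointwise false u        = ≡.sym (ℕSum.sum-ε (allFin m) (λ _ → ≡.refl))
    pointwise true  (inj₁ i) = ≡.sym (ℕSum.sum-ε (allFin m) (λ _ → ≡.refl))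
    pointwise true  (inj₂ w) = ≡.sym (≡.trans
      (ℕSum.sum-single _ w (λ v v≢w → ≡.cong bit
        (dec-false (_≟ᵥ_ {n = n} (inj₂ w) (inj₂ v)) (λ r → v≢w (≡.sym (Sum.inj₂-injective r))))))
      (≡.cong bit (dec-true (_≟ᵥ_ {n = n} (inj₂ w) (inj₂ w)) ≡.refl)))
    ends≡sum : ∀ h → ends h ≡ ℕSum.sum (allFin m) (λ v → through h F (inj₂ v))
    ends≡sum h = ≡.trans (count≡sum (end? h)) (≡.trans
      (ℕSum.sum-cong (allFin q) (λ f → pointwise (does (f Subset.∈? F)) (h f)))
      (≡.trans (ℕSum.sum-swap (λ f v → indicator (through? h F (inj₂ v) f)) (allFin q) (allFin m))
        (ℕSum.sum-cong (allFin m) (λ v → ≡.sym (count≡sum (through? h F (inj₂ v)))))))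
    total : ends tgt ≡ count (Subset._∈? F)
    total = ≡.trans (≡.trans (ends≡sum tgt) (≡.trans (ℕSum.sum-cong (allFin m) bal) (≡.sym (ends≡sum src))))
      (count-cong (end? src) (Subset._∈? F) proj₁ (λ {f} f∈F → f∈F , src-internal f f∈F (src f) ≡.refl))
      where
      src-internal : ∀ f → f ∈ F → ∀ u → src f ≡ u → Internal (src f)
      src-internal f f∈F (inj₁ j) r = contradiction r (no-sources f f∈F j)
      src-internal f f∈F (inj₂ v) r = v , r
    strict : ends tgt ℕ.< count (Subset._∈? F)
    strict = ℕ.≤-trans (s≤s (count-mono (end? tgt) (λ f → (f Subset.∈? F) ×-dec ¬? (f Fin.≟ g))
        (λ (f∈F , v , r) → f∈F , λ { ≡.refl → boundary≢internal (≡.trans (≡.sym p) r) })))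
      (ℕ.≤-reflexive (≡.sym (count-remove (Subset._∈? F) g∈F)))

  internal-src : ∀ {e f} → tgt e ≡ src f → ∃ λ v → src f ≡ inj₂ v
  internal-src {e} {f} p = by (src f) ≡.refl
    where
    by : ∀ u → src f ≡ u → ∃ λ v → src f ≡ inj₂ v
    by (inj₁ i) r = contradiction r (boundary-once (≡.trans p r))
    by (inj₂ v) r = v , r

  -- Removing `e` takes a departure from `src e` and an arrival from `tgt e`, which moves the
  -- surplus of one departure to the start of `f`.
  step→ : ∀ {e f j F} → EdgeFlowTo G e j F → tgt e ≡ src f → f ∈ F → EdgeFlowTo G f j (F ∖ e)
  step→ {e} {f} {j} {F} ((e∈F , bal , start , sources) , g , g∈F , g-sink) p f∈F =
    (∈-∖⁺ f∈F f≢e , bal′ , start′ , sources′) , g , ∈-∖⁺ g∈F g≢e , g-sink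
    where
    f≢e : f ≢ e
    f≢e ≡.refl = loopless e (≡.sym p)
    w = proj₁ (internal-src p)
    src-f : src f ≡ inj₂ w
    src-f = proj₂ (internal-src p)
    g≢e : g ≢ e
    g≢e ≡.refl = contradiction src-f (λ r → boundary≢internal (≡.trans (≡.sym g-sink) (≡.trans p r)))
    bal′ : ∀ v → inj₂ v ≢ src f → arriving G (F ∖ e) (inj₂ v) ≡ leaving G (F ∖ e) (inj₂ v)
    bal′ v v≢f with src e ≟ᵥ inj₂ v
    ... | yes r = ℕ.suc-injective (begin
      suc (arriving G (F ∖ e) (inj₂ v))    ≡⟨ ≡.cong suc (through-∖′ tgt (λ t → v≢f (≡.trans (≡.sym t) p))) ⟨
      suc (arriving G F (inj₂ v))          ≡⟨ ≡.subst (λ u → suc (arriving G F u) ≡ leaving G F u) r start ⟩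
      leaving G F (inj₂ v)                 ≡⟨ through-∖ src e∈F r ⟩
      suc (leaving G (F ∖ e) (inj₂ v))     ∎)
      where open ≡.≡-Reasoning
    ... | no ¬r = ≡.trans (≡.sym (through-∖′ tgt (λ t → v≢f (≡.trans (≡.sym t) p))))
      (≡.trans (bal v (¬r ∘ ≡.sym)) (through-∖′ src ¬r))
    start′ : suc (arriving G (F ∖ e) (src f)) ≡ leaving G (F ∖ e) (src f)
    start′ = begin
      suc (arriving G (F ∖ e) (src f))     ≡⟨ through-∖ tgt e∈F p ⟨
      arriving G F (src f)                 ≡⟨ ≡.cong (arriving G F) src-f ⟩
      arriving G F (inj₂ w)                ≡⟨ bal w (λ r → loopless e (≡.trans (≡.sym r) (≡.trans (≡.sym src-f) (≡.sym p)))) ⟩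
      leaving G F (inj₂ w)                 ≡⟨ ≡.cong (leaving G F) src-f ⟨
      leaving G F (src f)                  ≡⟨ through-∖′ src (λ r → loopless e (≡.trans r (≡.sym p))) ⟩
      leaving G (F ∖ e) (src f)            ∎
      where open ≡.≡-Reasoning
    sources′ : ∀ h → h ∈ F ∖ e → h ≢ f → ∀ i → src h ≢ inj₁ i
    sources′ h h∈ _ = let h∈F , h≢e = ∈-∖⁻ h∈ in sources h h∈F h≢e

  -- The edge `e` is itself the surplus. If `src e` is on the boundary, both counts of the remainder
  -- vanish: nothing arrives at a source, and the remainder contains no edge leaving one.
  restore-start : ∀ {e F} → e ∈ F → (∀ v → inj₂ v ≡ src e → arriving G (F ∖ e) (inj₂ v) ≡ leaving G (F ∖ e) (inj₂ v)) →
                  (∀ h → h ∈ F ∖ e → ∀ i → src h ≢ inj₁ i) → suc (arriving G F (src e)) ≡ leaving G F (src e)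
  restore-start {e} {F} e∈F bal sources = ≡.trans
    (≡.cong suc (≡.trans (through-∖′ tgt (λ r → loopless e (≡.sym r))) (by (src e) ≡.refl)))
    (≡.sym (through-∖ src e∈F ≡.refl))
    where
    by : ∀ u → src e ≡ u → arriving G (F ∖ e) (src e) ≡ leaving G (F ∖ e) (src e)
    by (inj₂ v) r = ≡.subst (λ u → arriving G (F ∖ e) u ≡ leaving G (F ∖ e) u) (≡.sym r) (bal v (≡.sym r))
    by (inj₁ i) r = ≡.trans (through-zero tgt (λ h _ q → boundary-once (≡.trans q r) r))
      (≡.sym (through-zero src (λ h h∈ q → sources h h∈ i (≡.trans q r))))

  step← : ∀ {e f j F} → e ∈ F → tgt e ≡ src f → EdgeFlowTo G f j (F ∖ e) → EdgeFlowTo G e j F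
  step← {e} {f} {j} {F} e∈F p ((f∈ , bal , start , sources) , g , g∈ , g-sink) =
    (e∈F , bal′ , restore-start e∈F (λ v r → bal v (λ q → loopless e (≡.trans (≡.sym r) (≡.trans q (≡.sym p))))) no-sources
      , λ h h∈F h≢e → no-sources h (∈-∖⁺ h∈F h≢e)) , g , proj₁ (∈-∖⁻ g∈) , g-sink
    where
    no-sources : ∀ h → h ∈ F ∖ e → ∀ i → src h ≢ inj₁ i
    no-sources h h∈ i with h Fin.≟ f
    ... | yes ≡.refl = λ r → boundary-once (≡.trans p r) r
    ... | no h≢f = sources h h∈ h≢f i
    bal′ : ∀ v → inj₂ v ≢ src e → arriving G F (inj₂ v) ≡ leaving G F (inj₂ v)
    bal′ v v≢e with tgt e ≟ᵥ inj₂ v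
    ... | yes r = begin
      arriving G F (inj₂ v)               ≡⟨ through-∖ tgt e∈F r ⟩
      suc (arriving G (F ∖ e) (inj₂ v))   ≡⟨ ≡.subst (λ u → suc (arriving G (F ∖ e) u) ≡ leaving G (F ∖ e) u) (≡.trans (≡.sym p) r) start ⟩
      leaving G (F ∖ e) (inj₂ v)          ≡⟨ through-∖′ src (v≢e ∘ ≡.sym) ⟨
      leaving G F (inj₂ v)                ∎
      where open ≡.≡-Reasoning
    ... | no ¬r = ≡.trans (through-∖′ tgt ¬r) (≡.trans (bal v (λ q → ¬r (≡.trans p (≡.sym q)))) (≡.sym (through-∖′ src (v≢e ∘ ≡.sym))))

  last→ : ∀ {e i j F} → EdgeFlowTo G e j F → tgt e ≡ inj₁ i → Conservative G (F ∖ e)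
  last→ {e} {i} {j} {F} ((e∈F , bal , start , sources) , _) p =
    (λ f f∈ k → no-sources f f∈ k , no-sinks bal′ no-sources f f∈ k) , bal′
    where
    no-sources : ∀ h → h ∈ F ∖ e → ∀ i → src h ≢ inj₁ i
    no-sources h h∈ = let h∈F , h≢e = ∈-∖⁻ h∈ in sources h h∈F h≢e
    no-arrival : ∀ {v : Fin m} → tgt e ≢ inj₂ v
    no-arrival r = boundary≢internal (≡.trans (≡.sym p) r)
    bal′ : Balanced (F ∖ e)
    bal′ v with src e ≟ᵥ inj₂ v
    ... | yes r = ℕ.suc-injective (≡.trans (≡.cong suc (≡.sym (through-∖′ tgt no-arrival)))
      (≡.trans (≡.subst (λ u → suc (arriving G F u) ≡ leaving G F u) r start) (through-∖ src e∈F r)))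
    ... | no ¬r = ≡.trans (≡.sym (through-∖′ tgt no-arrival)) (≡.trans (bal v (¬r ∘ ≡.sym)) (through-∖′ src ¬r))

  -- Without `e` the flow is conservative and does not touch the boundary, so `e` alone can reach
  -- the required sink.
  last-sink : ∀ {e i j F} → EdgeFlowTo G e j F → tgt e ≡ inj₁ i → tgt e ≡ inj₁ j
  last-sink {e} {i} {j} flow@(_ , g , g∈F , g-sink) p with g Fin.≟ e
  ... | yes ≡.refl = g-sink
  ... | no g≢e = contradiction g-sink (proj₂ (proj₁ (last→ flow p) g (∈-∖⁺ g∈F g≢e) j))

  last← : ∀ {e j F} → e ∈ F → tgt e ≡ inj₁ j → Conservative G (F ∖ e) → EdgeFlowTo G e j F
  last← {e} {j} {F} e∈F p (boundary , bal) =
    (e∈F , (λ v v≢e → ≡.trans (through-∖′ tgt no-arrival) (≡.trans (bal v) (≡.sym (through-∖′ src (v≢e ∘ ≡.sym)))))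
    , restore-start e∈F (λ v _ → bal v) (λ h h∈ i → proj₁ (boundary h h∈ i))
    , λ h h∈F h≢e i → proj₁ (boundary h (∈-∖⁺ h∈F h≢e) i)) , e , e∈F , p
    where
    no-arrival : ∀ {v : Fin m} → tgt e ≢ inj₂ v
    no-arrival r = boundary≢internal (≡.trans (≡.sym p) r)

  successor : ∀ {e j F v} → EdgeFlowTo G e j F → tgt e ≡ inj₂ v → ∃ λ f → f ∈ F × tgt e ≡ src f
  successor {e} {j} {F} {v} ((e∈F , bal , _) , _) p =
    let f , f∈F , r = through-witness src (ℕ.≤-trans (through-positive tgt e∈F p)
                        (ℕ.≤-reflexive (bal v (λ q → loopless e (≡.trans (≡.sym q) (≡.sym p))))))
    in f , f∈F , ≡.trans p (≡.sym r)

  -- Away from `src e` the flow is balanced, and at `src e` it is balanced once `e` is removed. A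
  -- balanced vertex has at most one departure.
  flow-unique : ∀ {e j F v f g} → EdgeFlowTo G e j F → f ∈ F → g ∈ F → f ≢ e → g ≢ e →
                src f ≡ inj₂ v → src g ≡ inj₂ v → f ≡ g
  flow-unique {e} {j} {F} {v} ((e∈F , bal , start , _) , _) f∈F g∈F f≢e g≢e p r with src e ≟ᵥ inj₂ v
  ... | no ¬s = balanced-unique (bal v (¬s ∘ ≡.sym)) f∈F g∈F p r
  ... | yes s = balanced-unique
    (≡.trans (≡.sym (through-∖′ tgt (λ t → loopless e (≡.trans s (≡.sym t)))))
      (ℕ.suc-injective (≡.trans (≡.subst (λ u → suc (arriving G F u) ≡ leaving G F u) s start) (through-∖ src e∈F s))))
    (∈-∖⁺ f∈F f≢e) (∈-∖⁺ g∈F g≢e) p r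

  successor-unique : ∀ {e j F f g} → EdgeFlowTo G e j F → f ∈ F → g ∈ F → tgt e ≡ src f → tgt e ≡ src g → f ≡ g
  successor-unique {e} flow f∈F g∈F p r = flow-unique flow f∈F g∈F (not-e p) (not-e r)
      (proj₂ (internal-src p)) (≡.trans (≡.sym r) (≡.trans p (proj₂ (internal-src p))))
    where
    not-e : ∀ {f} → tgt e ≡ src f → f ≢ e
    not-e p ≡.refl = loopless e (≡.sym p)

-- The loop-erased walk of an edge flow

module Walks {n m q : ℕ} (G : Digraph n m q) (color : Fin m → Color) (plabic : IsPlabic G color)
             (loopless : ∀ e → Digraph.src G e ≢ Digraph.tgt G e) where
  open Digraph G
  open Flows G color plabic loopless
  open Chain src tgt using (Chained)

  -- Walk j e F P: the path e ∷ P leads to b_j and uses each edge of F at most once.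

  data Walk (j : Fin n) : Fin q → Subset q → List (Fin q) → Set where
    stop : ∀ {e F} → e ∈ F → tgt e ≡ inj₁ j → Walk j e F []
    step : ∀ {e f F P} → e ∈ F → tgt e ≡ src f → Walk j f (F ∖ e) P → Walk j e F (f ∷ P)

  private
    variable
      j : Fin n
      e f : Fin q
      F : Subset q
      P Q : List (Fin q)

  walk-head : Walk j e F P → e ∈ F
  walk-head (stop e∈F _)   = e∈F
  walk-head (step e∈F _ _) = e∈F

  walk-all : Walk j e F P → All (_∈ F) (e ∷ P)
  walk-all (stop e∈F _)   = e∈F ∷ []
  walk-all (step e∈F _ W) = e∈F ∷ All.map (λ h → proj₁ (∈-∖⁻ h)) (walk-all W)

  walk-distinct : Walk j e F P → Unique (e ∷ P)
  walk-distinct (stop _ _)   = [] ∷ []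
  walk-distinct (step _ _ W) = All.map (λ h p → proj₂ (∈-∖⁻ h) (≡.sym p)) (walk-all W) ∷ walk-distinct W

  walk-chained : Walk j e F P → Chained (e ∷ P)
  walk-chained (stop _ _)   = [-]
  walk-chained (step _ p W) = p ∷ walk-chained W

  walk-last : Walk j e F P → Maybe.map tgt (last (e ∷ P)) ≡ just (inj₁ j)
  walk-last (stop _ p)   = ≡.cong just p
  walk-last (step _ _ W) = walk-last W

  path⇒walk : ∀ P → Chained (e ∷ P) → Maybe.map tgt (last (e ∷ P)) ≡ just (inj₁ j) → Unique (e ∷ P) →
              All (_∈ F) (e ∷ P) → Walk j e F P
  path⇒walk []      _         l _         (e∈F ∷ _)  = stop e∈F (Maybe.just-injective l)
  path⇒walk (f ∷ P) (p ∷ ps) l (e≢ ∷ un) (e∈F ∷ in-F) = step e∈F p (path⇒walk P ps l un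
    (All.zipWith (λ (f∈F , e≢f) → ∈-∖⁺ f∈F (e≢f ∘ ≡.sym)) (in-F , e≢)))

  walk-unique : EdgeFlowTo G e j F → Walk j e F P → Walk j e F Q → P ≡ Q
  walk-unique flow (stop _ _)    (stop _ _)    = ≡.refl
  walk-unique flow (stop _ r)    (step _ p _)  = contradiction (≡.trans (≡.sym p) r) (boundary-once r)
  walk-unique flow (step _ p _)  (stop _ r)    = contradiction (≡.trans (≡.sym p) r) (boundary-once r)
  walk-unique flow (step e∈F p W) (step _ p′ W′)
    with successor-unique flow (proj₁ (∈-∖⁻ (walk-head W))) (proj₁ (∈-∖⁻ (walk-head W′))) p p′
  ... | ≡.refl = ≡.cong (_ ∷_) (walk-unique (step→ flow p (proj₁ (∈-∖⁻ (walk-head W)))) W W′)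

  size : Subset q → ℕ
  size F = count (Subset._∈? F)

  size-∖ : e ∈ F → size F ≡ suc (size (F ∖ e))
  size-∖ {e} {F} e∈F = count-insert (Subset._∈? F) (Subset._∈? (F ∖ e)) e e∈F (λ h → proj₂ (∈-∖⁻ h) ≡.refl) ∈-∖⁺ (proj₁ ∘ ∈-∖⁻)

  size≤q : ∀ F → size F ℕ.≤ q
  size≤q F = ℕ.≤-trans (List.length-filter (Subset._∈? F) (allFin q)) (ℕ.≤-reflexive (List.length-tabulate id))

  walk-length : Walk j e F P → suc (length P) ℕ.≤ size F
  walk-length (stop e∈F _)   = count-positive (Subset._∈? _) e∈F
  walk-length (step e∈F _ W) = ℕ.≤-trans (s≤s (walk-length W)) (ℕ.≤-reflexive (≡.sym (size-∖ e∈F)))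

  walk-exists : EdgeFlowTo G e j F → ∃ λ P → Walk j e F P
  walk-exists {F = F₀} flow = go (size F₀) ≡.refl flow
    where
    -- Every step uses up an edge of the flow, so the number `k` of its edges bounds the recursion.
    go : ∀ k → size F ≡ k → EdgeFlowTo G e j F → ∃ λ P → Walk j e F P
    end : ∀ k → size F ≡ k → EdgeFlowTo G e j F → ∀ u → tgt e ≡ u → ∃ λ P → Walk j e F P
    go k s flow = end k s flow _ ≡.refl
    end k s flow@((e∈F , _) , _) (inj₁ i) p = [] , stop e∈F (last-sink flow p)
    end zero s flow@((e∈F , _) , _) (inj₂ v) p = contradiction (≡.trans (≡.sym s) (size-∖ e∈F)) λ ()
    end (suc k) s flow@((e∈F , _) , _) (inj₂ v) p =
      let f , f∈F , r = successor flow p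
          P , W = go k (ℕ.suc-injective (≡.trans (≡.sym (size-∖ e∈F)) s)) (step→ flow r f∈F)
      in f ∷ P , step e∈F r W

  walk-complement : EdgeFlowTo G e j F → Walk j e F P → ∃ λ C → Conservative G C ×
    (∀ {x} → x ∈ C → x ∈ F × x ∉ˡ e ∷ P) × (∀ {x} → x ∈ F → x ∉ˡ e ∷ P → x ∈ C)
  walk-complement {e} {F = F} flow (stop e∈F p) = F ∖ e , last→ flow p ,
    (λ h → proj₁ (∈-∖⁻ h) , λ { (here x≡e) → proj₂ (∈-∖⁻ h) x≡e }) , λ x∈F x∉ → ∈-∖⁺ x∈F (x∉ ∘ here)
  walk-complement {e} flow (step e∈F p W) =
    let C , cons , to , from = walk-complement (step→ flow p (proj₁ (∈-∖⁻ (walk-head W)))) W in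
    C , cons ,
    (λ h → let x∈ , x∉ = to h in proj₁ (∈-∖⁻ x∈) , λ { (here x≡e) → proj₂ (∈-∖⁻ x∈) x≡e ; (there x∈P) → x∉ x∈P }) ,
    λ x∈F x∉ → from (∈-∖⁺ x∈F (x∉ ∘ here)) (x∉ ∘ there)

  walk⇒decomposes : EdgeFlowTo G e j F → Walk j e F P → Decomposes G e j F (e ∷ P)
  walk⇒decomposes {e} {j} {F} {P} flow W =
    let C , cons , to , from = walk-complement flow W in
    (walk-chained W , ≡.refl , walk-last W) , walk-distinct W , C , cons ,
    Subset.⊆-antisym
      (λ h → let x∈P , x∈C = Subset.x∈p∩q⁻ (edgeSet (e ∷ P)) C h in contradiction (∈-edgeSet⁻ (e ∷ P) x∈P) (proj₂ (to x∈C)))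
      (λ h → contradiction h Subset.∉⊥) ,
    Subset.⊆-antisym
      (λ {x} x∈F → Subset.x∈p∪q⁺ (split x∈F (any? (Fin._≟_ x) (e ∷ P)) from))
      (λ h → [ (λ x∈P → All.lookup (walk-all W) (∈-edgeSet⁻ (e ∷ P) x∈P)) , (λ x∈C → proj₁ (to x∈C)) ]′ (Subset.x∈p∪q⁻ (edgeSet (e ∷ P)) C h))
    where
    split : ∀ {x C} → x ∈ F → Dec (x ∈ˡ e ∷ P) → (∀ {x} → x ∈ F → x ∉ˡ e ∷ P → x ∈ C) → x ∈ edgeSet (e ∷ P) ⊎ x ∈ C
    split x∈F (yes x∈P) from = inj₁ (∈-edgeSet⁺ x∈P)
    split x∈F (no x∉P)  from = inj₂ (from x∈F x∉P)

  decomposes⇒walk : ∀ {P} → Decomposes G e j F P → ∃ λ Q → P ≡ e ∷ Q × Walk j e F Q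
  decomposes⇒walk {P = x ∷ P} ((chain , ≡.refl , l) , un , C , _ , _ , ≡.refl) =
    P , ≡.refl , path⇒walk P chain l un (All.tabulate (λ x∈P → Subset.x∈p∪q⁺ (inj₁ (∈-edgeSet⁺ x∈P))))

  -- Every solution of `Decomposes` is a walk inside `F`, and there is only one, so the first hit of
  -- the search is the right one. The search reaches it because a walk has at most as many edges as
  -- `F`, hence at most `q`.
  walkOf≡ : EdgeFlowTo G e j F → Walk j e F P → walkOf G e j F ≡ e ∷ P
  walkOf≡ {e} {j} {F} {P} flow W = ≡.cong (fromMaybe []) (filter-head (decomposes? G e j F) _
    (List.∈-concatMap⁺ (sequences q) (List.lose (List.∈-upTo⁺ (s≤s (ℕ.≤-trans (walk-length W) (size≤q F)))) (∈-sequences (e ∷ P))))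
    (walk⇒decomposes flow W)
    (λ D → let Q , p , W′ = decomposes⇒walk D in ≡.trans p (≡.cong (e ∷_) (walk-unique flow W′ W))))

  walk-mono : ∀ {F F′ : Subset q} → (∀ {x} → x ∈ F → x ∈ F′) → Walk j e F P → Walk j e F′ P
  walk-mono sub (stop e∈F p)   = stop (sub e∈F) p
  walk-mono sub (step e∈F p W) = step (sub e∈F) p
    (walk-mono (λ h → let x∈ , x≢ = ∈-∖⁻ h in ∈-∖⁺ (sub x∈) x≢) W)

  walk-suffix : ∀ X {g Y} → P ≡ X ++ g ∷ Y → Walk j e F P → Walk j g F Y
  walk-suffix []      ≡.refl (step _ _ W) = walk-mono (proj₁ ∘ ∈-∖⁻) W
  walk-suffix (x ∷ X) ≡.refl (step _ _ W) = walk-mono (proj₁ ∘ ∈-∖⁻) (walk-suffix X ≡.refl W)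

-- Two flows out of one white vertex, and the cycle between their walks

module Loops {n m q : ℕ} (G : Digraph n m q) (color : Fin m → Color) (plabic : IsPlabic G color)
             (loopless : ∀ e → Digraph.src G e ≢ Digraph.tgt G e) where
  open Digraph G
  open Flows G color plabic loopless
  open Walks G color plabic loopless
  open Chain src tgt using (Chained)

  Internal : Vertex n m → Set
  Internal u = ∃ λ v → u ≡ inj₂ v

  private
    variable
      j : Fin n
      e f g : Fin q
      F : Subset q
      P Q : List (Fin q)

  -- The start of a flow has one departure more than arrivals; as `e` arrives there, at least two
  -- edges depart.
  other-exit : EdgeFlowTo G f j F → e ∈ F → tgt e ≡ src f → ∃ λ g → g ∈ F × g ≢ f × src g ≡ src f
  other-exit {f} {F = F} ((f∈F , _ , start , _) , _) e∈F p =
    let g , g∈ , r = through-witness src (ℕ.≤-trans (through-positive tgt e∈F p)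
                       (ℕ.≤-reflexive (ℕ.suc-injective (≡.trans start (through-∖ src f∈F ≡.refl)))))
        g∈F , g≢f = ∈-∖⁻ g∈
    in g , g∈F , g≢f , r

  -- The balance conditions depend on the first edge only through its starting vertex. That vertex
  -- is internal because `e` ends there, so the condition on boundary sources carries over as well.
  other-flow : EdgeFlowTo G f j F → tgt e ≡ src f → g ∈ F → src g ≡ src f → EdgeFlowTo G g j F
  other-flow {f} {F = F} {g = g} ((f∈F , bal , start , sources) , sink) p g∈F r =
    (g∈F , (λ v v≢ → bal v (λ q → v≢ (≡.trans q (≡.sym r)))) ,
     ≡.subst (λ u → suc (arriving G F u) ≡ leaving G F u) (≡.sym r) start , sources′) , sink
    where
    sources′ : ∀ h → h ∈ F → h ≢ g → ∀ i → src h ≢ inj₁ i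
    sources′ h h∈F _ i with h Fin.≟ f
    ... | yes ≡.refl = λ s → boundary-once (≡.trans p s) s
    ... | no h≢f = sources h h∈F h≢f i

  flow-internal : EdgeFlowTo G f j F → e ∈ F → tgt e ≡ src f → ∀ {a} → a ∈ F → Internal (src a)
  flow-internal {f} ((_ , _ , _ , sources) , _) e∈F p {a} a∈F with a Fin.≟ f
  ... | yes ≡.refl = internal-src p
  ... | no a≢f = by (src a) ≡.refl
    where
    by : ∀ u → src a ≡ u → Internal (src a)
    by (inj₁ i) r = contradiction r (sources a a∈F a≢f i)
    by (inj₂ v) r = v , r

  exit-unique : EdgeFlowTo G f j F → tgt e ≡ src f → g ∈ F → g ≢ f → src g ≡ src f →
                ∀ {h} → h ∈ F → h ≢ f → src h ≡ src f → h ≡ g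
  exit-unique flow p g∈F g≢f r h∈F h≢f s = let _ , src-f = internal-src p in
    flow-unique flow h∈F g∈F h≢f g≢f (≡.trans s src-f) (≡.trans r src-f)

  -- With two edges of F leaving it, the vertex is white.

  entry-unique : EdgeFlowTo G f j F → e ∈ F → tgt e ≡ src f → ∀ {a} → a ∈ F → tgt a ≡ tgt e → a ≡ e
  entry-unique {f} {F = F} {e} ((f∈F , _ , start , _) , _) e∈F p {a} a∈F r =
    through-unique tgt one a∈F e∈F (≡.trans r (≡.trans p src-f)) (≡.trans p src-f)
    where
    v = proj₁ (internal-src p)
    src-f = proj₂ (internal-src p)
    one : arriving G F (inj₂ v) ℕ.≤ 1
    one = [ id , (λ le → contradiction (ℕ.≤-trans (s≤s (through-positive tgt e∈F (≡.trans p src-f)))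
      (ℕ.≤-trans (ℕ.≤-reflexive (≡.subst (λ u → suc (arriving G F u) ≡ leaving G F u) src-f start)) le)) λ { (s≤s ()) }) ]′ (narrow F v)

  -- At every vertex that the walk reaches inside `C`, conservation provides a departure in `C`, and
  -- uniqueness of exits makes it the next edge of the walk. Only the start of `f` has two exits,
  -- and `e` is the only way into it. As `C` has no boundary edges, the walk cannot stop before it
  -- uses `e`.
  follow : EdgeFlowTo G f j F → e ∈ F → tgt e ≡ src f → ∀ {C} → Conservative G C → (∀ {x} → x ∈ C → x ∈ F × x ≢ f) →
           ∀ {g F′ P} → (∀ {x} → x ∈ F′ → x ∈ F) → Walk j g F′ P → g ∈ C → e ∈ˡ g ∷ P
  follow {f} {j} {F} {e} flow e∈F p {C} cons C⊆ = go
    where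
    go : ∀ {g F′ P} → (∀ {x} → x ∈ F′ → x ∈ F) → Walk j g F′ P → g ∈ C → e ∈ˡ g ∷ P
    go ⊆F (stop _ r) g∈C = contradiction r (proj₂ (proj₁ cons _ g∈C _))
    go {g} ⊆F (step {f = h} g∈ r W) g∈C with g Fin.≟ e
    ... | yes g≡e = here (≡.sym g≡e)
    ... | no g≢e = there (go (⊆F ∘ proj₁ ∘ ∈-∖⁻) W h∈C)
      where
      h∈F : h ∈ F
      h∈F = ⊆F (proj₁ (∈-∖⁻ (walk-head W)))
      h≢f : h ≢ f
      h≢f ≡.refl = g≢e (entry-unique flow e∈F p (⊆F g∈) (≡.trans r (≡.sym p)))
      h∈C : h ∈ C
      h∈C = let v , src-h = internal-src r
                k , k∈C , src-k = through-witness src (ℕ.≤-trans (through-positive tgt g∈C (≡.trans r src-h))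
                                    (ℕ.≤-reflexive (proj₂ cons v)))
                k∈F , k≢f = C⊆ k∈C
            in ≡.subst (_∈ C) (flow-unique flow k∈F h∈F k≢f h≢f src-k src-h) k∈C

  -- If the walk from `f` misses `e`, then `e` lies in its conservative complement. So does an exit
  -- from `tgt e`, which can only be `g`, and `follow` applies to the walk from `g`.
  loop-side : EdgeFlowTo G f j F → e ∈ F → tgt e ≡ src f → g ∈ F → g ≢ f → src g ≡ src f →
              Walk j f F P → Walk j g F Q → e ∈ˡ f ∷ P ⊎ e ∈ˡ g ∷ Q
  loop-side {f} {j} {F} {e} {g} {P} {Q} flow e∈F p g∈F g≢f r W W′ with any? (e Fin.≟_) (f ∷ P)
  ... | yes e∈ = inj₁ e∈
  ... | no e∉ = inj₂ (follow flow e∈F p cons C⊆ id W′ g∈C)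
    where
    complement = walk-complement flow W
    C = proj₁ complement
    cons = proj₁ (proj₂ complement)
    to = proj₁ (proj₂ (proj₂ complement))
    C⊆ : ∀ {x} → x ∈ C → x ∈ F × x ≢ f
    C⊆ x∈C = proj₁ (to x∈C) , λ { ≡.refl → proj₂ (to x∈C) (here ≡.refl) }
    g∈C : g ∈ C
    g∈C = let v , src-f = internal-src p
              k , k∈C , src-k = through-witness src (ℕ.≤-trans
                                  (through-positive tgt (proj₂ (proj₂ (proj₂ complement)) e∈F e∉) (≡.trans p src-f))
                                  (ℕ.≤-reflexive (proj₂ cons v)))
              k∈F , k≢f = C⊆ k∈C
          in ≡.subst (_∈ C) (exit-unique flow p g∈F g≢f r k∈F k≢f (≡.trans src-k (≡.sym src-f))) k∈C

  chained-prefix : ∀ a X {z Y} → Chained (a ∷ X ++ z ∷ Y) → Chained (a ∷ X ++ z ∷ [])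
  chained-prefix a []      (p ∷ _)  = p ∷ [-]
  chained-prefix a (x ∷ X) (p ∷ ps) = p ∷ chained-prefix x X ps

  unique-prefix : ∀ X {z : Fin q} {Y} → Unique (X ++ z ∷ Y) → Unique (X ++ z ∷ [])
  unique-prefix []      _        = [] ∷ []
  unique-prefix (x ∷ X) (x≢ ∷ u) = All.++⁺ (All.++⁻ˡ X x≢) (All.head (All.++⁻ʳ X x≢) ∷ []) ∷ unique-prefix X u

  unique-suffix : ∀ X {z : Fin q} {Y} → Unique (X ++ z ∷ Y) → All (λ x → x ∉ˡ Y) (X ++ z ∷ [])
  unique-suffix []      (z≢ ∷ _) = (λ z∈Y → All.lookup z≢ z∈Y ≡.refl) ∷ []
  unique-suffix (x ∷ X) (x≢ ∷ u) =
    (λ x∈Y → All.lookup x≢ (List.∈-++⁺ʳ X (there x∈Y)) ≡.refl) ∷ unique-suffix X u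

  distinct-src : ∀ L → Unique L → (∀ {a b} → a ∈ˡ L → b ∈ˡ L → src a ≡ src b → a ≡ b) →
                 AllPairs (λ a b → src a ≢ src b) L
  distinct-src []      _        _   = []
  distinct-src (a ∷ L) (a≢ ∷ u) inj =
    All.tabulate (λ b∈L p → All.lookup a≢ b∈L (inj (here ≡.refl) (there b∈L) p)) ∷
    distinct-src L u (λ a∈L b∈L → inj (there a∈L) (there b∈L))

  chained-internal : ∀ a X z → Chained (a ∷ X ++ z ∷ []) → Internal (tgt z) →
                     All (λ b → Internal (src b)) (a ∷ X ++ z ∷ []) →
                     All (λ b → Internal (src b) × Internal (tgt b)) (a ∷ X ++ z ∷ [])
  chained-internal a []      z (p ∷ _)  z-int (s ∷ t ∷ []) =
    (s , ≡.subst Internal (≡.sym p) t) ∷ (t , z-int) ∷ []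
  chained-internal a (x ∷ X) z (p ∷ ps) z-int (s ∷ ts@(t ∷ _)) =
    (s , ≡.subst Internal (≡.sym p) t) ∷ chained-internal x X z ps z-int ts

  -- The walk from `f` runs once round the cycle `f ∷ X ++ e ∷ []` and then continues as the walk
  -- `g ∷ Y` of the same edge set started at `g`.
  record Loop (j : Fin n) (F : Subset q) (f e g : Fin q) (P : List (Fin q)) : Set where
    field
      {X Y}    : List (Fin q)
      split    : P ≡ X ++ e ∷ g ∷ Y
      rest     : Walk j g F Y
      chained  : Chained (f ∷ X ++ e ∷ [])
      closed   : tgt e ≡ src f
      distinct : AllPairs (λ a b → src a ≢ src b) (f ∷ X ++ e ∷ [])
      internal : All (λ b → Internal (src b) × Internal (tgt b)) (f ∷ X ++ e ∷ [])

  loop : EdgeFlowTo G f j F → e ∈ F → tgt e ≡ src f → g ∈ F → g ≢ f → src g ≡ src f →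
         Walk j f F P → e ∈ˡ f ∷ P → Loop j F f e g P
  loop {f} flow e∈F p g∈F g≢f r W (here ≡.refl) = contradiction (≡.sym p) (loopless f)
  loop {f} {j} {F} {e} {g} {P} flow e∈F p g∈F g≢f r W (there e∈P) with List.∈-∃++ e∈P
  -- The walk cannot end with `e`: nothing departs from a boundary sink, whereas `f` departs from
  -- `tgt e`.
  ... | X , [] , ≡.refl = contradiction (≡.trans (≡.sym p) end-e) (boundary-once end-e)
    where
    end-e : tgt e ≡ inj₁ j
    end-e with walk-suffix X ≡.refl W
    ... | stop _ t = t
  ... | X , h ∷ Y , ≡.refl with walk-suffix X ≡.refl W
  -- The edge after `e` leaves `src f` and is not the already used `f`, which leaves only `g`.
  ...   | step _ s W′ with exit-unique flow p g∈F g≢f r (proj₁ (∈-∖⁻ (walk-head W′)))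
                             (λ h≡f → All.lookup (headAll (walk-distinct W)) (List.∈-++⁺ʳ X (there (here ≡.refl))) (≡.sym h≡f))
                             (≡.trans (≡.sym s) p)
    where
    headAll : ∀ {a x} {A : Set a} {R : A → A → Set x} {y zs} → AllPairs R (y ∷ zs) → All (R y) zs
    headAll (h ∷ _) = h
  ...     | ≡.refl = record
    { split = ≡.refl
    ; rest = walk-mono (proj₁ ∘ ∈-∖⁻) W′
    ; chained = chain
    ; closed = p
    ; distinct = distinct-src (f ∷ X ++ e ∷ []) (unique-prefix (f ∷ X) (walk-distinct W)) injective
    ; internal = chained-internal f X e chain (≡.subst Internal (≡.sym p) (internal-src p))
                   (All.tabulate (λ a∈ → flow-internal flow e∈F p (in-F a∈)))
    }
    where
    chain = chained-prefix f X (walk-chained W)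
    in-F : ∀ {a} → a ∈ˡ f ∷ X ++ e ∷ [] → a ∈ F
    in-F = All.lookup (All.++⁺ (All.++⁻ˡ (f ∷ X) (walk-all W)) (e∈F ∷ []))
    not-g : ∀ {a} → a ∈ˡ f ∷ X ++ e ∷ [] → a ≢ g
    not-g a∈ ≡.refl = All.lookup (unique-suffix (f ∷ X) (walk-distinct W)) a∈ (here ≡.refl)
    -- Only `f` and `g` leave `src f` within `F`, and `g` comes after the cycle; every other vertex
    -- has a single exit in `F`. Thus distinct edges of the cycle have distinct starts.
    injective : ∀ {a b} → a ∈ˡ f ∷ X ++ e ∷ [] → b ∈ˡ f ∷ X ++ e ∷ [] → src a ≡ src b → a ≡ b
    injective {a} {b} a∈ b∈ s with a Fin.≟ f | b Fin.≟ f
    ... | yes ≡.refl | yes ≡.refl = ≡.refl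
    ... | yes ≡.refl | no b≢f = contradiction (exit-unique flow p g∈F g≢f r (in-F b∈) b≢f (≡.sym s)) (not-g b∈)
    ... | no a≢f | yes ≡.refl = contradiction (exit-unique flow p g∈F g≢f r (in-F a∈) a≢f s) (not-g a∈)
    ... | no a≢f | no b≢f = let v , src-a = flow-internal flow e∈F p (in-F a∈) in
      flow-unique flow (in-F a∈) (in-F b∈) a≢f b≢f src-a (≡.trans (≡.sym s) src-a)

-- Formal power series: shifts, products and inverses

module SeriesAlgebra {c ℓ₁ ℓ₂ : Level} (K : OrderedField c ℓ₁ ℓ₂) where
  open OrderedField K hiding (zero)
  open OverField K
  open OrderedFieldProperties K
  open RingSolver
  open import Algebra.Properties.Ring ring using (-0#≈0#)
  open import Relation.Binary.Reasoning.Setoid setoid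
  open ListSum +-commutativeMonoid public

  infixr 8 [_]_
  -- The Iverson bracket; it turns sums over filtered lists into sums over the full list.
  [_]_ : ∀ {p} {P : Set p} → Dec P → Carrier → Carrier
  [ P? ] x = if does P? then x else 0#

  []-yes : ∀ {p} {P : Set p} (P? : Dec P) → P → ∀ x → [ P? ] x ≈ x
  []-yes P? h x = reflexive (≡.cong (λ b → if b then x else 0#) (dec-true P? h))

  []-no : ∀ {p} {P : Set p} (P? : Dec P) → ¬ P → ∀ x → [ P? ] x ≈ 0#
  []-no P? h x = reflexive (≡.cong (λ b → if b then x else 0#) (dec-false P? h))

  []-cong : ∀ {p} {P : Set p} (P? : Dec P) {x y} → (P → x ≈ y) → [ P? ] x ≈ [ P? ] y
  []-cong (yes p) h = h p
  []-cong (no _)  h = refl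

  []-zero : ∀ {p} {P : Set p} (P? : Dec P) {x} → (P → x ≈ 0#) → [ P? ] x ≈ 0#
  []-zero (yes p) h = h p
  []-zero (no _)  h = refl

  []-* : ∀ {p} {P : Set p} (P? : Dec P) x y → [ P? ] x * y ≈ [ P? ] (x * y)
  []-* P? x y with does P?
  ... | true  = refl
  ... | false = zeroˡ y

  *-[] : ∀ {p} {P : Set p} (P? : Dec P) x y → x * [ P? ] y ≈ [ P? ] (x * y)
  *-[] P? x y with does P?
  ... | true  = refl
  ... | false = zeroʳ x

  []-iff : ∀ {p r} {P : Set p} {R : Set r} (P? : Dec P) (R? : Dec R) → (P → R) → (R → P) →
           ∀ {x y} → (P → x ≈ y) → [ P? ] x ≈ [ R? ] y
  []-iff (yes p) (yes _) to from h = h p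
  []-iff (yes p) (no ¬r) to from h = contradiction (to p) ¬r
  []-iff (no ¬p) (yes r) to from h = contradiction (from r) ¬p
  []-iff (no _)  (no _)  to from h = refl

  sum-[] : ∀ {a p} {A : Set a} {P : Set p} (P? : Dec P) (f : A → Carrier) xs → sum xs (λ x → [ P? ] f x) ≈ [ P? ] sum xs f
  sum-[] P? f xs with does P?
  ... | true  = refl
  ... | false = sum-ε xs (λ _ → refl)

  sum-*ˡ : ∀ {a} {A : Set a} (f : A → Carrier) y xs → y * sum xs f ≈ sum xs (λ x → y * f x)
  sum-*ˡ f y []       = zeroʳ y
  sum-*ˡ f y (x ∷ xs) = trans (distribˡ y _ _) (+-congˡ (sum-*ˡ f y xs))

  sum-*ʳ : ∀ {a} {A : Set a} (f : A → Carrier) y xs → sum xs f * y ≈ sum xs (λ x → f x * y)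
  sum-*ʳ f y xs = trans (*-comm _ y) (trans (sum-*ˡ f y xs) (sum-cong xs (λ x → *-comm y (f x))))

  sum-cong-All : ∀ {a} {A : Set a} {f g : A → Carrier} {xs} → All (λ x → f x ≈ g x) xs → sum xs f ≈ sum xs g
  sum-cong-All []       = refl
  sum-cong-All (h ∷ hs) = +-cong h (sum-cong-All hs)

  sum-pair : ∀ {k} (h : Fin k → Carrier) {f g} → f ≢ g → (∀ x → x ≢ f → x ≢ g → h x ≈ 0#) →
             sum (allFin k) h ≈ h f + h g
  sum-pair h {f} {g} f≢g others = begin
    sum (allFin _) h
      ≈⟨ sum-cong (allFin _) divide ⟩
    sum (allFin _) (λ x → [ x Fin.≟ f ] h x + [ ¬? (x Fin.≟ f) ] h x)
      ≈⟨ sum-∙ (λ x → [ x Fin.≟ f ] h x) (λ x → [ ¬? (x Fin.≟ f) ] h x) (allFin _) ⟩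
    sum (allFin _) (λ x → [ x Fin.≟ f ] h x) + sum (allFin _) (λ x → [ ¬? (x Fin.≟ f) ] h x)
      ≈⟨ +-cong (trans (sum-single _ f (λ x x≢f → []-no (x Fin.≟ f) x≢f (h x))) ([]-yes (f Fin.≟ f) ≡.refl (h f)))
                (trans (sum-single _ g (λ x x≢g → []-zero (¬? (x Fin.≟ f)) (λ x≢f → others x x≢f x≢g)))
                       ([]-yes (¬? (g Fin.≟ f)) (f≢g ∘ ≡.sym) (h g))) ⟩
    h f + h g ∎
    where
    divide : ∀ x → h x ≈ [ x Fin.≟ f ] h x + [ ¬? (x Fin.≟ f) ] h x
    divide x with does (x Fin.≟ f)
    ... | true  = sym (+-identityʳ _)
    ... | false = sym (+-identityˡ _)

  sum-upTo : ∀ k (f : ℕ → Carrier) → sum (upTo (suc k)) f ≈ f 0 + sum (upTo k) (f ∘ suc)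
  sum-upTo k f = +-congˡ (reflexive (≡.trans (≡.cong (λ xs → sum xs f) (≡.sym (List.map-applyUpTo id suc k))) (sum-map f suc (upTo k))))

  sum-upTo-last : ∀ k (f : ℕ → Carrier) → sum (upTo (suc k)) f ≈ sum (upTo k) f + f k
  sum-upTo-last zero    f = trans (+-identityʳ _) (sym (+-identityˡ _))
  sum-upTo-last (suc k) f = trans (sum-upTo (suc k) f) (trans (+-congˡ (sum-upTo-last k (f ∘ suc)))
    (trans (sym (+-assoc _ _ _)) (+-congʳ (sym (sum-upTo k f)))))

  sum-splits : ∀ a (α : Vec ℕ q) (h : Vec ℕ (suc q) × Vec ℕ (suc q) → Carrier) →
               sum (splits (a ∷ α)) h ≈ sum (upTo (suc a)) (λ k → sum (splits α) (λ (β , γ) → h (k ∷ β , (a ∸ k) ∷ γ)))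
  sum-splits a α h = sum-product h _ (upTo (suc a)) (splits α)

  splits-degree : ∀ (α : Vec ℕ q) → All (λ (β , γ) → Vec.sum β ℕ.+ Vec.sum γ ≡ Vec.sum α) (splits α)
  splits-degree []      = ≡.refl ∷ []
  splits-degree (a ∷ α) = All.tabulate degree
    where
    degree : ∀ {s} → s ∈ˡ splits (a ∷ α) → Vec.sum (proj₁ s) ℕ.+ Vec.sum (proj₂ s) ≡ a ℕ.+ Vec.sum α
    degree s∈ with List.∈-cartesianProductWith⁻ _ (upTo (suc a)) (splits α) s∈
    ... | k , (β , γ) , k∈ , βγ∈ , ≡.refl = ≡.trans (interchange k (Vec.sum β) (a ∸ k) (Vec.sum γ))
      (≡.cong₂ ℕ._+_ (ℕ.m+[n∸m]≡n (ℕ.≤-pred (List.∈-upTo⁻ k∈))) (All.lookup (splits-degree α) βγ∈))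
      where open import Algebra.Properties.CommutativeSemigroup ℕ.+-commutativeSemigroup using (interchange)

  -- S is T times the variable e.

  Shift : Fin q → Series q → Series q → Set ℓ₁
  Shift e S T = (∀ α → lookup α e ≡ 0 → S α ≈ 0#) × (∀ α → S (α [ e ]%= suc) ≈ T α)

  -- In the first coordinate the product is a sum over its share k: the term k = 0 vanishes and the
  -- others are renumbered. For a later coordinate each summand is again a product of series in the
  -- remaining variables.
  shift-*ˢ : ∀ (e : Fin q) {S T} → Shift e S T → ∀ B → Shift e (S *ˢ B) (T *ˢ B)
  shift-*ˢ {suc q} zero {S} {T} (vanish , grow) B = vanish′ , grow′
    where
    row : ∀ a k (α : Vec ℕ q) → Carrier
    row a k α = sum (splits α) (λ (β , γ) → S (k ∷ β) * B ((a ∸ k) ∷ γ))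
    row-zero : ∀ a α → row a 0 α ≈ 0#
    row-zero a α = sum-ε (splits α) (λ (β , γ) → trans (*-congʳ (vanish (0 ∷ β) ≡.refl)) (zeroˡ _))
    vanish′ : ∀ α → lookup α zero ≡ 0 → (S *ˢ B) α ≈ 0#
    vanish′ (.0 ∷ α) ≡.refl = trans (sum-splits 0 α _) (trans (+-identityʳ _) (row-zero 0 α))
    grow′ : ∀ α → (S *ˢ B) (α [ zero ]%= suc) ≈ (T *ˢ B) α
    grow′ (a ∷ α) = begin
      sum (splits (suc a ∷ α)) _                       ≈⟨ sum-splits (suc a) α _ ⟩
      sum (upTo (suc (suc a))) (λ k → row (suc a) k α) ≈⟨ sum-upTo (suc a) _ ⟩
      row (suc a) 0 α + sum (upTo (suc a)) (λ k → row (suc a) (suc k) α)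
        ≈⟨ +-cong (row-zero (suc a) α) (sum-cong (upTo (suc a)) (λ k → sum-cong (splits α) (λ (β , γ) → *-congʳ (grow (k ∷ β))))) ⟩
      0# + sum (upTo (suc a)) (λ k → sum (splits α) (λ (β , γ) → T (k ∷ β) * B ((a ∸ k) ∷ γ)))
        ≈⟨ +-identityˡ _ ⟩
      sum (upTo (suc a)) (λ k → sum (splits α) (λ (β , γ) → T (k ∷ β) * B ((a ∸ k) ∷ γ)))
        ≈⟨ sum-splits a α _ ⟨
      (T *ˢ B) (a ∷ α) ∎
  shift-*ˢ {suc q} (suc e) {S} {T} (vanish , grow) B = vanish′ , grow′
    where
    inner : ∀ a k → Shift e ((S ∘ (k ∷_)) *ˢ (B ∘ ((a ∸ k) ∷_))) ((T ∘ (k ∷_)) *ˢ (B ∘ ((a ∸ k) ∷_)))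
    inner a k = shift-*ˢ e ((λ α → vanish (k ∷ α)) , (λ α → grow (k ∷ α))) _
    vanish′ : ∀ α → lookup α (suc e) ≡ 0 → (S *ˢ B) α ≈ 0#
    vanish′ (a ∷ α) p = trans (sum-splits a α _) (sum-ε (upTo (suc a)) (λ k → proj₁ (inner a k) α p))
    grow′ : ∀ α → (S *ˢ B) (α [ suc e ]%= suc) ≈ (T *ˢ B) α
    grow′ (a ∷ α) = trans (sum-splits a (α [ e ]%= suc) _) (trans (sum-cong (upTo (suc a)) (λ k → proj₂ (inner a k) α)) (sym (sum-splits a α _)))

  *ˢ-congˡ : ∀ {S T : Series q} B → S ≈ˢ T → S *ˢ B ≈ˢ T *ˢ B
  *ˢ-congˡ B h α = sum-cong (splits α) (λ (β , γ) → *-congʳ (h β))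

  -- The series 1 defined by recursion on the exponent vector, in step with `splits`.
  δ : Series q
  δ []          = 1#
  δ (zero ∷ α)  = δ α
  δ (suc _ ∷ α) = 0#

  1ˢ≈[] : ∀ (α : Vec ℕ q) → 1ˢ α ≈ [ Vec.≡-dec ℕ._≟_ (Vec.replicate _ 0) α ] 1#
  1ˢ≈[] α = trans (sum-filter (λ (_ , β) → Vec.≡-dec ℕ._≟_ β α) proj₁ ((1# , Vec.replicate _ 0) ∷ [])) (+-identityʳ _)

  1ˢ≈δ : ∀ (α : Vec ℕ q) → 1ˢ α ≈ δ α
  1ˢ≈δ α = trans (1ˢ≈[] α) (go α)
    where
    go : ∀ {q} (α : Vec ℕ q) → [ Vec.≡-dec ℕ._≟_ (Vec.replicate _ 0) α ] 1# ≈ δ α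
    go []          = refl
    go (zero ∷ α)  = trans ([]-iff (Vec.≡-dec ℕ._≟_ (Vec.replicate _ 0) (0 ∷ α)) (Vec.≡-dec ℕ._≟_ (Vec.replicate _ 0) α)
      Vec.∷-injectiveʳ (≡.cong (0 ∷_)) (λ _ → refl)) (go α)
    go (suc a ∷ α) = []-no (Vec.≡-dec ℕ._≟_ (Vec.replicate _ 0) (suc a ∷ α)) (λ ()) 1#

  1ˢ-constant : ∀ q → 1ˢ (Vec.replicate q 0) ≈ 1#
  1ˢ-constant q = trans (1ˢ≈δ (Vec.replicate q 0)) (δ-constant q)
    where
    δ-constant : ∀ q → δ (Vec.replicate q 0) ≈ 1#
    δ-constant zero    = refl
    δ-constant (suc q) = δ-constant q

  δ-*ˢ : ∀ (B : Series q) → δ *ˢ B ≈ˢ B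
  δ-*ˢ B []      = trans (+-identityʳ _) (*-identityˡ _)
  δ-*ˢ B (a ∷ α) = begin
    (δ *ˢ B) (a ∷ α)            ≈⟨ sum-splits a α _ ⟩
    sum (upTo (suc a)) row      ≈⟨ sum-upTo a _ ⟩
    row 0 + sum (upTo a) (row ∘ suc)
      ≈⟨ +-cong (δ-*ˢ (B ∘ (a ∷_)) α) (sum-ε (upTo a) (λ k → sum-ε (splits α) (λ (β , γ) → zeroˡ _))) ⟩
    B (a ∷ α) + 0#              ≈⟨ +-identityʳ _ ⟩
    B (a ∷ α)                   ∎
    where
    row : ℕ → Carrier
    row k = sum (splits α) (λ (β , γ) → δ (k ∷ β) * B ((a ∸ k) ∷ γ))

  1ˢ-*ˢ : ∀ (B : Series q) → 1ˢ *ˢ B ≈ˢ B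
  1ˢ-*ˢ B α = trans (*ˢ-congˡ B 1ˢ≈δ α) (δ-*ˢ B α)

  -ˢ-*ˢ : ∀ (S T B : Series q) α → ((S -ˢ T) *ˢ B) α ≈ (S *ˢ B) α - (T *ˢ B) α
  -ˢ-*ˢ S T B α = begin
    sum (splits α) (λ (β , γ) → (S β - T β) * B γ)
      ≈⟨ sum-cong (splits α) (λ (β , γ) → solve 3 (λ s t b → (s :- t) :* b := s :* b :+ con -[1+ 0 ] :* (t :* b)) refl (S β) (T β) (B γ)) ⟩
    sum (splits α) (λ (β , γ) → S β * B γ + (- 1#) * (T β * B γ))
      ≈⟨ sum-∙ _ _ (splits α) ⟩
    (S *ˢ B) α + sum (splits α) (λ (β , γ) → (- 1#) * (T β * B γ))
      ≈⟨ +-congˡ (sym (sum-*ˡ _ (- 1#) (splits α))) ⟩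
    (S *ˢ B) α + (- 1#) * (T *ˢ B) α
      ≈⟨ solve 2 (λ s t → s :+ con -[1+ 0 ] :* t := s :- t) refl ((S *ˢ B) α) ((T *ˢ B) α) ⟩
    (S *ˢ B) α - (T *ˢ B) α ∎

  sum≡0⇒replicate : ∀ (α : Vec ℕ q) → Vec.sum α ≡ 0 → α ≡ Vec.replicate _ 0
  sum≡0⇒replicate []         p = ≡.refl
  sum≡0⇒replicate (zero ∷ α) p = ≡.cong (0 ∷_) (sum≡0⇒replicate α p)

  module Inverse {q : ℕ} (D : Series q) (D₀ : D (Vec.replicate _ 0) ≈ 1#) where

    power : ℕ → Series q
    power = powˢ (1ˢ -ˢ D)

    -- The series `1ˢ -ˢ D` has no constant term, so its `k`-th power starts in degree `k`.
    power-vanishes : ∀ k α → Vec.sum α ℕ.< k → power k α ≈ 0#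
    power-vanishes (suc k) α (s≤s α≤k) = trans (sum-cong-All {g = λ _ → 0#} (All.map term (splits-degree α))) (sum-ε (splits α) (λ _ → refl))
      where
      term : ∀ {s} → Vec.sum (proj₁ s) ℕ.+ Vec.sum (proj₂ s) ≡ Vec.sum α → (1ˢ -ˢ D) (proj₁ s) * power k (proj₂ s) ≈ 0#
      term {β , γ} deg with Vec.sum γ ℕ.<? k
      ... | yes γ<k = trans (*-congˡ (power-vanishes k γ γ<k)) (zeroʳ _)
      ... | no γ≮k = trans (*-congʳ constant) (zeroˡ _)
        where
        -- The degrees satisfy |β| + |γ| = |α| ≤ k ≤ |γ|, so the first factor is taken at its
        -- constant term.
        β₀ : Vec.sum β ≡ 0
        β₀ = ℕ.n≤0⇒n≡0 (ℕ.+-cancelʳ-≤ (Vec.sum γ) _ 0 (ℕ.≤-trans (ℕ.≤-reflexive deg) (ℕ.≤-trans α≤k (ℕ.≮⇒≥ γ≮k))))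
        constant : 1ˢ β - D β ≈ 0#
        constant rewrite sum≡0⇒replicate β β₀ = trans (+-cong (1ˢ-constant q) (-‿cong D₀)) (-‿inverseʳ 1#)

    D-power : ∀ k α → (D *ˢ power k) α ≈ power k α - power (suc k) α
    D-power k α = begin
      (D *ˢ power k) α
        ≈⟨ solve 2 (λ x y → y := x :- (x :- y)) refl (power k α) ((D *ˢ power k) α) ⟩
      power k α - (power k α - (D *ˢ power k) α)
        ≈⟨ +-congˡ (-‿cong (+-congʳ (sym (1ˢ-*ˢ (power k) α)))) ⟩
      power k α - ((1ˢ *ˢ power k) α - (D *ˢ power k) α)
        ≈⟨ +-congˡ (-‿cong (sym (-ˢ-*ˢ 1ˢ D (power k) α))) ⟩
      power k α - power (suc k) α ∎

    telescoping : ∀ k α → sum (upTo k) (λ l → power l α - power (suc l) α) ≈ power 0 α - power k α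
    telescoping zero    α = sym (-‿inverseʳ _)
    telescoping (suc k) α = trans (sum-upTo-last k _) (trans (+-congʳ (telescoping k α))
      (solve 3 (λ x y z → (x :- y) :+ (y :- z) := x :- z) refl (power 0 α) (power k α) (power (suc k) α)))

    -- The cut-off in `inverseˢ` depends on the degree of the coefficient. Further terms are zero,
    -- so all the coefficients that meet in a product may use one common cut-off.
    more-terms : ∀ j γ → sum (upTo (suc (Vec.sum γ) ℕ.+ j)) (λ l → power l γ) ≈ inverseˢ D γ
    more-terms zero    γ = reflexive (≡.cong (λ b → sum (upTo b) (λ l → power l γ)) (ℕ.+-identityʳ (suc (Vec.sum γ))))
    more-terms (suc j) γ = trans (reflexive (≡.cong (λ b → sum (upTo b) (λ l → power l γ)) (ℕ.+-suc (suc (Vec.sum γ)) j)))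
      (trans (sum-upTo-last (suc (Vec.sum γ) ℕ.+ j) _)
      (trans (+-cong (more-terms j γ) (power-vanishes _ γ (s≤s (ℕ.m≤m+n (Vec.sum γ) j)))) (+-identityʳ _)))

    -- Since `D` is one minus `1ˢ -ˢ D`, the geometric sum telescopes; the last power is of higher
    -- order than the degree of `α` and vanishes there.
    inverse-*ˢ : D *ˢ inverseˢ D ≈ˢ 1ˢ
    inverse-*ˢ α = begin
      (D *ˢ inverseˢ D) α
        ≈⟨ sum-cong-All (All.map (λ {s} deg → *-congˡ (sym (extend s deg))) (splits-degree α)) ⟩
      sum (splits α) (λ (β , γ) → D β * sum (upTo (suc (Vec.sum α))) (λ l → power l γ))
        ≈⟨ sum-cong (splits α) (λ (β , γ) → sum-*ˡ _ (D β) (upTo (suc (Vec.sum α)))) ⟩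
      sum (splits α) (λ (β , γ) → sum (upTo (suc (Vec.sum α))) (λ l → D β * power l γ))
        ≈⟨ sum-swap _ (splits α) (upTo (suc (Vec.sum α))) ⟩
      sum (upTo (suc (Vec.sum α))) (λ l → (D *ˢ power l) α)
        ≈⟨ sum-cong (upTo (suc (Vec.sum α))) (λ l → D-power l α) ⟩
      sum (upTo (suc (Vec.sum α))) (λ l → power l α - power (suc l) α)
        ≈⟨ telescoping (suc (Vec.sum α)) α ⟩
      1ˢ α - power (suc (Vec.sum α)) α
        ≈⟨ +-congˡ (trans (-‿cong (power-vanishes _ α ℕ.≤-refl)) -0#≈0#) ⟩
      1ˢ α + 0#   ≈⟨ +-identityʳ _ ⟩
      1ˢ α        ∎
      where
      extend : ∀ s → Vec.sum (proj₁ s) ℕ.+ Vec.sum (proj₂ s) ≡ Vec.sum α →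
               sum (upTo (suc (Vec.sum α))) (λ l → power l (proj₂ s)) ≈ inverseˢ D (proj₂ s)
      extend (β , γ) deg = trans
        (reflexive (≡.cong (λ d → sum (upTo (suc d)) (λ l → power l γ)) (≡.trans (≡.sym deg) (ℕ.+-comm (Vec.sum β) _))))
        (more-terms (Vec.sum β) γ)

-- Exponent vectors of edge sets and of paths

χ : Subset q → Vec ℕ q
χ = flowExponents

bit-injective : ∀ {a b} → bit a ≡ bit b → a ≡ b
bit-injective {false} {false} _ = ≡.refl
bit-injective {true}  {true}  _ = ≡.refl

χ-injective : ∀ {F F′ : Subset q} → χ F ≡ χ F′ → F ≡ F′
χ-injective {F = []}    {[]}      _ = ≡.refl
χ-injective {F = a ∷ F} {b ∷ F′} p =
  ≡.cong₂ _∷_ (bit-injective (Vec.∷-injectiveˡ p)) (χ-injective (Vec.∷-injectiveʳ p))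

-- Decides whether a monomial is squarefree; no other monomials occur in the numerators and the
-- denominator.
χ? : ∀ (α : Vec ℕ q) → Dec (∃ λ F → χ F ≡ α)
χ? []                = yes ([] , ≡.refl)
χ? (suc (suc a) ∷ α) = no λ { ((false ∷ F) , ()) ; ((true ∷ F) , ()) }
χ? (zero ∷ α)        = map′ (λ (F , p) → outside ∷ F , ≡.cong (0 ∷_) p)
  (λ { ((false ∷ F) , p) → F , Vec.∷-injectiveʳ p ; ((true ∷ F) , ()) }) (χ? α)
χ? (suc zero ∷ α)    = map′ (λ (F , p) → inside ∷ F , ≡.cong (1 ∷_) p)
  (λ { ((true ∷ F) , p) → F , Vec.∷-injectiveʳ p ; ((false ∷ F) , ()) }) (χ? α)

lookup-χ : ∀ (F : Subset q) e → lookup (χ F) e ≡ bit (lookup F e)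
lookup-χ F e = Vec.lookup-map e bit F

χ-⊕ : ∀ {F : Subset q} {e} → e ∉ F → χ F [ e ]%= suc ≡ χ (F ⊕ e)
χ-⊕ {F = false ∷ F} {zero}  e∉F = ≡.refl
χ-⊕ {F = true ∷ F}  {zero}  e∉F = contradiction Vec.here e∉F
χ-⊕ {F = b ∷ F}     {suc e} e∉F = ≡.cong (bit b ∷_) (χ-⊕ (e∉F ∘ Vec.there))

χ-suc : ∀ (α : Vec ℕ q) e {F} → χ F ≡ α [ e ]%= suc → χ (F ∖ e) ≡ α × e ∈ F
χ-suc (zero ∷ α)  zero    {true ∷ F}  p = ≡.cong (0 ∷_) (Vec.∷-injectiveʳ p) , Vec.here
χ-suc (suc a ∷ α) zero    {true ∷ F}  ()
χ-suc (a ∷ α)     zero    {false ∷ F} ()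
χ-suc (a ∷ α)     (suc e) {b ∷ F}     p =
  let r , e∈F = χ-suc α e (Vec.∷-injectiveʳ p) in ≡.cong₂ _∷_ (Vec.∷-injectiveˡ p) r , Vec.there e∈F

sum-suc : ∀ (α : Vec ℕ q) e → Vec.sum (α [ e ]%= suc) ≡ suc (Vec.sum α)
sum-suc (a ∷ α) zero    = ≡.refl
sum-suc (a ∷ α) (suc e) = ≡.trans (≡.cong (a ℕ.+_) (sum-suc α e)) (ℕ.+-suc a _)

lookup-suc : ∀ (α : Vec ℕ q) e → lookup α e ≡ 0 ⊎ ∃ λ β → α ≡ β [ e ]%= suc
lookup-suc (zero ∷ α)  zero    = inj₁ ≡.refl
lookup-suc (suc a ∷ α) zero    = inj₂ (a ∷ α , ≡.refl)
lookup-suc (a ∷ α)     (suc e) with lookup-suc α e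
... | inj₁ p        = inj₁ p
... | inj₂ (β , p)  = inj₂ (a ∷ β , ≡.cong (a ∷_) p)

[]%=suc-injective : ∀ (α β : Vec ℕ q) e → α [ e ]%= suc ≡ β [ e ]%= suc → α ≡ β
[]%=suc-injective (a ∷ α) (b ∷ β) zero    p = ≡.cong₂ _∷_ (ℕ.suc-injective (Vec.∷-injectiveˡ p)) (Vec.∷-injectiveʳ p)
[]%=suc-injective (a ∷ α) (b ∷ β) (suc e) p = ≡.cong₂ _∷_ (Vec.∷-injectiveˡ p) ([]%=suc-injective α β e (Vec.∷-injectiveʳ p))

pathExponents-∷ : ∀ (e : Fin q) P → pathExponents (e ∷ P) ≡ pathExponents P [ e ]%= suc
pathExponents-∷ {q} e P = ≡.sym (≡.trans (≡.sym (Vec.tabulate∘lookup _)) (Vec.tabulate-cong pointwise))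
  where
  pointwise : ∀ f → lookup (pathExponents P [ e ]%= suc) f ≡ length (filter (f Fin.≟_) (e ∷ P))
  pointwise f with f Fin.≟ e
  ... | yes ≡.refl = ≡.trans (Vec.lookup∘updateAt f (pathExponents P)) (≡.cong suc (Vec.lookup∘tabulate _ f))
  ... | no f≢e = ≡.trans (Vec.lookup∘updateAt′ f e f≢e (pathExponents P)) (Vec.lookup∘tabulate _ f)

lookup-pathExponents : ∀ (e : Fin q) P → lookup (pathExponents (e ∷ P)) e ≢ 0
lookup-pathExponents e P p = contradiction
  (≡.trans (≡.sym (Vec.lookup∘updateAt e (pathExponents P))) (≡.trans (≡.cong (λ α → lookup α e) (≡.sym (pathExponents-∷ e P))) p)) λ ()

-- Signs of paths and the linear system

xor-rearrange : ∀ w t c s → (w xor t) xor (c xor s) ≡ c xor (w xor (t xor s))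
xor-rearrange = solve 4 (λ w t c s → (w :+ t) :+ (c :+ s) := c :+ (w :+ (t :+ s))) ≡.refl
  where open xor-∧-Solver

xor-regroup : ∀ w t v s c d → w xor ((t xor (v xor s)) xor (c xor d)) ≡ ((t xor w) xor c) xor (v xor (s xor d))
xor-regroup = solve 6 (λ w t v s c d → w :+ ((t :+ (v :+ s)) :+ (c :+ d)) := ((t :+ w) :+ c) :+ (v :+ (s :+ d))) ≡.refl
  where open xor-∧-Solver

module FlowSeries {c ℓ₁ ℓ₂ ℓ : Level} (K : OrderedField c ℓ₁ ℓ₂) {n m q : ℕ}
                  (N : OverField.Network K ℓ n m q) where
  open OrderedField K hiding (zero)
  open OverField K
  open OrderedFieldProperties K
  open RingSolver
  open SeriesAlgebra K
  open Network N
  open NetworkGeometry K N using (wind; cycle-odd)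
  open Chain src tgt using (turns)
  open Flows graph color isPlabic nondegenerate
  open Walks graph color isPlabic nondegenerate
  open Loops graph color isPlabic nondegenerate
  open import Algebra.Properties.Ring ring using (-0#≈0#)
  open import Algebra.Properties.Semiring.Exp semiring using (_^_)
  open import Relation.Binary.Reasoning.Setoid setoid

  sgn : Bool → Carrier
  sgn b = if b then - 1# else 1#

  sgn-not : ∀ b → sgn (not b) ≈ - sgn b
  sgn-not false = refl
  sgn-not true  = solve 0 (con (+ 1) := :- (:- con (+ 1))) refl

  sgn-xor : ∀ a b → sgn (a xor b) ≈ sgn a * sgn b
  sgn-xor false b = sym (*-identityˡ _)
  sgn-xor true  b = trans (sgn-not b) (solve 1 (λ x → :- x := :- con (+ 1) :* x) refl (sgn b))

  power-sgn : ∀ k → (- 1#) ^ k ≈ sgn (odd k)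
  power-sgn zero    = refl
  power-sgn (suc k) = trans (*-congˡ (power-sgn k)) (sym (sgn-xor true (odd k)))

  crossings : Fin q → Bool
  crossings e = odd (int N e)

  parity : List (Fin q) → Bool
  parity P = turns wind P xor xorSum crossings P

  sign-parity : ∀ P → sign N P ≈ sgn (parity P)
  sign-parity P = trans (power-sgn ℤ.∣ windPath N P ℤ.+ + intPath N P ∣) (reflexive (≡.cong sgn
    (≡.trans (oddℤ-+ (windPath N P) (+ intPath N P)) (≡.cong₂ _xor_ (winding P) (intersections P)))))
    where
    winding : ∀ P → oddℤ (windPath N P) ≡ turns wind P
    winding []          = ≡.refl
    winding (e ∷ [])    = ≡.refl
    winding (e ∷ f ∷ P) = ≡.trans (oddℤ-+ (windEdges N e f) _) (≡.cong (wind e f xor_) (winding (f ∷ P)))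
    intersections : ∀ P → odd (intPath N P) ≡ xorSum crossings P
    intersections []      = ≡.refl
    intersections (e ∷ P) = ≡.trans (odd-+ (int N e) _) (≡.cong (crossings e xor_) (intersections P))

  sign-single : ∀ e → sign N (e ∷ []) ≈ sgn (crossings e)
  sign-single e = trans (sign-parity (e ∷ [])) (reflexive (≡.cong sgn (Bool.xor-identityʳ (crossings e))))

  sign-∷ : ∀ e f P → sign N (e ∷ f ∷ P) ≈ sgn (crossings e) * (sgn (wind e f) * sign N (f ∷ P))
  sign-∷ e f P = begin
    sign N (e ∷ f ∷ P)
      ≈⟨ sign-parity (e ∷ f ∷ P) ⟩
    sgn ((wind e f xor t) xor (crossings e xor s))
      ≡⟨ ≡.cong sgn (xor-rearrange (wind e f) t (crossings e) s) ⟩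
    sgn (crossings e xor (wind e f xor (t xor s)))
      ≈⟨ trans (sgn-xor (crossings e) _) (*-congˡ (sgn-xor (wind e f) _)) ⟩
    sgn (crossings e) * (sgn (wind e f) * sgn (t xor s))
      ≈⟨ *-congˡ (*-congˡ (sign-parity (f ∷ P))) ⟨
    sgn (crossings e) * (sgn (wind e f) * sign N (f ∷ P)) ∎
    where
    t = turns wind (f ∷ P)
    s = xorSum crossings (f ∷ P)

  turns-++ : ∀ f X e g Y → turns wind (f ∷ X ++ e ∷ g ∷ Y) ≡
             turns wind (f ∷ X ++ e ∷ []) xor (wind e g xor turns wind (g ∷ Y))
  turns-++ f []      e g Y = ≡.trans (≡.sym (Bool.xor-assoc (wind f e) (wind e g) _))
    (≡.trans (Bool.xor-assoc (wind f e) (wind e g) _) (≡.cong (_xor (wind e g xor turns wind (g ∷ Y))) (≡.sym (Bool.xor-identityʳ (wind f e)))))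
  turns-++ f (x ∷ X) e g Y = ≡.trans (≡.cong (wind f x xor_) (turns-++ x X e g Y)) (≡.sym (Bool.xor-assoc (wind f x) _ _))

  -- The factor for `e` followed by `f` closes the corner at which the cycle begins and ends, so the
  -- whole parity of the cycle, which is odd, splits off. What remains is `e` followed directly by
  -- the walk from `g`.
  loop-sign : ∀ {j F f e g P} (L : Loop j F f e g P) →
              sgn (wind e f) * sign N (f ∷ P) ≈ - (sgn (wind e g) * sign N (g ∷ Loop.Y L))
  loop-sign {f = f} {e} {g} L@(record { X = X ; Y = Y ; split = ≡.refl }) = begin
    sgn (wind e f) * sign N (f ∷ X ++ e ∷ g ∷ Y)
      ≈⟨ *-congˡ (sign-parity (f ∷ X ++ e ∷ g ∷ Y)) ⟩
    sgn (wind e f) * sgn (parity (f ∷ X ++ e ∷ g ∷ Y))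
      ≈⟨ sgn-xor (wind e f) _ ⟨
    sgn (wind e f xor parity (f ∷ X ++ e ∷ g ∷ Y))
      ≡⟨ ≡.cong sgn odd-loop ⟩
    sgn (not (wind e g xor parity (g ∷ Y)))
      ≈⟨ trans (sgn-not _) (-‿cong (sgn-xor (wind e g) _)) ⟩
    - (sgn (wind e g) * sgn (parity (g ∷ Y)))
      ≈⟨ -‿cong (*-congˡ (sign-parity (g ∷ Y))) ⟨
    - (sgn (wind e g) * sign N (g ∷ Y)) ∎
    where
    C = f ∷ X ++ e ∷ []
    xorSum-split : xorSum crossings (f ∷ X ++ e ∷ g ∷ Y) ≡ xorSum crossings C xor xorSum crossings (g ∷ Y)
    xorSum-split = ≡.trans (≡.cong (xorSum crossings) (≡.sym (List.++-assoc (f ∷ X) (e ∷ []) (g ∷ Y)))) (xorSum-++ crossings C (g ∷ Y))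
    odd-loop : wind e f xor parity (f ∷ X ++ e ∷ g ∷ Y) ≡ not (wind e g xor parity (g ∷ Y))
    odd-loop = ≡.trans (≡.cong (wind e f xor_) (≡.cong₂ _xor_ (turns-++ f X e g Y) xorSum-split))
      (≡.trans (xor-regroup (wind e f) (turns wind C) (wind e g) (turns wind (g ∷ Y)) (xorSum crossings C) (xorSum crossings (g ∷ Y)))
        (≡.cong (_xor (wind e g xor parity (g ∷ Y)))
          (cycle-odd f X e (Loop.chained L) (Loop.closed L) (Loop.distinct L) (Loop.internal L))))

  module _ (j : Fin n) where

    -- The right-hand side of the linear system for a single coefficient. The factor w_e is left
    -- out, since `Shift` accounts for it.
    combine : Fin q → (Fin q → Carrier) → Carrier → Carrier
    combine e a d = sgn (crossings e) * (sum (allFin q) (λ f → [ tgt e ≟ᵥ src f ] (sgn (wind e f) * a f))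
                                         + [ tgt e ≟ᵥ inj₁ j ] d)

    combine-cong : ∀ e {a a′ d d′} → (∀ f → tgt e ≡ src f → a f ≈ a′ f) → (tgt e ≡ inj₁ j → d ≈ d′) →
                   combine e a d ≈ combine e a′ d′
    combine-cong e a≈ d≈ = *-congˡ (+-cong
      (sum-cong (allFin q) (λ f → []-cong (tgt e ≟ᵥ src f) (λ p → *-congˡ (a≈ f p))))
      ([]-cong (tgt e ≟ᵥ inj₁ j) d≈))

    combine-*ʳ : ∀ e a d y → combine e a d * y ≈ combine e (λ f → a f * y) (d * y)
    combine-*ʳ e a d y = begin
      sgn (crossings e) * (sum (allFin q) move + final) * y
        ≈⟨ trans (*-assoc (sgn (crossings e)) _ y) (*-congˡ (distribʳ y _ final)) ⟩
      sgn (crossings e) * (sum (allFin q) move * y + final * y)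
        ≈⟨ *-congˡ (+-cong (sum-*ʳ move y (allFin q)) ([]-* (tgt e ≟ᵥ inj₁ j) d y)) ⟩
      sgn (crossings e) * (sum (allFin q) (λ f → move f * y) + [ tgt e ≟ᵥ inj₁ j ] (d * y))
        ≈⟨ *-congˡ (+-congʳ (sum-cong (allFin q) λ f → trans ([]-* (tgt e ≟ᵥ src f) (sgn (wind e f) * a f) y)
             ([]-cong (tgt e ≟ᵥ src f) (λ _ → *-assoc (sgn (wind e f)) (a f) y)))) ⟩
      combine e (λ f → a f * y) (d * y) ∎
      where
      move : Fin q → Carrier
      move f = [ tgt e ≟ᵥ src f ] (sgn (wind e f) * a f)
      final : Carrier
      final = [ tgt e ≟ᵥ inj₁ j ] d

    combine-sum : ∀ {x} {X : Set x} e (a : X → Fin q → Carrier) (d : X → Carrier) xs →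
                  sum xs (λ s → combine e (a s) (d s)) ≈ combine e (λ f → sum xs (λ s → a s f)) (sum xs d)
    combine-sum e a d xs = begin
      sum xs (λ s → sgn (crossings e) * (inner s + [ tgt e ≟ᵥ inj₁ j ] d s))
        ≈⟨ sum-*ˡ (λ s → inner s + [ tgt e ≟ᵥ inj₁ j ] d s) (sgn (crossings e)) xs ⟨
      sgn (crossings e) * sum xs (λ s → inner s + [ tgt e ≟ᵥ inj₁ j ] d s)
        ≈⟨ *-congˡ (sum-∙ inner (λ s → [ tgt e ≟ᵥ inj₁ j ] d s) xs) ⟩
      sgn (crossings e) * (sum xs inner + sum xs (λ s → [ tgt e ≟ᵥ inj₁ j ] d s))
        ≈⟨ *-congˡ (+-cong collect (sum-[] (tgt e ≟ᵥ inj₁ j) d xs)) ⟩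
      combine e (λ f → sum xs (λ s → a s f)) (sum xs d) ∎
      where
      inner : _ → Carrier
      inner s = sum (allFin q) (λ f → [ tgt e ≟ᵥ src f ] (sgn (wind e f) * a s f))
      collect : sum xs inner ≈ sum (allFin q) (λ f → [ tgt e ≟ᵥ src f ] (sgn (wind e f) * sum xs (λ s → a s f)))
      collect = begin
        sum xs inner
          ≈⟨ sum-swap (λ s f → [ tgt e ≟ᵥ src f ] (sgn (wind e f) * a s f)) xs (allFin q) ⟩
        sum (allFin q) (λ f → sum xs (λ s → [ tgt e ≟ᵥ src f ] (sgn (wind e f) * a s f)))
          ≈⟨ sum-cong (allFin q) (λ f → sum-[] (tgt e ≟ᵥ src f) (λ s → sgn (wind e f) * a s f) xs) ⟩
        sum (allFin q) (λ f → [ tgt e ≟ᵥ src f ] sum xs (λ s → sgn (wind e f) * a s f))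
          ≈⟨ sum-cong (allFin q) (λ f → []-cong (tgt e ≟ᵥ src f)
               (λ _ → sum-*ˡ (λ s → a s f) (sgn (wind e f)) xs)) ⟨
        sum (allFin q) (λ f → [ tgt e ≟ᵥ src f ] (sgn (wind e f) * sum xs (λ s → a s f))) ∎

    next : Series q → (Fin q → Series q) → Fin q → Series q
    next D A e α = combine e (λ f → A f α) (D α)

    -- Splitting off the first edge of a path gives this linear system, with 1
    -- in place of D; edge flows satisfy it with D the denominator.

    System : Series q → (Fin q → Series q) → Set ℓ₁
    System D A = ∀ e → Shift e (A e) (next D A e)

    -- Induction on the total degree: a coefficient without the variable `e` vanishes, and any other
    -- one is expressed by coefficients of degree one less.
    system-unique : ∀ {D D′ A A′} → System D A → System D′ A′ → D ≈ˢ D′ → ∀ e → A e ≈ˢ A′ e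
    system-unique {D} {D′} {A} {A′} sys sys′ D≈ e α = go (Vec.sum α) e α ≡.refl
      where
      go   : ∀ k e α → Vec.sum α ≡ k → A e α ≈ A′ e α
      grow : ∀ k e β → Vec.sum (β [ e ]%= suc) ≡ k → next D A e β ≈ next D′ A′ e β
      go k e α s = [ (λ zero-e → trans (proj₁ (sys e) α zero-e) (sym (proj₁ (sys′ e) α zero-e)))
                   , (λ (β , p) → ≡.subst (λ α → A e α ≈ A′ e α) (≡.sym p) (begin
                       A e (β [ e ]%= suc)    ≈⟨ proj₂ (sys e) β ⟩
                       next D A e β           ≈⟨ grow k e β (≡.trans (≡.cong Vec.sum (≡.sym p)) s) ⟩
                       next D′ A′ e β         ≈⟨ proj₂ (sys′ e) β ⟨
                       A′ e (β [ e ]%= suc)   ∎)) ]′ (lookup-suc α e)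
      grow zero    e β s = contradiction (≡.trans (≡.sym s) (sum-suc β e)) λ ()
      grow (suc k) e β s = combine-cong e {λ f → A f β} {λ f → A′ f β} {D β} {D′ β}
        (λ f _ → go k f β (ℕ.suc-injective (≡.trans (≡.sym (sum-suc β e)) s))) (λ _ → D≈ β)

    -- `combine` is linear in both arguments and so commutes with the convolution sum. With the
    -- inverse of `D` for `B`, the inhomogeneous term becomes 1.
    system-*ˢ : ∀ {D A} B → System D A → System (D *ˢ B) (λ e → A e *ˢ B)
    system-*ˢ {D} {A} B sys e = let vanish , grow = shift-*ˢ e (sys e) B in
      vanish , λ α → trans (grow α) (begin
        (next D A e *ˢ B) α
          ≈⟨ sum-cong (splits α) (λ (β , γ) → combine-*ʳ e (λ f → A f β) (D β) (B γ)) ⟩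
        sum (splits α) (λ (β , γ) → combine e (λ f → A f β * B γ) (D β * B γ))
          ≈⟨ combine-sum e (λ (β , γ) f → A f β * B γ) (λ (β , γ) → D β * B γ) (splits α) ⟩
        next (D *ˢ B) (λ e → A e *ˢ B) e α ∎)

-- Path series and flow polynomials solve the system

module Recurrences {c ℓ₁ ℓ₂ ℓ : Level} (K : OrderedField c ℓ₁ ℓ₂) {n m q : ℕ}
                   (N : OverField.Network K ℓ n m q) (j : Fin n) where
  open OrderedField K hiding (zero)
  open OverField K
  open SeriesAlgebra K
  open Network N
  open NetworkGeometry K N using (wind)
  open Flows graph color isPlabic nondegenerate
  open Walks graph color isPlabic nondegenerate
  open Loops graph color isPlabic nondegenerate
  open FlowSeries K N
  open import Relation.Binary.Reasoning.Setoid setoid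

  combine-none : ∀ e {a d} → (∀ f → tgt e ≡ src f → a f ≈ 0#) → (tgt e ≡ inj₁ j → d ≈ 0#) → combine j e a d ≈ 0#
  combine-none e {a} {d} a≈0 d≈0 = trans (*-congˡ (trans (+-cong
      (sum-ε (allFin q) (λ f → []-zero (tgt e ≟ᵥ src f) (λ p → trans (*-congˡ (a≈0 f p)) (zeroʳ _))))
      ([]-zero (tgt e ≟ᵥ inj₁ j) d≈0)) (+-identityʳ 0#))) (zeroʳ (sgn (crossings e)))

  combine-last : ∀ e {a d} → tgt e ≡ inj₁ j → combine j e a d ≈ sgn (crossings e) * d
  combine-last e {a} {d} p = *-congˡ (trans (+-cong
      (sum-ε (allFin q) (λ f → []-no (tgt e ≟ᵥ src f) (λ r → boundary-once p (≡.trans (≡.sym r) p)) (sgn (wind e f) * a f)))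
      ([]-yes (tgt e ≟ᵥ inj₁ j) p d)) (+-identityˡ d))

  combine-step : ∀ e f {a d} → tgt e ≡ src f → (∀ g → tgt e ≡ src g → g ≢ f → a g ≈ 0#) →
                 combine j e a d ≈ sgn (crossings e) * (sgn (wind e f) * a f)
  combine-step e f {a} {d} p others = *-congˡ (trans (+-cong
      (trans (sum-single (λ g → [ tgt e ≟ᵥ src g ] (sgn (wind e g) * a g)) f
        (λ g g≢f → []-zero (tgt e ≟ᵥ src g) (λ r → trans (*-congˡ (others g r g≢f)) (zeroʳ (sgn (wind e g))))))
        ([]-yes (tgt e ≟ᵥ src f) p (sgn (wind e f) * a f)))
      ([]-no (tgt e ≟ᵥ inj₁ j) (λ r → boundary-once r (≡.trans (≡.sym p) r)) d)) (+-identityʳ _))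

  exponents? : ∀ (P : List (Fin q)) α → Dec (pathExponents P ≡ α)
  exponents? P α = Vec.≡-dec ℕ._≟_ (pathExponents P) α

  path? : ∀ e P α → Dec (IsPath graph e j P × pathExponents P ≡ α)
  path? e P α = isPath? graph e j P ×-dec exponents? P α

  pathTerm : Fin q → Vec ℕ q → List (Fin q) → Carrier
  pathTerm e α P = [ path? e P α ] sign N P

  -- Removing the first edge of a path with a single edge leaves the empty list, which is not a path
  -- because it has no first edge. Its contribution 1, in degree zero only, is what makes the system
  -- inhomogeneous.
  emptyTerm : Vec ℕ q → List (Fin q) → Carrier
  emptyTerm α []      = [ exponents? [] α ] 1#
  emptyTerm α (_ ∷ _) = 0#

  pathTerm-[] : ∀ e α → pathTerm e α [] ≈ 0#
  pathTerm-[] e α = []-no (path? e [] α) (λ { ((_ , () , _) , _) }) (sign N [])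

  pathTerm-≢ : ∀ {e f} α P → f ≢ e → pathTerm e α (f ∷ P) ≈ 0#
  pathTerm-≢ {e} {f} α P f≢e = []-no (path? e (f ∷ P) α) (λ { ((_ , ≡.refl , _) , _) → f≢e ≡.refl }) (sign N (f ∷ P))

  exponents⁺ : ∀ {e : Fin q} {P α} → pathExponents P ≡ α → pathExponents (e ∷ P) ≡ α [ e ]%= suc
  exponents⁺ {e} {P} p = ≡.trans (pathExponents-∷ e P) (≡.cong (_[ e ]%= suc) p)

  exponents⁻ : ∀ {e : Fin q} {P α} → pathExponents (e ∷ P) ≡ α [ e ]%= suc → pathExponents P ≡ α
  exponents⁻ {e} {P} {α} p = []%=suc-injective (pathExponents P) α e (≡.trans (≡.sym (pathExponents-∷ e P)) p)

  pathTerm-step : ∀ e α P → pathTerm e (α [ e ]%= suc) (e ∷ P) ≈ combine j e (λ f → pathTerm f α P) (emptyTerm α P)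
  pathTerm-step e α [] = by (tgt e ≟ᵥ inj₁ j)
    where
    by : Dec (tgt e ≡ inj₁ j) → pathTerm e (α [ e ]%= suc) (e ∷ []) ≈ combine j e (λ f → pathTerm f α []) (emptyTerm α [])
    by (yes p) = begin
      pathTerm e (α [ e ]%= suc) (e ∷ [])
        ≈⟨ []-iff (path? e (e ∷ []) (α [ e ]%= suc)) (exponents? [] α)
             (λ (_ , r) → exponents⁻ {e} {[]} r) (λ r → ([-] , ≡.refl , ≡.cong just p) , exponents⁺ {e} {[]} r)
             (λ _ → trans (sign-single e) (sym (*-identityʳ _))) ⟩
      [ exponents? [] α ] (sgn (crossings e) * 1#)   ≈⟨ *-[] (exponents? [] α) (sgn (crossings e)) 1# ⟨
      sgn (crossings e) * emptyTerm α []             ≈⟨ combine-last e {λ f → pathTerm f α []} p ⟨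
      combine j e (λ f → pathTerm f α []) (emptyTerm α []) ∎
    by (no ¬p) = trans
      ([]-no (path? e (e ∷ []) (α [ e ]%= suc)) (λ ((_ , _ , r) , _) → ¬p (Maybe.just-injective r)) (sign N (e ∷ [])))
      (sym (combine-none e {λ f → pathTerm f α []} (λ f _ → pathTerm-[] f α) (λ r → contradiction r ¬p)))
  pathTerm-step e α (f ∷ P) = by (tgt e ≟ᵥ src f)
    where
    by : Dec (tgt e ≡ src f) → pathTerm e (α [ e ]%= suc) (e ∷ f ∷ P) ≈ combine j e (λ g → pathTerm g α (f ∷ P)) 0#
    by (yes p) = begin
      pathTerm e (α [ e ]%= suc) (e ∷ f ∷ P)
        ≈⟨ []-iff (path? e (e ∷ f ∷ P) (α [ e ]%= suc)) (path? f (f ∷ P) α)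
             (λ { ((_ ∷ l , _ , r) , s) → (l , ≡.refl , r) , exponents⁻ {e} {f ∷ P} s })
             (λ ((l , _ , r) , s) → (p ∷ l , ≡.refl , r) , exponents⁺ {e} {f ∷ P} s)
             (λ _ → trans (sign-∷ e f P) (sym (*-assoc _ _ _))) ⟩
      [ path? f (f ∷ P) α ] (sgn (crossings e) * sgn (wind e f) * sign N (f ∷ P))
        ≈⟨ *-[] (path? f (f ∷ P) α) (sgn (crossings e) * sgn (wind e f)) (sign N (f ∷ P)) ⟨
      sgn (crossings e) * sgn (wind e f) * pathTerm f α (f ∷ P)
        ≈⟨ *-assoc (sgn (crossings e)) (sgn (wind e f)) (pathTerm f α (f ∷ P)) ⟩
      sgn (crossings e) * (sgn (wind e f) * pathTerm f α (f ∷ P))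
        ≈⟨ combine-step e f {λ g → pathTerm g α (f ∷ P)} p (λ g _ g≢f → pathTerm-≢ α P (g≢f ∘ ≡.sym)) ⟨
      combine j e (λ g → pathTerm g α (f ∷ P)) 0# ∎
    by (no ¬p) = trans
      ([]-no (path? e (e ∷ f ∷ P) (α [ e ]%= suc)) (λ { ((r ∷ _ , _) , _) → ¬p r }) (sign N (e ∷ f ∷ P)))
      (sym (combine-none e {λ g → pathTerm g α (f ∷ P)}
        (λ g r → pathTerm-≢ {g} {f} α P (λ { ≡.refl → ¬p r })) (λ _ → refl)))

  pathSeries-terms : ∀ e α → pathSeries N e j α ≈ sum (sequences q (Vec.sum α)) (pathTerm e α)
  pathSeries-terms e α = sum-filter (λ P → path? e P α) (sign N) (sequences q (Vec.sum α))

  emptyTerms : ∀ α → sum (sequences q (Vec.sum α)) (emptyTerm α) ≈ 1ˢ α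
  emptyTerms α = by (Vec.sum α) ≡.refl
    where
    []-exponents : pathExponents {q} [] ≡ Vec.replicate q 0
    []-exponents = ≡.trans (Vec.tabulate-cong (λ f → ≡.sym (Vec.lookup-replicate f 0))) (Vec.tabulate∘lookup _)
    sum-replicate : ∀ q → Vec.sum (Vec.replicate q 0) ≡ 0
    sum-replicate zero    = ≡.refl
    sum-replicate (suc q) = sum-replicate q
    by : ∀ k → Vec.sum α ≡ k → sum (sequences q k) (emptyTerm α) ≈ 1ˢ α
    by zero p = begin
      emptyTerm α [] + 0#    ≈⟨ +-identityʳ (emptyTerm α []) ⟩
      emptyTerm α []         ≈⟨ []-iff (exponents? [] α) (Vec.≡-dec ℕ._≟_ (Vec.replicate q 0) α)
                                  (≡.trans (≡.sym []-exponents)) (≡.trans []-exponents) (λ _ → refl) ⟩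
      [ Vec.≡-dec ℕ._≟_ (Vec.replicate q 0) α ] 1#   ≈⟨ 1ˢ≈[] α ⟨
      1ˢ α                   ∎
    by (suc k) p = trans (sum-product (emptyTerm α) _∷_ (allFin q) (sequences q k))
      (trans (sum-ε (allFin q) (λ e → sum-ε (sequences q k) (λ P → refl)))
      (sym (trans (1ˢ≈[] α) ([]-no (Vec.≡-dec ℕ._≟_ (Vec.replicate q 0) α)
        (λ { ≡.refl → contradiction (≡.trans (≡.sym p) (sum-replicate q)) λ () }) 1#))))

  paths-system : System j 1ˢ (λ e → pathSeries N e j)
  paths-system e = vanish , grow
    where
    vanish : ∀ α → lookup α e ≡ 0 → pathSeries N e j α ≈ 0#
    vanish α z = trans (pathSeries-terms e α) (sum-ε (sequences q (Vec.sum α)) term)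
      where
      term : ∀ P → pathTerm e α P ≈ 0#
      term []      = pathTerm-[] e α
      term (f ∷ P) = []-no (path? e (f ∷ P) α)
        (λ { ((_ , ≡.refl , _) , ≡.refl) → lookup-pathExponents e P z }) (sign N (f ∷ P))
    grow : ∀ α → pathSeries N e j (α [ e ]%= suc) ≈ next j 1ˢ (λ e → pathSeries N e j) e α
    grow α = begin
      pathSeries N e j (α [ e ]%= suc)
        ≈⟨ pathSeries-terms e (α [ e ]%= suc) ⟩
      sum (sequences q (Vec.sum (α [ e ]%= suc))) (pathTerm e (α [ e ]%= suc))
        -- Raising the exponent of `e` by one lengthens the sequences by one edge, so a head can be
        -- split off from each of them.
        ≡⟨ ≡.cong (λ k → sum (sequences q k) (pathTerm e (α [ e ]%= suc))) (sum-suc α e) ⟩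
      sum (sequences q (suc l)) (pathTerm e (α [ e ]%= suc))
        ≈⟨ sum-product (pathTerm e (α [ e ]%= suc)) _∷_ (allFin q) (sequences q l) ⟩
      sum (allFin q) (λ f → sum (sequences q l) (λ P → pathTerm e (α [ e ]%= suc) (f ∷ P)))
        ≈⟨ sum-single _ e (λ f f≢e → sum-ε (sequences q l) (λ P → pathTerm-≢ (α [ e ]%= suc) P f≢e)) ⟩
      sum (sequences q l) (λ P → pathTerm e (α [ e ]%= suc) (e ∷ P))
        ≈⟨ sum-cong (sequences q l) (pathTerm-step e α) ⟩
      sum (sequences q l) (λ P → combine j e (λ f → pathTerm f α P) (emptyTerm α P))
        ≈⟨ combine-sum j e (λ P f → pathTerm f α P) (emptyTerm α) (sequences q l) ⟩
      combine j e (λ f → sum (sequences q l) (pathTerm f α)) (sum (sequences q l) (emptyTerm α))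
        ≈⟨ combine-cong j e (λ f _ → sym (pathSeries-terms f α)) (λ _ → emptyTerms α) ⟩
      next j 1ˢ (λ e → pathSeries N e j) e α ∎
      where l = Vec.sum α

  subsets-single : ∀ {k} (h : Subset k → Carrier) F → (∀ F′ → F′ ≢ F → h F′ ≈ 0#) → sum (subsets k) h ≈ h F
  subsets-single {zero}  h []      _      = +-identityʳ (h [])
  subsets-single {suc k} h (b ∷ F) others = trans (sum-product h _∷_ (inside ∷ outside ∷ []) (subsets k)) (by b ≡.refl)
    where
    row : ∀ a → a ≡ b → sum (subsets k) (λ F′ → h (a ∷ F′)) ≈ h (a ∷ F)
    row a a≡b = subsets-single (λ F′ → h (a ∷ F′)) F (λ F′ F′≢F → others (a ∷ F′) (F′≢F ∘ Vec.∷-injectiveʳ))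
    empty-row : ∀ a → a ≢ b → sum (subsets k) (λ F′ → h (a ∷ F′)) ≈ 0#
    empty-row a a≢b = sum-ε (subsets k) (λ F′ → others (a ∷ F′) (a≢b ∘ Vec.∷-injectiveˡ))
    by : ∀ a → a ≡ b → sum (subsets k) (λ F′ → h (true ∷ F′)) + (sum (subsets k) (λ F′ → h (false ∷ F′)) + 0#) ≈ h (b ∷ F)
    by true  ≡.refl = trans (+-cong (row true ≡.refl) (trans (+-identityʳ _) (empty-row false λ ()))) (+-identityʳ _)
    by false ≡.refl = trans (+-cong (empty-row true λ ()) (trans (+-identityʳ _) (row false ≡.refl))) (+-identityˡ _)

  module _ {p} {P : Subset q → Set p} (P? : ∀ F → Dec (P F)) (weigh : Subset q → Carrier) where

    -- Both `numerator` and `denominator` are of this form by definition.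
    flowPolynomial : Polynomial q
    flowPolynomial = List.map (λ F → weigh F , flowExponents F) (filter P? (subsets q))

    χ≟ : ∀ (F : Subset q) (α : Vec ℕ q) → Dec (χ F ≡ α)
    χ≟ F α = Vec.≡-dec ℕ._≟_ (χ F) α

    coefficient : ∀ α → toSeries flowPolynomial α ≈ sum (subsets q) (λ F → [ P? F ] [ χ≟ F α ] weigh F)
    coefficient α = begin
      toSeries flowPolynomial α
        ≈⟨ sum-filter (λ (_ , β) → Vec.≡-dec ℕ._≟_ β α) proj₁ flowPolynomial ⟩
      sum flowPolynomial (λ (a , β) → [ Vec.≡-dec ℕ._≟_ β α ] a)
        ≡⟨ sum-map (λ (a , β) → [ Vec.≡-dec ℕ._≟_ β α ] a) (λ F → weigh F , flowExponents F) (filter P? (subsets q)) ⟩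
      sum (filter P? (subsets q)) (λ F → [ χ≟ F α ] weigh F)
        ≈⟨ sum-filter P? (λ F → [ χ≟ F α ] weigh F) (subsets q) ⟩
      sum (subsets q) (λ F → [ P? F ] [ χ≟ F α ] weigh F) ∎

    -- Different edge sets have different monomials, so the coefficient has only one candidate.
    coefficient-χ : ∀ F → toSeries flowPolynomial (χ F) ≈ [ P? F ] weigh F
    coefficient-χ F = trans (coefficient (χ F)) (trans
      (subsets-single (λ F′ → [ P? F′ ] [ χ≟ F′ (χ F) ] weigh F′) F
        (λ F′ F′≢F → []-zero (P? F′) (λ _ → []-no (χ≟ F′ (χ F)) (F′≢F ∘ χ-injective) (weigh F′))))
      ([]-cong (P? F) (λ _ → []-yes (χ≟ F (χ F)) ≡.refl (weigh F))))

    coefficient-zero : ∀ α → (∀ F → χ F ≡ α → ¬ P F) → toSeries flowPolynomial α ≈ 0#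
    coefficient-zero α none = trans (coefficient α) (sum-ε (subsets q) (λ F → []-zero (P? F)
      (λ PF → []-no (χ≟ F α) (λ p → none F p PF) (weigh F))))

  num : Fin q → Series q
  num e = toSeries (numerator N e j)

  den : Series q
  den = toSeries (denominator N)

  num-flow : ∀ {e F P} → EdgeFlowTo graph e j F → Walk j e F P → num e (χ F) ≈ sign N (e ∷ P)
  num-flow {e} {F} flow W = trans (coefficient-χ (edgeFlowTo? graph e j) (λ F → sign N (walkOf graph e j F)) F)
    (trans ([]-yes (edgeFlowTo? graph e j F) flow (sign N (walkOf graph e j F))) (reflexive (≡.cong (sign N) (walkOf≡ flow W))))

  num-zero : ∀ e α → (∀ F → χ F ≡ α → ¬ EdgeFlowTo graph e j F) → num e α ≈ 0#
  num-zero e = coefficient-zero (edgeFlowTo? graph e j) (λ F → sign N (walkOf graph e j F))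

  num-none : ∀ {e F} → ¬ EdgeFlowTo graph e j F → num e (χ F) ≈ 0#
  num-none {e} {F} ¬flow = num-zero e (χ F) (λ F′ p flow → ¬flow (≡.subst (EdgeFlowTo graph e j) (χ-injective p) flow))

  den-one : ∀ {F} → Conservative graph F → den (χ F) ≈ 1#
  den-one {F} cons = trans (coefficient-χ (conservative? graph) (λ _ → 1#) F) ([]-yes (conservative? graph F) cons 1#)

  den-zero : ∀ α → (∀ F → χ F ≡ α → ¬ Conservative graph F) → den α ≈ 0#
  den-zero = coefficient-zero (conservative? graph) (λ _ → 1#)

  den-none : ∀ {F} → ¬ Conservative graph F → den (χ F) ≈ 0#
  den-none {F} ¬cons = den-zero (χ F) (λ F′ p cons → ¬cons (≡.subst (Conservative graph) (χ-injective p) cons))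

  combine-cancel : ∀ e f g {a d} → tgt e ≡ src f → tgt e ≡ src g → f ≢ g →
                   (∀ h → tgt e ≡ src h → h ≢ f → h ≢ g → a h ≈ 0#) →
                   sgn (wind e f) * a f ≈ - (sgn (wind e g) * a g) → combine j e a d ≈ 0#
  combine-cancel e f g {a} {d} p r f≢g others opposite = trans (*-congˡ (trans (+-cong
      (trans (sum-pair (λ h → [ tgt e ≟ᵥ src h ] (sgn (wind e h) * a h)) f≢g
        (λ h h≢f h≢g → []-zero (tgt e ≟ᵥ src h) (λ s → trans (*-congˡ (others h s h≢f h≢g)) (zeroʳ (sgn (wind e h))))))
      (trans (+-cong ([]-yes (tgt e ≟ᵥ src f) p (sgn (wind e f) * a f)) ([]-yes (tgt e ≟ᵥ src g) r (sgn (wind e g) * a g)))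
      (trans (+-congʳ opposite) (-‿inverseˡ (sgn (wind e g) * a g)))))
      ([]-no (tgt e ≟ᵥ inj₁ j) (λ s → boundary-once s (≡.trans (≡.sym p) s)) d)) (+-identityʳ 0#)))
    (zeroʳ (sgn (crossings e)))

  swap-sign : ∀ {x y} → x ≈ - y → y ≈ - x
  swap-sign {x} {y} h = trans (sym (-‿involutive y)) (-‿cong (sym h))
    where open import Algebra.Properties.Ring ring using (-‿involutive)

  -- One of the two walks runs round the cycle. The local `opened` treats it as the walk from `f`;
  -- the other case follows by exchanging `f` and `g`, since the claim is symmetric.
  exits-opposite : ∀ {e f g F} → EdgeFlowTo graph f j F → e ∈ F → tgt e ≡ src f → g ∈ F → g ≢ f → src g ≡ src f →
                   sgn (wind e f) * num f (χ F) ≈ - (sgn (wind e g) * num g (χ F))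
  exits-opposite {e} {f} {g} {F} flow e∈F p g∈F g≢f r = by (loop-side flow e∈F p g∈F g≢f r W W′)
    where
    flow′ : EdgeFlowTo graph g j F
    flow′ = other-flow flow p g∈F r
    walk : ∃ λ P → Walk j f F P
    walk = walk-exists flow
    walk′ : ∃ λ P → Walk j g F P
    walk′ = walk-exists flow′
    W = proj₂ walk
    W′ = proj₂ walk′
    opened : ∀ {f g P} → EdgeFlowTo graph f j F → EdgeFlowTo graph g j F → tgt e ≡ src f →
             g ≢ f → src g ≡ src f → Walk j f F P → e ∈ˡ f ∷ P →
             sgn (wind e f) * num f (χ F) ≈ - (sgn (wind e g) * num g (χ F))
    opened {f} {g} {P} flow flow′ p g≢f r W e∈P = begin
      sgn (wind e f) * num f (χ F)                    ≈⟨ *-congˡ (num-flow flow W) ⟩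
      sgn (wind e f) * sign N (f ∷ P)                 ≈⟨ loop-sign L ⟩
      - (sgn (wind e g) * sign N (g ∷ Loop.Y L))      ≈⟨ -‿cong (*-congˡ (num-flow flow′ (Loop.rest L))) ⟨
      - (sgn (wind e g) * num g (χ F))                ∎
      where
      L : Loop j F f e g P
      L = loop flow e∈F p (proj₁ (proj₁ flow′)) g≢f r W e∈P
    by : e ∈ˡ f ∷ proj₁ walk ⊎ e ∈ˡ g ∷ proj₁ walk′ → sgn (wind e f) * num f (χ F) ≈ - (sgn (wind e g) * num g (χ F))
    by (inj₁ e∈P) = opened flow flow′ p g≢f r W e∈P
    by (inj₂ e∈Q) = swap-sign (opened flow′ flow (≡.trans p (≡.sym r)) (g≢f ∘ ≡.sym) (≡.sym r) W′ e∈Q)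

  -- Three kinds of monomials are compared. If `α` is not squarefree, both sides are zero; otherwise
  -- it is the monomial of an edge set, treated by `repeated` or `extended` according to whether `e`
  -- belongs to it. The vanishing part of `Shift` holds because every flow starting at `e` contains
  -- `e`.
  flows-system : System j den num
  flows-system e = (λ α z → num-zero e α (λ { F ≡.refl ((e∈F , _) , _) → contradiction
      (≡.trans (≡.sym z) (≡.trans (lookup-χ F e) (≡.cong bit (Vec.[]=⇒lookup e∈F)))) λ () })) ,
    λ α → by-support α (χ? α)
    where
    Grow : Vec ℕ q → Set ℓ₁
    Grow α = num e (α [ e ]%= suc) ≈ next j den num e α

    -- The monomial contains the square of e, so no edge flow contributes on the
    -- left; on the right the two ways out of the white vertex tgt e cancel.

    repeated : ∀ G → e ∈ G → Grow (χ G)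
    repeated G e∈G = trans
      (num-zero e (χ G [ e ]%= suc) (λ F p _ → let r , _ = χ-suc (χ G) e p in
        proj₂ (∈-∖⁻ (≡.subst (e ∈_) (≡.sym (χ-injective r)) e∈G)) ≡.refl))
      (sym (by (Fin.any? (λ f → (tgt e ≟ᵥ src f) ×-dec edgeFlowTo? graph f j G))))
      where
      by : Dec (∃ λ f → tgt e ≡ src f × EdgeFlowTo graph f j G) → next j den num e (χ G) ≈ 0#
      by (no none) = combine-none e {λ f → num f (χ G)} {den (χ G)} (λ f p → num-none (λ flow → none (f , p , flow)))
        (λ p → den-none (λ (boundary , _) → proj₂ (boundary e e∈G j) p))
      by (yes (f , p , flow)) =
        let g , g∈G , g≢f , r = other-exit flow e∈G p in
        combine-cancel e f g {λ f → num f (χ G)} {den (χ G)} p (≡.trans p (≡.sym r)) (g≢f ∘ ≡.sym)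
          (λ h s h≢f h≢g → num-none (λ { ((h∈G , _) , _) →
            h≢g (exit-unique flow p g∈G g≢f r h∈G h≢f (≡.trans (≡.sym s) p)) }))
          (exits-opposite flow e∈G p g∈G g≢f r)

    -- Here at most one term survives on either side: if `G ⊕ e` is a flow starting at `e`, its walk
    -- singles out the next edge or ends at the sink. If it is not, neither can `G` be a flow from a
    -- next edge, or conservative with `e` ending at the sink.
    extended : ∀ G → e ∉ G → Grow (χ G)
    extended G e∉G = trans (reflexive (≡.cong (num e) (χ-⊕ e∉G))) (by (edgeFlowTo? graph e j (G ⊕ e)))
      where
      rest : (G ⊕ e) ∖ e ≡ G
      rest = ⊕-∖ e∉G
      by-walk : ∀ {P} → EdgeFlowTo graph e j (G ⊕ e) → Walk j e (G ⊕ e) P → num e (χ (G ⊕ e)) ≈ next j den num e (χ G)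
      by-walk flow W@(stop _ p) = begin
        num e (χ (G ⊕ e))                ≈⟨ trans (num-flow flow W) (sign-single e) ⟩
        sgn (crossings e)                ≈⟨ *-identityʳ _ ⟨
        sgn (crossings e) * 1#           ≈⟨ *-congˡ (den-one (≡.subst (Conservative graph) rest (last→ flow p))) ⟨
        sgn (crossings e) * den (χ G)    ≈⟨ combine-last e {λ f → num f (χ G)} p ⟨
        next j den num e (χ G)           ∎
      by-walk flow W@(step {f = f} {P = P} _ p W′) = begin
        num e (χ (G ⊕ e))                                             ≈⟨ trans (num-flow flow W) (sign-∷ e f P) ⟩
        sgn (crossings e) * (sgn (wind e f) * sign N (f ∷ P))
          ≈⟨ *-congˡ (*-congˡ (num-flow (≡.subst (EdgeFlowTo graph f j) rest (step→ flow p f∈))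
               (≡.subst (λ F → Walk j f F P) rest W′))) ⟨
        sgn (crossings e) * (sgn (wind e f) * num f (χ G))
          ≈⟨ combine-step e f {λ f → num f (χ G)} {den (χ G)} p (λ g r g≢f → num-none (λ { ((g∈G , _) , _) →
               g≢f (successor-unique flow (proj₁ (∈-∖⁻ (≡.subst (g ∈_) (≡.sym rest) g∈G))) f∈ r p) })) ⟨
        next j den num e (χ G)                                        ∎
        where
        f∈ : f ∈ G ⊕ e
        f∈ = proj₁ (∈-∖⁻ (walk-head W′))
      by : Dec (EdgeFlowTo graph e j (G ⊕ e)) → num e (χ (G ⊕ e)) ≈ next j den num e (χ G)
      by (yes flow) = by-walk flow (proj₂ (walk-exists flow))
      by (no ¬flow) = trans (num-none ¬flow) (sym (combine-none e {λ f → num f (χ G)} {den (χ G)}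
        (λ f p → num-none (λ flow → ¬flow (step← ∈-⊕ p (≡.subst (EdgeFlowTo graph f j) (≡.sym rest) flow))))
        (λ p → den-none (λ cons → ¬flow (last← ∈-⊕ p (≡.subst (Conservative graph) (≡.sym rest) cons))))))

    by-support : ∀ α → Dec (∃ λ F → χ F ≡ α) → Grow α
    by-support .(χ G) (yes (G , ≡.refl)) = by (e Subset.∈? G)
      where
      by : Dec (e ∈ G) → Grow (χ G)
      by (yes e∈G) = repeated G e∈G
      by (no e∉G)  = extended G e∉G
    by-support α (no none) = trans
      (num-zero e (α [ e ]%= suc) (λ F p _ → none (F ∖ e , proj₁ (χ-suc α e p))))
      (sym (combine-none e {λ f → num f α} {den α}
        (λ f _ → num-zero f α (λ F p _ → none (F , p))) (λ _ → den-zero α (λ F p _ → none (F , p)))))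

-- Division by the denominator, and its positivity

module Quotient {c ℓ₁ ℓ₂ ℓ : Level} (K : OrderedField c ℓ₁ ℓ₂) {n m q : ℕ}
                (N : OverField.Network K ℓ n m q) where
  open OrderedField K hiding (zero)
  open OverField K
  open OrderedFieldProperties K
  open SeriesAlgebra K
  open Network N
  open Flows graph color isPlabic nondegenerate
  open FlowSeries K N
  open import Algebra.Properties.Semiring.Exp semiring using (_^_)

  empty-conservative : Conservative graph Subset.⊥
  empty-conservative = (λ f f∈⊥ → contradiction f∈⊥ Subset.∉⊥) ,
    λ v → ≡.trans (through-zero tgt (λ f f∈⊥ → contradiction f∈⊥ Subset.∉⊥))
                  (≡.sym (through-zero src (λ f f∈⊥ → contradiction f∈⊥ Subset.∉⊥)))

  -- Multiplied by the inverse of the denominator, the flow solution solves the system of the paths,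
  -- and that system has only one solution.
  pathSeries-quotient : ∀ e j → pathSeries N e j ≈ˢ toSeries (numerator N e j) /ˢ toSeries (denominator N)
  pathSeries-quotient e j = system-unique j paths-system
    (system-*ˢ j (inverseˢ den) flows-system) (λ α → sym (Inverse.inverse-*ˢ den constant α)) e
    where
    open Recurrences K N j
    -- The constant coefficient comes from the empty flow; being 1, it makes `inverseˢ den` a true
    -- inverse.
    constant : den (Vec.replicate q 0) ≈ 1#
    constant = ≡.subst (λ α → den α ≈ 1#) (Vec.map-replicate bit outside q) (den-one empty-conservative)

  0<^ : ∀ {x} k → 0# < x → 0# < x ^ k
  0<^ zero    0<x = 0<1
  0<^ (suc k) 0<x = *-pos 0<x (0<^ k 0<x)

  monomial-pos : ∀ (α : Vec ℕ q) fs → 0# < foldr (λ f x → weight f ^ lookup α f * x) 1# fs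
  monomial-pos α []       = 0<1
  monomial-pos α (f ∷ fs) = *-pos (0<^ (lookup α f) (weight-pos f)) (monomial-pos α fs)

  denominator-subtractionFree : SubtractionFree (denominator N)
  denominator-subtractionFree = All.map⁺ (All.universal (λ _ → 0<1) (conservativeFlows graph))

  ∈-subsets : ∀ {k} (F : Subset k) → F ∈ˡ subsets k
  ∈-subsets []          = here ≡.refl
  ∈-subsets (true ∷ F)  = List.∈-cartesianProductWith⁺ _∷_ {xs = inside ∷ outside ∷ []} (here ≡.refl) (∈-subsets F)
  ∈-subsets (false ∷ F) = List.∈-cartesianProductWith⁺ _∷_ {xs = inside ∷ outside ∷ []} (there (here ≡.refl)) (∈-subsets F)

  -- The list must have a member, since an empty sum would be zero; for the denominator the empty
  -- flow is one.
  evaluate-pos : ∀ {C} Cs → C ∈ˡ Cs → 0# < evaluate weight (List.map (λ C → 1# , flowExponents C) Cs)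
  evaluate-pos (C ∷ [])      _ = 0<+ (*-pos 0<1 (monomial-pos (flowExponents C) (allFin q))) ≤-refl
  evaluate-pos (C ∷ C′ ∷ Cs) _ = +-pos-< (*-pos 0<1 (monomial-pos (flowExponents C) (allFin q)))
    (evaluate-pos (C′ ∷ Cs) (here ≡.refl))

  denominator-pos : 0# < evaluate weight (denominator N)
  denominator-pos = evaluate-pos (conservativeFlows graph)
    (List.∈-filter⁺ (conservative? graph) (∈-subsets Subset.⊥) empty-conservative)

theorem3p12 : ∀ {c ℓ₁ ℓ₂ ℓ : Level} (K : OrderedField c ℓ₁ ℓ₂) →
    let open OrderedField K
        open OverField K
    in ∀ {n m q : ℕ} (N : Network ℓ n m q) (A : Matrix (Network.rank N) n) →
       InCell N A → Represents N A →
       ∀ {d : ℕ} (B : Fin n → Fin d → Carrier) (e : Fin q) →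
         (∀ r → edgeVector N B e r ≈ˢ
                ∑ˢ (sinks (Network.graph N)) (λ j →
                  (toSeries (numerator N e j) /ˢ toSeries (denominator N)) ·ˢ B j r))
       × SubtractionFree (denominator N)
       × 0# < evaluate (Network.weight N) (denominator N)
theorem3p12 K N A _ _ B e =
  (λ r α → sum-cong (sinks (OverField.Network.graph N)) (λ j → *-congʳ (pathSeries-quotient e j α)))
  , denominator-subtractionFree , denominator-pos
  where
  open OrderedField K using (*-congʳ)
  open SeriesAlgebra K using (sum-cong)
  open Quotient K N
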